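{- There is an absolute constant $c>0$ such that the following holds. Let $\ell$ be a positive integer and $k$ a positive integer. Then every finite graph $G$ either contains $k$ edge-disjoint long cycles, or contains a set $X\subseteq E(G)$ of size at most $c\,(k^2\log k + k\ell)$ such that the graph $G-X$ (obtained from $G$ by deleting the edges in $X$) contains no long cycle.
   Context: A cycle is called long if its length (number of edges) is at least $\ell$. Logarithms are to base $2$. Cycles are edge-disjoint if they share no edge. -}

module Defs where

open import Data.Nat using (ℕ; suc; _≤_)
open import Data.Fin using (Fin; zero; suc; inject₁; fromℕ)
open import Data.Fin.Subset using (Subset; _∉_)
open import Data.Product using (Σ; _×_; _,_)
open import Data.Sum using (_⊎_)
open import Function.Definitions using (Injective)
open import Relation.Binary.PropositionalEquality using (_≡_)
open import Relation.Nullary using (¬_)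

-- A finite (multi)graph: vertices Fin n, edges Fin m, each edge has two
-- endpoints (parallel edges and loops allowed).
record Graph : Set where
  field
    n : ℕ
    m : ℕ
    ends : Fin m → Fin n × Fin n

open Graph public

Joins : (G : Graph) → Fin (m G) → Fin (n G) → Fin (n G) → Set
Joins G e u v = (ends G e ≡ (u , v)) ⊎ (ends G e ≡ (v , u))

record Cycle (G : Graph) : Set where
  field
    r     : ℕ
    verts : Fin (suc r) → Fin (n G)
    edges : Fin (suc r) → Fin (m G)
    verts-inj : Injective _≡_ _≡_ verts
    edges-inj : Injective _≡_ _≡_ edges
    step  : (i : Fin r) → Joins G (edges (inject₁ i)) (verts (inject₁ i)) (verts (suc i))
    close : Joins G (edges (fromℕ r)) (verts (fromℕ r)) (verts zero)

open Cycle public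

length : {G : Graph} → Cycle G → ℕ
length C = suc (r C)

Long : {G : Graph} → ℕ → Cycle G → Set
Long ℓ C = ℓ ≤ length C

EdgeDisjoint : {G : Graph} → Cycle G → Cycle G → Set
EdgeDisjoint C D = ∀ a b → ¬ (edges C a ≡ edges D b)

HasEdgeDisjointLongCycles : (G : Graph) → ℕ → ℕ → Set
HasEdgeDisjointLongCycles G ℓ k =
  Σ (Fin k → Cycle G) λ C →
    (∀ i → Long ℓ (C i)) × (∀ i j → ¬ (i ≡ j) → EdgeDisjoint (C i) (C j))

-- C uses no edge of X, i.e. C is a cycle of G - X
Avoids : {G : Graph} → Cycle G → Subset (m G) → Set
Avoids C X = ∀ a → edges C a ∉ X

HasLongCycleMinus : (G : Graph) → ℕ → Subset (m G) → Set
HasLongCycleMinus G ℓ X = Σ (Cycle G) λ C → Long ℓ C × Avoids C X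

{-# OPTIONS --safe #-}
module Submission where

-- Greedily remove long cycles with fewer than 2ℓ edges; afterwards every cycle has fewer than ℓ or at
-- least 2ℓ edges. Then "e and f lie on a common short cycle" is an equivalence relation on the edges,
-- and none of its classes contains a long cycle. So a long cycle leaves the class D of one of its edges,
-- and there are vertices u ≠ v that are joined both inside D and outside D. If Menger's theorem gives k
-- edge-disjoint u-v paths on both sides, they combine to k edge-disjoint closed walks each of which
-- contains a cycle that mixes the two sides, hence is long. Otherwise fewer than k edges separate u from
-- v on one side; these are deleted, keeping the graph connected, and one of them is put into a set Y: it lies
-- on no short cycle with the edges that remain and Y. After O(k log k) such steps a spanning tree of
-- what remains together with Y has no short cycle and O(k log k) more edges than vertices, so it contains
-- k edge-disjoint cycles by the usual argument: suppress vertices of degree at most 2 and repeatedly take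
-- the cycle of logarithmic length that exists by the Moore bound.
open import Defs
open import Data.Nat using (ℕ; zero; suc; _+_; _*_; _∸_; _^_; _≤_; _<_; z≤n; s≤s; _≤?_; _<?_)
open import Data.Nat.Logarithm using (⌊log₂_⌋; ⌊log₂⌋-mono-≤; ⌊log₂[2^n]⌋≡n)
open import Data.Nat.Solver using (module +-*-Solver)
open import Data.Bool using (Bool; true; false; not)
open import Data.Fin using (Fin; zero; suc; inject₁; fromℕ; fromℕ<)
open import Data.Fin.Subset using (Subset; ∣_∣; ⁅_⁆; _∪_) renaming (⊥ to ∅; _∈_ to _∈ˢ_)
open import Data.List using (List; []; _∷_; _++_; [_]; map; filter; allFin; take; drop; lookup; tabulate)
  renaming (length to len)
open import Data.List.Membership.Propositional using (_∈_; _∉_; find; lose)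
open import Data.List.Relation.Binary.Disjoint.Propositional using (Disjoint)
open import Data.List.Relation.Binary.Permutation.Propositional using (_↭_; ↭-refl; ↭-sym; ↭-trans; ↭-reflexive; prep; swap)
open import Data.List.Relation.Binary.Subset.Propositional using (_⊆_)
open import Data.List.Relation.Unary.All using (All; []; _∷_; all?)
open import Data.List.Relation.Unary.AllPairs using (AllPairs; []; _∷_)
open import Data.List.Relation.Unary.Any using (Any; here; there; any?)
open import Data.List.Relation.Unary.Linked using (Linked; []; [-]; _∷_)
open import Data.List.Relation.Unary.Unique.Propositional using (Unique)
open import Data.Product using (Σ; ∃; ∃-syntax; ∃₂; _×_; _,_; proj₁; proj₂)
open import Data.Sum using (_⊎_; inj₁; inj₂)
open import Data.Empty using (⊥; ⊥-elim)
open import Function using (_∘_; id; case_of_)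
open import Relation.Binary.PropositionalEquality using (_≡_; _≢_; refl; sym; trans; cong; cong₂; subst; subst₂; module ≡-Reasoning)
open import Relation.Nullary using (¬_; Dec; yes; no; does)
open import Relation.Nullary.Decidable using (¬?; _×-dec_; _⊎-dec_; map′; dec-true; dec-false)
import Data.Bool.Properties as Boolₚ
import Data.Fin.Properties as Finₚ
import Data.Fin.Subset.Properties as Subsetₚ
import Data.List.Membership.DecPropositional as DecMembership
import Data.List.Membership.Propositional.Properties as Mₚ
import Data.List.Properties as Lₚ
import Data.List.Relation.Binary.Permutation.Propositional.Properties as Pₚ
import Data.List.Relation.Unary.All as All
import Data.List.Relation.Unary.All.Properties as Allₚ
import Data.List.Relation.Unary.AllPairs as AllPairs
import Data.List.Relation.Unary.AllPairs.Properties as AllPairsₚ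
import Data.List.Relation.Unary.Unique.DecPropositional as DecUnique
import Data.List.Relation.Unary.Unique.Propositional.Properties as Uniqueₚ
import Data.Nat.Properties as ℕₚ
import Data.Sum as Sum
import Data.Vec as Vec

-- The gap between ℓ and 2ℓ gives transitivity: two short cycles with a common edge yield cycles of
-- length below 2ℓ, which are therefore short again. That a class has no long cycle is proved by
-- shortening: a path on a short cycle cuts a long cycle of the class down to no less than half its
-- length, hence to a long one. Deleting a whole cut but recording only one of its edges is the
-- crucial trade: a cycle whose only cut edge is the recorded one cannot stay on the side of the cut
-- (class or rest), so it mixes the two and is long. Connectedness matters because each edge of Y
-- then raises the surplus of edges over vertices by one; a disconnected graph is first joined up by
-- new edges, which lie on no cycle of the graph left by the greedy phase. The greedy phase costs at
-- most 2kℓ edges. The steps cost fewer than k edges each, and 2dk + 1 of them suffice for a depth d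
-- of order log k with 4dk < 2^d, which is what the Moore bound asks for.

uniq-++⁻ : ∀ {A : Set} (xs : List A) {ys} → Unique (xs ++ ys) →
           Unique xs × Unique ys × Disjoint xs ys
uniq-++⁻ [] u = [] , u , λ ()
uniq-++⁻ (x ∷ xs) (p ∷ u) with uniq-++⁻ xs u
... | u₁ , u₂ , dj = (Allₚ.++⁻ˡ xs p ∷ u₁) , u₂ ,
      λ { (here refl , q) → All.lookup (Allₚ.++⁻ʳ xs p) q refl ; (there h , q) → dj (h , q) }

uniq-↭ : ∀ {A : Set} {xs ys : List A} → xs ↭ ys → Unique xs → Unique ys
uniq-↭ _↭_.refl u = u
uniq-↭ (prep x p) (q ∷ u) = Pₚ.All-resp-↭ p q ∷ uniq-↭ p u
uniq-↭ (swap x y p) ((q₁ ∷ q₂) ∷ q₃ ∷ u) =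
  ((q₁ ∘ sym) ∷ Pₚ.All-resp-↭ p q₃) ∷ Pₚ.All-resp-↭ p q₂ ∷ uniq-↭ p u
uniq-↭ (_↭_.trans p q) u = uniq-↭ q (uniq-↭ p u)

uniq-∉ : ∀ {A : Set} {x : A} {xs} → Unique (x ∷ xs) → x ∉ xs
uniq-∉ (p ∷ _) h = All.lookup p h refl

∉-uniq : ∀ {A : Set} {x : A} {xs} → x ∉ xs → Unique xs → Unique (x ∷ xs)
∉-uniq {xs = xs} h u = All.tabulate (λ m e → h (subst (_∈ xs) (sym e) m)) ∷ u

uniq-tail : ∀ {A : Set} {x : A} {xs} → Unique (x ∷ xs) → Unique xs
uniq-tail (_ ∷ u) = u

all-⊆ : ∀ {A : Set} {P : A → Set} {xs ys} → xs ⊆ ys → All P ys → All P xs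
all-⊆ s a = All.tabulate (λ h → All.lookup a (s h))

uniq⇒len≤ : ∀ {A : Set} {xs ys : List A} → Unique xs → xs ⊆ ys → len xs ≤ len ys
uniq⇒len≤ {xs = []} _ _ = z≤n
uniq⇒len≤ {xs = x ∷ xs} u s with Mₚ.∈-∃++ (s (here refl))
... | a , b , refl = subst (suc (len xs) ≤_) (sym (Pₚ.↭-length (Pₚ.shift x a b)))
      (s≤s (uniq⇒len≤ (uniq-tail u) sub))
  where
  sub : xs ⊆ a ++ b
  sub h with Pₚ.∈-resp-↭ (Pₚ.shift x a b) (s (there h))
  ... | here refl = ⊥-elim (uniq-∉ u h)
  ... | there q   = q

uniqFin⇒len≤ : ∀ {k} {xs : List (Fin k)} → Unique xs → len xs ≤ k
uniqFin⇒len≤ {k} {xs} u = subst (len xs ≤_) (Lₚ.length-tabulate {n = k} id) (uniq⇒len≤ u (λ {x} _ → Mₚ.∈-allFin x))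

-- The case distinctions of the proof rest on exhaustive search: paths and cycles are lists of
-- bounded length over a searchable type.
Searchable : Set → Set₁
Searchable A = ∀ {P : A → Set} → (∀ x → Dec (P x)) → Dec (∃ P)

anyList? : ∀ {A : Set} → Searchable A → ∀ b {P : List A → Set} → (∀ l → Dec (P l)) →
           Dec (∃ λ l → len l ≤ b × P l)
anyList? S zero P? = map′ (λ p → [] , z≤n , p) (λ { ([] , _ , p) → p }) (P? [])
anyList? S (suc b) P? =
  map′ (λ { (inj₁ p) → [] , z≤n , p ; (inj₂ (x , l , le , p)) → x ∷ l , s≤s le , p })
       (λ { ([] , _ , p) → inj₁ p ; (x ∷ l , s≤s le , p) → inj₂ (x , l , le , p) })
       (P? [] ⊎-dec S (λ x → anyList? S b (λ l → P? (x ∷ l))))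

-- Walks, paths and cycles as lists of oriented edges.

module Walks (G : Graph) where

  -- Darts are oriented edges. A loop has two darts as well, so an edge determines its dart up to
  -- `flip`, and `flip` fixes no dart.
  V E Dart : Set
  V = Fin (n G)
  E = Fin (m G)
  Dart = E × Bool

  edge : Dart → E
  edge = proj₁

  src tgt : Dart → V
  src (e , true)  = proj₁ (ends G e)
  src (e , false) = proj₂ (ends G e)
  tgt (e , b) = src (e , not b)

  flip : Dart → Dart
  flip (e , b) = e , not b

  flip-flip : ∀ d → flip (flip d) ≡ d
  flip-flip (e , true)  = refl
  flip-flip (e , false) = refl

  tgt-flip : ∀ d → tgt (flip d) ≡ src d
  tgt-flip d = cong src (flip-flip d)

  edge-inv : ∀ d d′ → edge d ≡ edge d′ → d′ ≡ d ⊎ d′ ≡ flip d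
  edge-inv (e , true)  (e , true)  refl = inj₁ refl
  edge-inv (e , true)  (e , false) refl = inj₂ refl
  edge-inv (e , false) (e , true)  refl = inj₂ refl
  edge-inv (e , false) (e , false) refl = inj₁ refl

  _≟ᵈ_ : (d d′ : Dart) → Dec (d ≡ d′)
  (e , b) ≟ᵈ (e′ , b′) = map′ (λ { (refl , refl) → refl }) (λ { refl → refl , refl })
                          ((e Finₚ.≟ e′) ×-dec (b Boolₚ.≟ b′))

  open DecMembership (Finₚ._≟_ {n G}) using () renaming (_∈?_ to _∈ᵛ?_) public
  open DecMembership (Finₚ._≟_ {m G}) using () renaming (_∈?_ to _∈ᵉ?_) public
  open DecMembership _≟ᵈ_ using () renaming (_∈?_ to _∈ᵈ?_) public
  open DecUnique (Finₚ._≟_ {n G}) using () renaming (unique? to uniqueᵛ?) public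
  open DecUnique (Finₚ._≟_ {m G}) using () renaming (unique? to uniqueᵉ?) public

  searchDart : Searchable Dart
  searchDart P? = map′ (λ { (e , inj₁ p) → (e , true) , p ; (e , inj₂ p) → (e , false) , p })
                       (λ { ((e , true) , p) → e , inj₁ p ; ((e , false) , p) → e , inj₂ p })
                       (Finₚ.any? (λ e → P? (e , true) ⊎-dec P? (e , false)))

  tails : List Dart → List V
  tails = map src

  es : List Dart → List E
  es = map edge

  data IsWalk : V → List Dart → V → Set where
    nil  : ∀ {u v} → u ≡ v → IsWalk u [] v
    cons : ∀ {u v d ds} → src d ≡ u → IsWalk (tgt d) ds v → IsWalk u (d ∷ ds) v

  walk? : ∀ u ds v → Dec (IsWalk u ds v)
  walk? u [] v = map′ nil (λ { (nil e) → e }) (u Finₚ.≟ v)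
  walk? u (d ∷ ds) v = map′ (λ { (e , w) → cons e w }) (λ { (cons e w) → e , w })
                            ((src d Finₚ.≟ u) ×-dec walk? (tgt d) ds v)

  walk-++ : ∀ {u x v a b} → IsWalk u a x → IsWalk x b v → IsWalk u (a ++ b) v
  walk-++ (nil refl) w = w
  walk-++ (cons e w′) w = cons e (walk-++ w′ w)

  walk-split : ∀ {u v} a {b} → IsWalk u (a ++ b) v → ∃ λ x → IsWalk u a x × IsWalk x b v
  walk-split {u} [] w = u , nil refl , w
  walk-split (d ∷ a) (cons e w) with walk-split a w
  ... | x , w₁ , w₂ = x , cons e w₁ , w₂

  rev : List Dart → List Dart
  rev [] = []
  rev (d ∷ ds) = rev ds ++ [ flip d ]

  walk-rev : ∀ {u v ds} → IsWalk u ds v → IsWalk v (rev ds) u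
  walk-rev (nil e) = nil (sym e)
  walk-rev {ds = d ∷ _} (cons e w) = walk-++ (walk-rev w) (cons refl (nil (trans (tgt-flip d) e)))

  rev-++ : ∀ a b → rev (a ++ b) ≡ rev b ++ rev a
  rev-++ [] b = sym (Lₚ.++-identityʳ (rev b))
  rev-++ (d ∷ a) b = trans (cong (_++ [ flip d ]) (rev-++ a b)) (Lₚ.++-assoc (rev b) (rev a) _)

  rev-rev : ∀ a → rev (rev a) ≡ a
  rev-rev [] = refl
  rev-rev (d ∷ a) = trans (rev-++ (rev a) [ flip d ]) (cong₂ _∷_ (flip-flip d) (rev-rev a))

  es-rev : ∀ a → es (rev a) ↭ es a
  es-rev [] = ↭-refl
  es-rev (d ∷ a) = ↭-trans (↭-reflexive (Lₚ.map-++ edge (rev a) [ flip d ]))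
    (↭-trans (Pₚ.++-comm (es (rev a)) [ edge d ]) (prep (edge d) (es-rev a)))

  len-rev : ∀ a → len (rev a) ≡ len a
  len-rev a = trans (sym (Lₚ.length-map edge (rev a))) (trans (Pₚ.↭-length (es-rev a)) (Lₚ.length-map edge a))

  -- Either side lists all vertices of the walk, once in each direction; `tails` alone omits the
  -- last vertex.
  rev-tails : ∀ {u v ds} → IsWalk u ds v → u ∷ tails (rev ds) ↭ v ∷ tails ds
  rev-tails (nil refl) = ↭-refl
  rev-tails {v = v} {ds = d ∷ ds} (cons refl w) =
    ↭-trans (prep (src d) (↭-trans (↭-reflexive (Lₚ.map-++ src (rev ds) [ flip d ]))
                             (↭-trans (Pₚ.++-comm (tails (rev ds)) [ tgt d ]) (rev-tails w))))
            (swap (src d) v ↭-refl)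

  all-rev : ∀ {P : E → Set} {a} → All (P ∘ edge) a → All (P ∘ edge) (rev a)
  all-rev [] = []
  all-rev (p ∷ ps) = Allₚ.++⁺ (all-rev ps) (p ∷ [])

  all-es : ∀ {P : E → Set} {a} → All (P ∘ edge) a → All P (es a)
  all-es = Allₚ.map⁺

  es-all : ∀ {P : E → Set} {a} → All P (es a) → All (P ∘ edge) a
  es-all = Allₚ.map⁻

  es-⊆ : ∀ {a b} → a ⊆ b → es a ⊆ es b
  es-⊆ s h with Mₚ.∈-map⁻ edge h
  ... | d , q , refl = Mₚ.∈-map⁺ edge (s q)

  visit : ∀ {u v x ds} → IsWalk u ds v → x ∈ tails ds →
          ∃ λ a → ∃ λ d → ∃ λ b → ds ≡ a ++ d ∷ b × src d ≡ x × IsWalk u a x × IsWalk x (d ∷ b) v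
  visit {ds = d ∷ ds} (cons e w) (here refl) = [] , d , ds , refl , refl , nil (sym e) , cons refl w
  visit {ds = d ∷ ds} (cons e w) (there h) with visit w h
  ... | a , d′ , b , refl , s , w₁ , w₂ = d ∷ a , d′ , b , refl , s , cons e w₁ , w₂

  dart-split : ∀ {u v d ds} → IsWalk u ds v → d ∈ ds →
               ∃ λ a → ∃ λ b → ds ≡ a ++ d ∷ b × IsWalk u a (src d) × IsWalk (tgt d) b v
  dart-split w h with Mₚ.∈-∃++ h
  ... | a , b , refl with walk-split a w
  ... | x , w₁ , cons refl w₂ = a , b , refl , w₁ , w₂

  Simple : List Dart → V → Set
  Simple ds v = Unique (v ∷ tails ds)

  -- Loop erasure from the end: if the new start already lies on the erased remainder, everything
  -- before that visit is dropped. The inclusion in `ds` preserves restrictions on the edges and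
  -- disjointness.
  erase : ∀ {u v ds} → IsWalk u ds v → ∃ λ p → IsWalk u p v × Simple p v × p ⊆ ds × len p ≤ len ds
  erase (nil e) = [] , nil e , ([] ∷ []) , id , z≤n
  erase {u} {v} {d ∷ ds} (cons e w) with erase w
  ... | p , wp , sp , sub , le with src d Finₚ.≟ v | src d ∈ᵛ? tails p
  ... | yes s | _ = [] , nil (trans (sym e) s) , ([] ∷ []) , (λ ()) , z≤n
  ... | no s | no h = d ∷ p , cons e wp ,
        uniq-↭ (swap (src d) v ↭-refl)
          (∉-uniq (λ { (here q) → s q ; (there q) → h q }) sp) ,
        (λ { (here q) → here q ; (there q) → there (sub q) }) , s≤s le
  ... | no s | yes h with visit wp h
  ... | a , d′ , b , refl , _ , _ , w₂ = d′ ∷ b , subst (λ z → IsWalk z (d′ ∷ b) v) e w₂ ,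
        proj₁ (proj₂ (uniq-++⁻ (tails a)
          (uniq-↭ (↭-sym (Pₚ.shift v (tails a) (tails (d′ ∷ b))))
            (subst (λ z → Unique (v ∷ z)) (Lₚ.map-++ src a (d′ ∷ b)) sp)))) ,
        (λ q → there (sub (Mₚ.∈-++⁺ʳ a q))) ,
        ℕₚ.≤-trans (subst (_ ≤_) (sym (Lₚ.length-++ a)) (ℕₚ.m≤n+m _ (len a))) (ℕₚ.m≤n⇒m≤1+n le)

  tgt-in : ∀ {u v d ds} → IsWalk u ds v → d ∈ ds → tgt d ∈ v ∷ tails ds
  tgt-in (cons e (nil refl)) (here refl) = here refl
  tgt-in (cons e (cons e′ w)) (here refl) = there (there (here (sym e′)))
  tgt-in (cons e w) (there h) with tgt-in w h
  ... | here q = here q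
  ... | there q = there (there q)

  -- A second use of an edge in the same direction would repeat its source, and one in the opposite
  -- direction would end there.
  simple-es : ∀ {u v p} → IsWalk u p v → Simple p v → Unique (es p)
  simple-es (nil _) _ = []
  simple-es {p = d ∷ p} w₀@(cons e w) u@((s ∷ q) ∷ r ∷ t) = ∉-uniq no-rep (simple-es w (q ∷ t))
    where
    no-rep : edge d ∉ es p
    no-rep h with Mₚ.∈-map⁻ edge h
    ... | d′ , h′ , eq with edge-inv d d′ eq
    ... | inj₁ refl = All.lookup r (Mₚ.∈-map⁺ src h′) refl
    ... | inj₂ refl with tgt-in w h′
    ... | here z = s (trans (sym z) (tgt-flip d))
    ... | there z = All.lookup r z (sym (tgt-flip d))

  -- Beyond distinct vertices, distinct edges rule out the walk along an edge and straight back,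
  -- while loops and pairs of parallel edges count as cycles.
  record IsCyc (c : List Dart) : Set where
    constructor cyc
    field
      {base}  : V
      walk    : IsWalk base c base
      utails  : Unique (tails c)
      uedges  : Unique (es c)
      nonempty : c ≢ []
  open IsCyc public

  isCyc-∷ : ∀ {d p} → IsWalk (tgt d) p (src d) → Simple p (src d) → edge d ∉ es p → IsCyc (d ∷ p)
  isCyc-∷ w s h = cyc (cons refl w) s (∉-uniq h (simple-es w s)) (λ ())

  -- The standard way to extract a cycle through a chosen dart from a closed walk: loops are erased
  -- in the remainder, which does not use that edge.
  closeUp : ∀ d {ds} → IsWalk (tgt d) ds (src d) → edge d ∉ es ds →
            ∃ λ p → p ⊆ ds × IsCyc (d ∷ p) × IsWalk (tgt d) p (src d)
  closeUp d w h with erase w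
  ... | p , wp , sp , sub , _ = p , sub , isCyc-∷ wp sp (h ∘ es-⊆ sub) , wp

  cyc-∷ : ∀ {d p} → IsCyc (d ∷ p) → IsWalk (tgt d) p (src d)
  cyc-∷ (cyc (cons refl w) _ _ _) = w

  cyc? : ∀ c → Dec (IsCyc c)
  cyc? [] = no (λ C → nonempty C refl)
  cyc? (d ∷ p) = map′ (λ { (w , a , b) → cyc (cons refl w) a b (λ ()) })
                      (λ C → cyc-∷ C , utails C , uedges C)
                      (walk? (tgt d) p (src d) ×-dec (uniqueᵛ? (tails (d ∷ p)) ×-dec uniqueᵉ? (es (d ∷ p))))

  cyc-len : ∀ {c} → IsCyc c → len c ≤ m G
  cyc-len {c} C = subst (_≤ m G) (Lₚ.length-map edge c) (uniqFin⇒len≤ (uedges C))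

  abstract
    anyCyc? : ∀ {P : List Dart → Set} → (∀ c → Dec (P c)) → Dec (∃ λ c → IsCyc c × P c)
    anyCyc? P? = map′ (λ { (c , _ , q) → c , q }) (λ { (c , C , q) → c , cyc-len C , C , q })
                      (anyList? searchDart (m G) (λ c → cyc? c ×-dec P? c))

  rotate : ∀ a {b} → IsCyc (a ++ b) → IsCyc (b ++ a)
  rotate a {b} (cyc w ut ue ne) with walk-split a w
  ... | x , w₁ , w₂ = cyc (walk-++ w₂ w₁)
      (subst Unique (sym (Lₚ.map-++ src b a)) (uniq-↭ (Pₚ.++-comm (tails a) (tails b)) (subst Unique (Lₚ.map-++ src a b) ut)))
      (subst Unique (sym (Lₚ.map-++ edge b a)) (uniq-↭ (Pₚ.++-comm (es a) (es b)) (subst Unique (Lₚ.map-++ edge a b) ue)))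
      (λ eq → ne (Pₚ.↭-empty-inv (↭-trans (Pₚ.++-comm a b) (↭-reflexive eq))))

  revCyc : ∀ {c} → IsCyc c → IsCyc (rev c)
  revCyc {c} (cyc w ut ue ne) = cyc (walk-rev w) (uniq-↭ (↭-sym (Pₚ.drop-∷ (rev-tails w))) ut)
    (uniq-↭ (↭-sym (es-rev c)) ue)
    (λ eq → ne (trans (sym (rev-rev c)) (cong rev eq)))

  -- The cycle is rotated to start at `d`, after a reversal if it runs through the edge the other
  -- way.
  through : ∀ {c} d → IsCyc c → edge d ∈ es c → ∃ λ p → IsCyc (d ∷ p) × es (d ∷ p) ↭ es c
  through {c} d C h with Mₚ.∈-map⁻ edge h
  ... | d′ , h′ , eq with Mₚ.∈-∃++ h′
  ... | a , b , refl with edge-inv d d′ eq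
  ... | inj₁ refl = b ++ a , rotate a C , Pₚ.map⁺ edge (Pₚ.++-comm (d ∷ b) a)
  ... | inj₂ refl = rev a ++ rev b ,
          subst IsCyc eq₁ (rotate (rev b) (subst IsCyc eq₂ (revCyc C))) ,
          ↭-trans (↭-reflexive (cong es (sym eq₁)))
            (↭-trans (Pₚ.map⁺ edge (Pₚ.++-comm ([ flip (flip d) ] ++ rev a) (rev b)))
              (↭-trans (↭-reflexive (cong es (sym eq₂))) (es-rev (a ++ flip d ∷ b))))
    where
    eq₁ : flip (flip d) ∷ rev a ++ rev b ≡ d ∷ rev a ++ rev b
    eq₁ = cong (_∷ rev a ++ rev b) (flip-flip d)
    eq₂ : rev (a ++ flip d ∷ b) ≡ rev b ++ flip (flip d) ∷ rev a
    eq₂ = trans (rev-++ a (flip d ∷ b)) (Lₚ.++-assoc (rev b) [ flip (flip d) ] (rev a))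

  es↭⇒len : ∀ {a b} → es a ↭ es b → len a ≡ len b
  es↭⇒len {a} {b} p = trans (sym (Lₚ.length-map edge a)) (trans (Pₚ.↭-length p) (Lₚ.length-map edge b))

  closed-tgt : ∀ {u d c} → IsWalk u c u → d ∈ c → tgt d ∈ tails c
  closed-tgt {c = d ∷ c} w h with tgt-in w h
  ... | there q = q
  closed-tgt {c = d ∷ c} w@(cons e _) h | here q = here (trans q (sym e))

  ends-in : ∀ {c} d → IsCyc c → edge d ∈ es c → src d ∈ tails c
  ends-in d C h with Mₚ.∈-map⁻ edge h
  ... | d′ , h′ , eq with edge-inv d d′ eq
  ... | inj₁ refl = Mₚ.∈-map⁺ src h′
  ... | inj₂ refl = subst (_∈ _) (tgt-flip d) (closed-tgt (walk C) h′)

  -- The condition is on darts and not on edges because residual graphs are directed and components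
  -- are later cut out by conditions on endpoints.
  record Conn (R : Dart → Set) (u v : V) : Set where
    constructor conn
    field
      {path}   : List Dart
      isWalk   : IsWalk u path v
      respects : All R path

  abstract
    conn? : ∀ {R : Dart → Set} → (∀ d → Dec (R d)) → ∀ u v → Dec (Conn R u v)
    conn? {R} R? u v = map′ (λ { (p , _ , w , a) → conn w a }) back
        (anyList? searchDart (n G) (λ p → walk? u p v ×-dec all? R? p))
      where
      back : Conn R u v → ∃ λ p → len p ≤ n G × IsWalk u p v × All R p
      back (conn w a) with erase w
      ... | p , wp , sp , sub , _ = p ,
        ℕₚ.<⇒≤ (subst (λ z → suc z ≤ n G) (Lₚ.length-map src p) (uniqFin⇒len≤ sp)) , wp , all-⊆ sub a

  conn-refl : ∀ {R u} → Conn R u u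
  conn-refl = conn (nil refl) []

  conn-trans : ∀ {R u v w} → Conn R u v → Conn R v w → Conn R u w
  conn-trans (conn w a) (conn w′ a′) = conn (walk-++ w w′) (Allₚ.++⁺ a a′)

  conn-sym : ∀ {P : E → Set} {u v} → Conn (P ∘ edge) u v → Conn (P ∘ edge) v u
  conn-sym (conn w a) = conn (walk-rev w) (all-rev a)

  conn-dart : ∀ {R} d → R d → Conn R (src d) (tgt d)
  conn-dart d r = conn (cons refl (nil refl)) (r ∷ [])

  conn-map : ∀ {R R′ : Dart → Set} → (∀ d → R d → Conn R′ (src d) (tgt d)) → ∀ {u v} → Conn R u v → Conn R′ u v
  conn-map f (conn (nil refl) []) = conn-refl
  conn-map f (conn (cons refl w) (r ∷ a)) = conn-trans (f _ r) (conn-map f (conn w a))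

  crossing : ∀ {S : V → Set} → (∀ v → Dec (S v)) → ∀ {u v p} → IsWalk u p v → S u → ¬ S v →
             ∃ λ d → d ∈ p × S (src d) × ¬ S (tgt d)
  crossing S? (nil refl) s ns = ⊥-elim (ns s)
  crossing {S} S? {p = d ∷ p} (cons refl w) s ns with S? (tgt d)
  ... | no q = d , here refl , s , q
  ... | yes q with crossing S? w q ns
  ... | d′ , h , r = d′ , there h , r

-- Arcs of cycles, ears and shortcuts.

module Ears (G : Graph) where
  open Walks G public

  start-in : ∀ {x b v} → IsWalk x b v → x ∈ v ∷ tails b
  start-in (nil e) = here e
  start-in (cons e _) = there (here (sym e))

  split₂ : ∀ {c x y} → IsCyc c → x ∈ tails c → y ∈ tails c → x ≢ y →
           ∃₂ λ a b → IsWalk x a y × IsWalk y b x × IsCyc (a ++ b) × a ++ b ↭ c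
  split₂ C hx hy x≢y with visit (walk C) hx
  ... | a₀ , d , b₀ , refl , refl , _ , _ with rotate a₀ C
  ... | C′ with visit (cons refl (cyc-∷ C′)) (Pₚ.∈-resp-↭ (Pₚ.map⁺ src (Pₚ.++-comm a₀ (d ∷ b₀))) hy)
  ... | a , d′ , b , eq , _ , w₁ , w₂ = a , d′ ∷ b , w₁ , w₂ , subst IsCyc eq C′ ,
        ↭-trans (↭-reflexive (sym eq)) (Pₚ.++-comm (d ∷ b₀) a₀)

  -- A repeated edge would be run in both directions, and then one of its ends is the source of two
  -- darts, unless the walk is just that edge and back.
  closed-cyc : ∀ {x c} → IsWalk x c x → Unique (tails c) → c ≢ [] → (∀ d → c ≢ d ∷ flip d ∷ []) → IsCyc c
  closed-cyc (nil _) _ ne _ = ⊥-elim (ne refl)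
  closed-cyc {c = d ∷ p} (cons refl w) u _ nd = isCyc-∷ w u no-rep
    where
    no-flip : ∀ {p} → IsWalk (tgt d) p (src d) → Unique (src d ∷ tails p) → d ∷ p ≢ d ∷ flip d ∷ [] → flip d ∈ p → ⊥
    no-flip {_ ∷ []} _ _ nd (here refl) = nd refl
    no-flip {_ ∷ z ∷ _} (cons _ (cons e _)) u _ (here refl) = uniq-∉ u (there (here (sym (trans e (tgt-flip d)))))
    no-flip {x ∷ _} (cons e _) u _ (there h) = uniq-∉ (uniq-tail u) (subst (_∈ _) (sym e) (Mₚ.∈-map⁺ src h))
    no-rep : edge d ∉ es p
    no-rep h with Mₚ.∈-map⁻ edge h
    ... | d′ , h′ , eq with edge-inv d d′ eq
    ... | inj₁ refl = uniq-∉ u (Mₚ.∈-map⁺ src h′)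
    ... | inj₂ refl = no-flip w u (nd d) h′

  -- The arc `b` gives way to a path without inner vertices on the cycle. Length three excludes that
  -- the path runs back along a one-edge arc `a`.
  ear-cyc : ∀ {x y a b f p} → IsWalk x a y → IsWalk x b y → IsCyc (a ++ rev b) →
            IsWalk x (f ∷ p) y → Simple (f ∷ p) y → Disjoint (tails p) (tails (a ++ rev b)) →
            3 ≤ len (a ++ rev (f ∷ p)) → IsCyc (a ++ rev (f ∷ p))
  ear-cyc {x} {y} {a} {b} {f} {p} wa wb C wp@(cons sf _) sp dj l3 =
    closed-cyc (walk-++ wa (walk-rev wp))
      (subst Unique (sym (Lₚ.map-++ src a (rev (f ∷ p)))) (Uniqueₚ.++⁺ (proj₁ uC) (uniq-tail uxr) dis))
      (λ eq → case subst (λ z → 3 ≤ len z) eq l3 of λ ())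
      (λ d eq → case subst (λ z → 3 ≤ len z) eq l3 of λ { (s≤s (s≤s ())) })
    where
    uC : Unique (tails a) × Unique (tails (rev b)) × Disjoint (tails a) (tails (rev b))
    uC = uniq-++⁻ (tails a) (subst Unique (Lₚ.map-++ src a (rev b)) (utails C))
    uxr : Unique (x ∷ tails (rev (f ∷ p)))
    uxr = uniq-↭ (↭-sym (rev-tails wp)) sp
    y∈b : y ∈ tails (rev b)
    y∈b with start-in (walk-rev wb)
    ... | here e = ⊥-elim (uniq-∉ sp (here (trans e (sym sf))))
    ... | there h = h
    dis : Disjoint (tails a) (tails (rev (f ∷ p)))
    dis (ha , hp) with Pₚ.∈-resp-↭ (rev-tails wp) (there hp)
    ... | here refl = proj₂ (proj₂ uC) (ha , y∈b)
    ... | there (here refl) = uniq-∉ uxr (subst (_∈ _) sf hp)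
    ... | there (there h) = dj (h , subst (_ ∈_) (sym (Lₚ.map-++ src a (rev b))) (Mₚ.∈-++⁺ˡ ha))

  len-++r : ∀ (a b : List Dart) → len (a ++ rev b) ≡ len a + len b
  len-++r a b = trans (Lₚ.length-++ a) (cong (len a +_) (len-rev b))

  simple-split : ∀ {z y} a d b → src d ≡ z → Simple (a ++ d ∷ b) y → Simple a z × Simple (d ∷ b) y
  simple-split {z} {y} a d b refl s =
    ∉-uniq (λ h → proj₂ (proj₂ u) (h , here refl)) (proj₁ u) ,
    ∉-uniq (λ h → uniq-∉ s′ (Mₚ.∈-++⁺ʳ (tails a) h)) (proj₁ (proj₂ u))
    where
    s′ : Unique (y ∷ tails a ++ tails (d ∷ b))
    s′ = subst (λ q → Unique (y ∷ q)) (Lₚ.map-++ src a (d ∷ b)) s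
    u = uniq-++⁻ (tails a) (uniq-tail s′)

  Shorter : (E → Set) → ℕ → Set
  Shorter D N = ∃ λ c → IsCyc c × All (D ∘ edge) c × len c < N × N ≤ len c + len c

  -- A path p between two vertices of a cycle that is shorter than both arcs yields a shorter cycle which
  -- still has at least half the length: if p meets the cycle inside, one of its two parts is again
  -- shorter than both arcs between its ends; otherwise p closes up with the longer arc.
  shortcut : ∀ {D : E → Set} t {N x y a b p} → len p ≤ t → IsWalk x a y → IsWalk x b y →
             IsCyc (a ++ rev b) → All (D ∘ edge) (a ++ rev b) → len (a ++ rev b) ≡ N →
             IsWalk x p y → Simple p y → All (D ∘ edge) p →
             len p < len a → len p < len b → Shorter D N
  -- With an empty path both arcs would be nonempty closed walks at `x`, so the cycle would visit
  -- `x` twice.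
  shortcut {D} t {N} {x} {y} {a} {b} {[]} _ wa wb C _ _ (nil refl) _ _ la lb = ⊥-elim (bad wa (walk-rev wb) C la (subst (0 <_) (sym (len-rev b)) lb))
    where
    bad : ∀ {a b} → IsWalk x a x → IsWalk x b x → IsCyc (a ++ b) → 0 < len a → 0 < len b → ⊥
    bad {d ∷ a} {d′ ∷ b} (cons e _) (cons e′ _) C _ _ =
      uniq-∉ (utails C) (subst (_∈ _) (trans e′ (sym e)) (Mₚ.∈-map⁺ src (Mₚ.∈-++⁺ʳ a (here refl))))
  shortcut {D} (suc t) {N} {x} {y} {a} {b} {f ∷ p} (s≤s lt) wa wb C aC eN wp sp ap la lb
    with any? (λ z → z ∈ᵛ? tails (a ++ rev b)) (tails p)
  ... | no none = pick (ℕₚ.≤-total (len b) (len a))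
    where
    dj : Disjoint (tails p) (tails (a ++ rev b))
    dj (h , h′) = none (lose h h′)
    dj′ : Disjoint (tails p) (tails (b ++ rev a))
    dj′ (h , h′) = dj (h , Pₚ.∈-resp-↭ (Pₚ.drop-∷ (↭-trans (↭-reflexive (cong (λ z → x ∷ tails z) (sym eq))) (rev-tails (walk-++ wa (walk-rev wb))))) h′)
      where eq : rev (a ++ rev b) ≡ b ++ rev a
            eq = trans (rev-++ a (rev b)) (cong (_++ rev a) (rev-rev b))
    C′ : IsCyc (b ++ rev a)
    C′ = subst IsCyc (trans (rev-++ a (rev b)) (cong (_++ rev a) (rev-rev b))) (revCyc C)
    2+ : ∀ {k l} → suc k < l → 3 ≤ l + suc k
    2+ {k} {suc (suc l)} (s≤s (s≤s q)) = s≤s (s≤s (ℕₚ.≤-trans (s≤s z≤n) (ℕₚ.m≤n+m (suc k) l)))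
    eN′ : len a + len b ≡ N
    eN′ = trans (sym (len-++r a b)) eN
    pick : len b ≤ len a ⊎ len a ≤ len b → Shorter D N
    pick (inj₁ h) = a ++ rev (f ∷ p) ,
      ear-cyc wa wb C wp sp dj (subst (3 ≤_) (sym (len-++r a (f ∷ p))) (2+ la)) ,
      Allₚ.++⁺ (Allₚ.++⁻ˡ a aC) (all-rev ap) ,
      subst₂ _<_ (sym (len-++r a (f ∷ p))) eN′ (ℕₚ.+-monoʳ-< (len a) lb) ,
      subst₂ _≤_ eN′ refl (ℕₚ.≤-trans (ℕₚ.+-monoʳ-≤ (len a) h) (ℕₚ.+-mono-≤ lea lea))
      where lea : len a ≤ len (a ++ rev (f ∷ p))
            lea = subst (len a ≤_) (sym (len-++r a (f ∷ p))) (ℕₚ.m≤m+n _ _)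
    pick (inj₂ h) = b ++ rev (f ∷ p) ,
      ear-cyc wb wa C′ wp sp dj′ (subst (3 ≤_) (sym (len-++r b (f ∷ p))) (2+ lb)) ,
      Allₚ.++⁺ (subst (All (D ∘ edge)) (rev-rev b) (all-rev (Allₚ.++⁻ʳ a aC))) (all-rev ap) ,
      subst₂ _<_ (sym (len-++r b (f ∷ p))) (trans (ℕₚ.+-comm (len b) (len a)) eN′) (ℕₚ.+-monoʳ-< (len b) la) ,
      subst₂ _≤_ eN′ refl (ℕₚ.≤-trans (ℕₚ.+-monoˡ-≤ (len b) h) (ℕₚ.+-mono-≤ leb leb))
      where leb : len b ≤ len (b ++ rev (f ∷ p))
            leb = subst (len b ≤_) (sym (len-++r b (f ∷ p))) (ℕₚ.m≤m+n _ _)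
  ... | yes some with find some
  ... | z , hz , hz′ with wp
  ... | cons sf wp′ with visit wp′ hz
  ... | p₁ , d , p₂ , refl , refl , w₁ , w₂ = finish (Mₚ.∈-++⁻ (tails a) (subst (z ∈_) (Lₚ.map-++ src a (rev b)) hz′))
    where
    sps : Simple (f ∷ p₁) z × Simple (d ∷ p₂) y
    sps = simple-split (f ∷ p₁) d p₂ refl sp
    lp : len (f ∷ p) ≡ len (f ∷ p₁) + len (d ∷ p₂)
    lp = Lₚ.length-++ (f ∷ p₁)
    lt₁ : len (f ∷ p₁) ≤ t
    lt₁ = ℕₚ.≤-trans (ℕₚ.≤-trans (subst (len (f ∷ p₁) ≤_) (sym (ℕₚ.+-suc (len p₁) (len p₂))) (s≤s (ℕₚ.m≤m+n _ _))) (ℕₚ.≤-reflexive (sym (Lₚ.length-++ p₁)))) lt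
    lt₂ : len (d ∷ p₂) ≤ t
    lt₂ = ℕₚ.≤-trans (ℕₚ.≤-trans (ℕₚ.m≤n+m (len (d ∷ p₂)) (len p₁)) (ℕₚ.≤-reflexive (sym (Lₚ.length-++ p₁)))) lt
    ap₁ : All (D ∘ edge) (f ∷ p₁)
    ap₁ = Allₚ.++⁻ˡ (f ∷ p₁) ap
    ap₂ : All (D ∘ edge) (d ∷ p₂)
    ap₂ = Allₚ.++⁻ʳ (f ∷ p₁) ap
    on-arc : ∀ {a b} → IsWalk x a y → IsWalk x b y → IsCyc (a ++ rev b) → All (D ∘ edge) (a ++ rev b) →
             len (a ++ rev b) ≡ N → len (f ∷ p) < len a → len (f ∷ p) < len b → z ∈ tails a → Shorter D N
    on-arc {_} {b} wa wb C aC eN la lb h with visit wa h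
    ... | a₁ , g , a₂ , refl , _ , wa₁ , wa₂ with len (f ∷ p₁) <? len a₁
    ... | yes q = shortcut t lt₁ wa₁ (walk-++ wb (walk-rev wa₂)) (subst IsCyc eq C) (subst (All _) eq aC)
                  (trans (cong len (sym eq)) eN) (cons sf w₁) (proj₁ sps) ap₁ q
                  (ℕₚ.≤-<-trans (ℕₚ.≤-trans (ℕₚ.m≤m+n _ _) (ℕₚ.≤-reflexive (sym lp)))
                    (ℕₚ.<-≤-trans lb (ℕₚ.≤-trans (ℕₚ.m≤m+n _ _) (ℕₚ.≤-reflexive (sym (Lₚ.length-++ b))))))
      where eq : (a₁ ++ g ∷ a₂) ++ rev b ≡ a₁ ++ rev (b ++ rev (g ∷ a₂))
            eq = trans (Lₚ.++-assoc a₁ (g ∷ a₂) (rev b))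
                   (cong (a₁ ++_) (sym (trans (rev-++ b (rev (g ∷ a₂))) (cong (_++ rev b) (rev-rev (g ∷ a₂))))))
    -- As the whole path is shorter than `a` and its first part is no shorter than `a₁`, its second
    -- part is shorter than the rest of `a`; the opposite arc only grows.
    ... | no q = shortcut t lt₂ wa₂ (walk-++ (walk-rev wa₁) wb)
                  (subst IsCyc eq (rotate a₁ (subst IsCyc as C)))
                  (subst (All _) eq (Pₚ.All-resp-↭ (Pₚ.++-comm a₁ _) (subst (All _) as aC)))
                  (trans (cong len (sym eq)) (trans (Pₚ.↭-length (Pₚ.++-comm ((g ∷ a₂) ++ rev b) a₁)) (trans (cong len (sym as)) eN)))
                  w₂ (proj₂ sps) ap₂
                  (ℕₚ.+-cancelˡ-< (len a₁) _ _ (ℕₚ.≤-<-trans (ℕₚ.+-monoˡ-≤ _ (ℕₚ.≮⇒≥ q))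
                    (subst₂ _<_ lp (Lₚ.length-++ a₁) la)))
                  (ℕₚ.≤-<-trans (ℕₚ.≤-trans (ℕₚ.m≤n+m (len (d ∷ p₂)) (len (f ∷ p₁))) (ℕₚ.≤-reflexive (sym lp)))
                    (ℕₚ.<-≤-trans lb (ℕₚ.≤-trans (ℕₚ.m≤n+m _ _) (ℕₚ.≤-reflexive (sym (Lₚ.length-++ (rev a₁)))))))
      where as : (a₁ ++ g ∷ a₂) ++ rev b ≡ a₁ ++ (g ∷ a₂) ++ rev b
            as = Lₚ.++-assoc a₁ (g ∷ a₂) (rev b)
            eq : ((g ∷ a₂) ++ rev b) ++ a₁ ≡ (g ∷ a₂) ++ rev (rev a₁ ++ b)
            eq = trans (Lₚ.++-assoc (g ∷ a₂) (rev b) a₁)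
                   (cong ((g ∷ a₂) ++_) (sym (trans (rev-++ (rev a₁) b) (cong (rev b ++_) (rev-rev a₁)))))
    finish : z ∈ tails a ⊎ z ∈ tails (rev b) → Shorter D N
    finish (inj₁ h) = on-arc wa wb C aC eN la lb h
    finish (inj₂ h) with Pₚ.∈-resp-↭ (rev-tails wb) (there h)
    ... | here e = ⊥-elim (uniq-∉ (proj₂ sps) (here (sym e)))
    ... | there h′ = on-arc wb wa (subst IsCyc eq (revCyc C)) (subst (All _) eq (all-rev aC))
                       (trans (cong len (sym eq)) (trans (len-rev (a ++ rev b)) eN)) lb la h′
      where eq : rev (a ++ rev b) ≡ b ++ rev a
            eq = trans (rev-++ a (rev b)) (cong (_++ rev a) (rev-rev b))

-- Lying on a common short cycle as an equivalence relation.

module Gaps (G : Graph) where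
  open Ears G public

  firstHit : ∀ {S : V → Set} → (∀ v → Dec (S v)) → ∀ {u v ds} → IsWalk u ds v → S v →
             ∃ λ a → ∃ λ b → ∃ λ x → ds ≡ a ++ b × IsWalk u a x × IsWalk x b v × S x × All (¬_ ∘ S) (tails a)
  firstHit S? (nil refl) s = [] , [] , _ , refl , nil refl , nil refl , s , []
  firstHit S? {ds = d ∷ ds} w@(cons refl w′) s with S? (src d)
  ... | yes q = [] , d ∷ ds , src d , refl , nil refl , w , q , []
  ... | no q with firstHit S? w′ s
  ... | a , b , x , refl , wa , wb , sx , al = d ∷ a , b , x , refl , cons refl wa , wb , sx , q ∷ al

  record Joined (c₁ c₂ : List Dart) (e g : E) : Set where
    constructor joined
    field
      {cycle} : List Dart
      isCyc   : IsCyc cycle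
      within  : es cycle ⊆ es c₁ ++ es c₂
      has₁    : e ∈ es cycle
      has₂    : g ∈ es cycle
      bounded : len cycle ≤ len c₁ + len c₂

  -- The part of c₂ around g up to the first vertices of c₁ on both sides is an ear of c₁; it has two
  -- different ends because c₂ meets c₁ in both ends of f.
  ear : ∀ {c₁ c₂ e f g} → IsCyc c₁ → IsCyc c₂ → e ∈ es c₁ → f ∈ es c₁ → f ∈ es c₂ → g ∈ es c₂ → g ∉ es c₁ →
        Joined c₁ c₂ e g
  ear {c₁} {c₂} {e} {f} {g} C₁ C₂ he hf hf₂ hg ng with through (g , true) C₂ hg
  ... | w , C₂′ , perm with Pₚ.∈-resp-↭ (↭-sym perm) hf₂
  ... | here refl = ⊥-elim (ng hf)
  ... | there hfw with Mₚ.∈-map⁻ edge hfw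
  ... | df , hdf , refl with dart-split (cyc-∷ C₂′) hdf
  ... | s , t , refl , ws , wt
      with firstHit (λ v → v ∈ᵛ? tails c₁) ws (ends-in df C₁ hf)
         | firstHit (λ v → v ∈ᵛ? tails c₁) (walk-rev wt) (ends-in (flip df) C₁ hf)
  ... | s₁ , s₂ , x , refl , ws₁ , ws₂ , hx , ns | r₁ , r₂ , y , eqr , wr₁ , wr₂ , hy , nr =
      result (split₂ C₁ hx hy x≢y)
    where
    dg : Dart
    dg = g , true
    p : List Dart
    p = rev r₁ ++ dg ∷ s₁
    wp : IsWalk y p x
    wp = walk-++ (walk-rev wr₁) (cons refl ws₁)
    U : Unique ((src df ∷ tails (s₁ ++ s₂)) ++ (src dg ∷ tails t))
    U = uniq-↭ (↭-trans (↭-reflexive (cong (src dg ∷_) (Lₚ.map-++ src (s₁ ++ s₂) (df ∷ t))))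
                (↭-trans (prep (src dg) (Pₚ.shift (src df) (tails (s₁ ++ s₂)) (tails t)))
                  (↭-sym (Pₚ.shift (src dg) (src df ∷ tails (s₁ ++ s₂)) (tails t)))))
          (utails C₂′)
    U′ = uniq-++⁻ (src df ∷ tails (s₁ ++ s₂)) U
    t-side : tgt df ∷ tails (rev t) ↭ src dg ∷ tails t
    t-side = rev-tails wt
    Ut : Unique (tails r₁ ++ tails r₂)
    Ut = subst Unique (trans (cong tails eqr) (Lₚ.map-++ src r₁ r₂)) (uniq-tail (uniq-↭ (↭-sym t-side) (proj₁ (proj₂ U′))))
    r₁⊆ : tails r₁ ⊆ src dg ∷ tails t
    r₁⊆ h = Pₚ.∈-resp-↭ t-side (there (subst (_ ∈_) (sym (trans (cong tails eqr) (Lₚ.map-++ src r₁ r₂))) (Mₚ.∈-++⁺ˡ h)))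
    y∈ : y ∈ src dg ∷ tails t
    y∈ with start-in wr₂
    ... | here e = Pₚ.∈-resp-↭ t-side (here e)
    ... | there h = Pₚ.∈-resp-↭ t-side (there (subst (_ ∈_) (sym (trans (cong tails eqr) (Lₚ.map-++ src r₁ r₂))) (Mₚ.∈-++⁺ʳ (tails r₁) h)))
    s₁⊆ : tails s₁ ⊆ src df ∷ tails (s₁ ++ s₂)
    s₁⊆ h = there (subst (_ ∈_) (sym (Lₚ.map-++ src s₁ s₂)) (Mₚ.∈-++⁺ˡ h))
    x∈ : x ∈ src df ∷ tails (s₁ ++ s₂)
    x∈ with start-in ws₂
    ... | here e = here e
    ... | there h = there (subst (_ ∈_) (sym (Lₚ.map-++ src s₁ s₂)) (Mₚ.∈-++⁺ʳ (tails s₁) h))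
    -- On `c₂`, `x` lies on the stretch from `g` to `f` and `y` on the one from `f` back to `g`;
    -- these share no vertex.
    x≢y : x ≢ y
    x≢y refl = proj₂ (proj₂ U′) (x∈ , y∈)
    p-tails : tails p ↭ (y ∷ tails r₁) ++ tails s₁
    p-tails = ↭-trans (↭-reflexive (Lₚ.map-++ src (rev r₁) (dg ∷ s₁)))
      (↭-trans (Pₚ.shift (src dg) (tails (rev r₁)) (tails s₁)) (Pₚ.++⁺ʳ (tails s₁) (rev-tails wr₁)))
    Up : Unique (tails p)
    Up = uniq-↭ (↭-sym p-tails) (Uniqueₚ.++⁺
      (∉-uniq (λ h → All.lookup nr h hy) (proj₁ (uniq-++⁻ (tails r₁) Ut)))
      (proj₁ (uniq-++⁻ (tails s₁) (subst Unique (Lₚ.map-++ src s₁ s₂) (uniq-tail (proj₁ U′)))))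
      λ { (here refl , h) → All.lookup ns h hy ; (there h , h′) → proj₂ (proj₂ U′) (s₁⊆ h′ , r₁⊆ h) })
    lp : len p ≤ len c₂
    lp = begin
      len p                          ≡⟨ Lₚ.length-++ (rev r₁) ⟩
      len (rev r₁) + suc (len s₁)    ≡⟨ cong (_+ suc (len s₁)) (len-rev r₁) ⟩
      len r₁ + suc (len s₁)          ≤⟨ ℕₚ.+-mono-≤ (ℕₚ.m≤m+n (len r₁) (len r₂)) (s≤s (ℕₚ.m≤m+n (len s₁) (len s₂))) ⟩
      len r₁ + len r₂ + suc (len s₁ + len s₂) ≡⟨ cong₂ _+_ (sym (Lₚ.length-++ r₁)) (cong suc (sym (Lₚ.length-++ s₁))) ⟩
      len (r₁ ++ r₂) + suc (len (s₁ ++ s₂)) ≡⟨ cong (_+ suc (len (s₁ ++ s₂))) (trans (cong len (sym eqr)) (len-rev t)) ⟩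
      len t + suc (len (s₁ ++ s₂))  ≡⟨ ℕₚ.+-comm (len t) _ ⟩
      suc (len (s₁ ++ s₂) + len t) ≤⟨ s≤s (ℕₚ.+-monoʳ-≤ (len (s₁ ++ s₂)) (ℕₚ.n≤1+n (len t))) ⟩
      suc (len (s₁ ++ s₂) + suc (len t)) ≡⟨ cong suc (sym (Lₚ.length-++ (s₁ ++ s₂))) ⟩
      len (dg ∷ (s₁ ++ s₂) ++ df ∷ t)      ≡⟨ es↭⇒len {dg ∷ (s₁ ++ s₂) ++ df ∷ t} {c₂} perm ⟩
      len c₂ ∎
      where open ℕₚ.≤-Reasoning
    p⊆ : es p ⊆ es c₂
    p⊆ h with Mₚ.∈-++⁻ (es (rev r₁)) (subst (_ ∈_) (Lₚ.map-++ edge (rev r₁) (dg ∷ s₁)) h)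
    ... | inj₂ (here refl) = hg
    ... | inj₂ (there q) = Pₚ.∈-resp-↭ perm (there (subst (_ ∈_) (sym (Lₚ.map-++ edge (s₁ ++ s₂) (df ∷ t)))
            (Mₚ.∈-++⁺ˡ (subst (_ ∈_) (sym (Lₚ.map-++ edge s₁ s₂)) (Mₚ.∈-++⁺ˡ q)))))
    ... | inj₁ q = Pₚ.∈-resp-↭ perm (there (subst (_ ∈_) (sym (Lₚ.map-++ edge (s₁ ++ s₂) (df ∷ t)))
            (Mₚ.∈-++⁺ʳ (es (s₁ ++ s₂)) (there (Pₚ.∈-resp-↭ (es-rev t) (subst (_ ∈_)
              (sym (trans (cong es eqr) (Lₚ.map-++ edge r₁ r₂))) (Mₚ.∈-++⁺ˡ (Pₚ.∈-resp-↭ (es-rev r₁) q))))))))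
    g∈p : g ∈ es p
    g∈p = subst (g ∈_) (sym (Lₚ.map-++ edge (rev r₁) (dg ∷ s₁))) (Mₚ.∈-++⁺ʳ (es (rev r₁)) (here refl))
    close-with : ∀ {a b} → IsWalk x a y → IsWalk y b x → IsCyc (a ++ b) → es (a ++ b) ↭ es c₁ →
                 tails (a ++ b) ⊆ tails c₁ → e ∈ es a → Joined c₁ c₂ e g
    close-with {a} {b} wa wb C pe pt h = joined
        (closed-cyc (walk-++ wa wp) (subst Unique (sym (Lₚ.map-++ src a p)) (Uniqueₚ.++⁺ (proj₁ ua) Up dj))
          (λ eq → case subst (λ z → e ∈ es z) eq he′ of λ ())
          (λ d eq → ng (subst (_∈ es c₁) (both d (subst (λ z → e ∈ es z) eq he′) (subst (λ z → g ∈ es z) eq hg′)) he)))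
        (λ {z} q → case Mₚ.∈-++⁻ (es a) (subst (z ∈_) (Lₚ.map-++ edge a p) q) of λ
            { (inj₁ q) → Mₚ.∈-++⁺ˡ (Pₚ.∈-resp-↭ pe (subst (z ∈_) (sym (Lₚ.map-++ edge a b)) (Mₚ.∈-++⁺ˡ q)))
            ; (inj₂ q) → Mₚ.∈-++⁺ʳ (es c₁) (p⊆ q) })
        he′ hg′
        (subst (_≤ len c₁ + len c₂) (sym (Lₚ.length-++ a)) (ℕₚ.+-mono-≤
          (ℕₚ.≤-trans (ℕₚ.m≤m+n (len a) (len b)) (ℕₚ.≤-reflexive (trans (sym (Lₚ.length-++ a)) (es↭⇒len pe)))) lp))
      where
      he′ : e ∈ es (a ++ p)
      he′ = subst (e ∈_) (sym (Lₚ.map-++ edge a p)) (Mₚ.∈-++⁺ˡ h)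
      hg′ : g ∈ es (a ++ p)
      hg′ = subst (g ∈_) (sym (Lₚ.map-++ edge a p)) (Mₚ.∈-++⁺ʳ (es a) g∈p)
      ua = uniq-++⁻ (tails a) (subst Unique (Lₚ.map-++ src a b) (utails C))
      y∈b : y ∈ tails b
      y∈b with start-in wb
      ... | here q = ⊥-elim (x≢y (sym q))
      ... | there q = q
      inC : ∀ {z} → z ∈ tails a → z ∈ tails c₁
      inC q = pt (subst (_ ∈_) (sym (Lₚ.map-++ src a b)) (Mₚ.∈-++⁺ˡ q))
      dj : Disjoint (tails a) (tails p)
      dj (q , q′) with Mₚ.∈-++⁻ (y ∷ tails r₁) (Pₚ.∈-resp-↭ p-tails q′)
      ... | inj₁ (here refl) = proj₂ (proj₂ ua) (q , y∈b)
      ... | inj₁ (there q″) = All.lookup nr q″ (inC q)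
      ... | inj₂ q″ = All.lookup ns q″ (inC q)
      both : ∀ d {e g} → e ∈ es (d ∷ flip d ∷ []) → g ∈ es (d ∷ flip d ∷ []) → e ≡ g
      both d (here refl) (here refl) = refl
      both d (here refl) (there (here refl)) = refl
      both d (there (here refl)) (here refl) = refl
      both d (there (here refl)) (there (here refl)) = refl
    result : (∃₂ λ a b → IsWalk x a y × IsWalk y b x × IsCyc (a ++ b) × a ++ b ↭ c₁) → Joined c₁ c₂ e g
    result (a , b , wa , wb , C , pm) with Mₚ.∈-++⁻ (es a) (subst (e ∈_) (Lₚ.map-++ edge a b) (Pₚ.∈-resp-↭ (Pₚ.map⁺ edge (↭-sym pm)) he))
    ... | inj₁ h = close-with wa wb C (Pₚ.map⁺ edge pm) (Pₚ.∈-resp-↭ (Pₚ.map⁺ src pm)) h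
    ... | inj₂ h = close-with (walk-rev wb) (walk-rev wa) (subst IsCyc eq (revCyc C))
                     (↭-trans (↭-reflexive (cong es (sym eq))) (↭-trans (es-rev (a ++ b)) (Pₚ.map⁺ edge pm)))
                     (λ q → Pₚ.∈-resp-↭ (Pₚ.map⁺ src pm) (Pₚ.∈-resp-↭ (Pₚ.drop-∷ (rev-tails (walk-++ wa wb)))
                       (subst (λ z → _ ∈ tails z) (sym eq) q)))
                     (Pₚ.∈-resp-↭ (↭-sym (es-rev b)) h)
      where eq = rev-++ a b

  module Near (A : E → Set) (A? : ∀ e → Dec (A e)) (ℓ : ℕ)
              (gap : ∀ {c} → IsCyc c → All (A ∘ edge) c → ℓ ≤ len c → ℓ + ℓ ≤ len c) where

    Common : E → E → Set
    Common e f = ∃ λ c → IsCyc c × All (A ∘ edge) c × len c < ℓ × e ∈ es c × f ∈ es c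

    -- Equality is added because an edge on no short cycle must still have a class; `A f` keeps
    -- every class inside `A`.
    Near : E → E → Set
    Near e f = A f × (f ≡ e ⊎ Common e f)

    near? : ∀ e f → Dec (Near e f)
    near? e f = A? f ×-dec (f Finₚ.≟ e ⊎-dec
      anyCyc? (λ c → all? (A? ∘ edge) c ×-dec ((len c <? ℓ) ×-dec ((e ∈ᵉ? es c) ×-dec (f ∈ᵉ? es c)))))

    -- If `g` is not on the first cycle, `ear` gives a cycle through `e` and `g` of length below 2ℓ,
    -- and the gap makes it short.
    common-trans : ∀ {e f g} → Common e f → Common f g → Common e g
    common-trans {e} {f} {g} (c₁ , C₁ , a₁ , l₁ , he , hf) (c₂ , C₂ , a₂ , l₂ , hf₂ , hg) with g ∈ᵉ? es c₁
    ... | yes h = c₁ , C₁ , a₁ , l₁ , he , h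
    ... | no h with ear C₁ C₂ he hf hf₂ hg h
    ... | joined {c} C sub h₁ h₂ le = c , C , a , ℕₚ.≰⇒> short , h₁ , h₂
      where
      a : All (A ∘ edge) c
      a = es-all (all-⊆ sub (Allₚ.++⁺ (all-es a₁) (all-es a₂)))
      short : ¬ ℓ ≤ len c
      short q = ℕₚ.<⇒≱ (ℕₚ.+-mono-< l₁ l₂) (ℕₚ.≤-trans (gap C a q) le)

    common-sym : ∀ {e f} → Common e f → Common f e
    common-sym (c , C , a , l , h , h′) = c , C , a , l , h′ , h

    -- By transitivity a short cycle with one edge in a class stays in it. Hence every cycle with
    -- edges inside and outside a class is long.
    near-closed : ∀ {e f g c} → IsCyc c → All (A ∘ edge) c → len c < ℓ → f ∈ es c → g ∈ es c → Near e f → Near e g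
    near-closed C a l hf hg (_ , inj₁ refl) = All.lookup (all-es a) hg , inj₂ (_ , C , a , l , hf , hg)
    near-closed C a l hf hg (_ , inj₂ q) = All.lookup (all-es a) hg , inj₂ (common-trans q (_ , C , a , l , hf , hg))

    near-common : ∀ {e f g} → Near e f → Near e g → f ≢ g → Common f g
    near-common (_ , inj₁ refl) (_ , inj₁ refl) ne = ⊥-elim (ne refl)
    near-common (_ , inj₁ refl) (_ , inj₂ q) _ = q
    near-common (_ , inj₂ q) (_ , inj₁ refl) _ = common-sym q
    near-common (_ , inj₂ q) (_ , inj₂ q′) _ = common-trans (common-sym q) q′

    near-cycle : ∀ {e c f} → Near e f → IsCyc c → All (A ∘ edge) c → len c < ℓ → f ∈ es c → All (Near e ∘ edge) c
    near-cycle nf C a l hf = es-all (All.tabulate (λ hg → near-closed C a l hf hg nf))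

    -- Induction on the length: two vertices of the cycle at distance at least ℓ along it lie on a common short cycle.
    no-long : ∀ {e} t {c} → len c ≤ t → IsCyc c → All (Near e ∘ edge) c → 1 ≤ ℓ → ℓ ≤ len c → ⊥
    no-long {e} zero {c} lt C nc 1≤ ll = ℕₚ.<⇒≱ 1≤ (ℕₚ.≤-trans ll lt)
    -- The gap gives at least 2ℓ darts, so at least ℓ remain after the first ℓ.
    no-long {e} (suc t) {c} lt C nc 1≤ ll = go (take ℓ c) (drop ℓ c) (Lₚ.take++drop≡id ℓ c)
        (trans (Lₚ.length-take ℓ c) (ℕₚ.m≤n⇒m⊓n≡m ll))
        (subst (ℓ ≤_) (sym (Lₚ.length-drop ℓ c)) (ℕₚ.m+n≤o⇒m≤o∸n ℓ (gap C (All.map proj₁ nc) ll)))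
      where
      go : ∀ a b → a ++ b ≡ c → len a ≡ ℓ → ℓ ≤ len b → ⊥
      go [] b _ la _ = ℕₚ.<⇒≢ 1≤ la
      go (d ∷ a) [] _ _ lb = ℕₚ.<⇒≱ 1≤ lb
      go (d ∷ a) (d′ ∷ b) refl la lb with walk-split (d ∷ a) (cons refl (cyc-∷ C))
      ... | y , wa@(cons refl _) , wb@(cons refl _)
          with near-common (All.lookup nc (here refl)) (All.lookup nc (Mₚ.∈-++⁺ʳ (d ∷ a) (here refl)))
                 (λ eq → uniq-∉ (uedges C) (subst (_∈ _) (sym eq) (Mₚ.∈-map⁺ edge (Mₚ.∈-++⁺ʳ a (here refl)))))
      ... | k , K , ka , kl , h , h′
          with split₂ K (ends-in d K h) (ends-in d′ K h′)
                 (λ eq → uniq-∉ (utails C) (subst (_∈ _) (sym eq) (Mₚ.∈-map⁺ src (Mₚ.∈-++⁺ʳ a (here refl)))))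
      ... | k₁ , k₂ , wk , _ , _ , pm with erase wk
      ... | p , wp , sp , sub , le
          with shortcut {Near e} (len p) {a = d ∷ a} {b = rev (d′ ∷ b)} ℕₚ.≤-refl wa (walk-rev wb)
                 (subst (λ z → IsCyc (d ∷ a ++ z)) (sym (rev-rev (d′ ∷ b))) C)
                 (subst (λ z → All (Near e ∘ edge) (d ∷ a ++ z)) (sym (rev-rev (d′ ∷ b))) nc)
                 refl wp sp
                 (all-⊆ (λ q → Pₚ.∈-resp-↭ pm (Mₚ.∈-++⁺ˡ (sub q)))
                   (near-cycle (All.lookup nc (here refl)) K ka kl h))
                 (ℕₚ.<-≤-trans short (ℕₚ.≤-reflexive (sym la)))
                 (ℕₚ.<-≤-trans short (ℕₚ.≤-trans lb (ℕₚ.≤-reflexive (sym (len-rev (d′ ∷ b))))))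
        where
        short : len p < ℓ
        short = ℕₚ.≤-<-trans (ℕₚ.≤-trans le (ℕₚ.≤-trans (ℕₚ.m≤m+n (len k₁) (len k₂))
                  (ℕₚ.≤-reflexive (trans (sym (Lₚ.length-++ k₁)) (Pₚ.↭-length pm))))) kl
      -- The new cycle keeps at least half of 2ℓ edges, so it is long again and the induction goes
      -- on.
      ... | c′ , C′ , nc′ , lt′ , half =
          no-long t (ℕₚ.≤-pred (ℕₚ.≤-trans (subst (λ z → len c′ < len (d ∷ a ++ z)) (rev-rev (d′ ∷ b)) lt′) lt)) C′ nc′ 1≤
            (ℕₚ.≮⇒≥ (λ q → ℕₚ.<⇒≱ (ℕₚ.+-mono-< q q)
              (ℕₚ.≤-trans (gap C (All.map proj₁ nc) ll) (subst (λ z → len (d ∷ a ++ z) ≤ len c′ + len c′) (rev-rev (d′ ∷ b)) half))))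

-- Menger's theorem for edges, by augmenting unit flows.

extract : ∀ {A : Set} {p F : List A} → Unique p → p ⊆ F → ∃ λ F′ → F ↭ p ++ F′
extract {p = []} {F} _ _ = F , ↭-refl
extract {p = x ∷ p} u s with Mₚ.∈-∃++ (s (here refl))
... | a , b , refl with extract {p = p} {a ++ b} (uniq-tail u) sub
  where
  sub : p ⊆ a ++ b
  sub h with Pₚ.∈-resp-↭ (Pₚ.shift x a b) (s (there h))
  ... | here refl = ⊥-elim (uniq-∉ u h)
  ... | there q = q
... | F′ , pm = F′ , ↭-trans (Pₚ.shift x a b) (prep x pm)

does-true : ∀ {A : Set} (a? : Dec A) → does a? ≡ true → A
does-true (yes a) _ = a

module Menger (G : Graph) where
  open Walks G

  DisjointEdges : List Dart → List Dart → Set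
  DisjointEdges a b = Disjoint (es a) (es b)

  bit : Bool → ℕ
  bit true = 1
  bit false = 0

  ♯ : (V → Bool) → List V → ℕ
  ♯ S [] = 0
  ♯ S (v ∷ vs) = bit (S v) + ♯ S vs

  ♯-++ : ∀ S a {b} → ♯ S (a ++ b) ≡ ♯ S a + ♯ S b
  ♯-++ S [] = refl
  ♯-++ S (v ∷ a) {b} = trans (cong (bit (S v) +_) (♯-++ S a)) (sym (ℕₚ.+-assoc (bit (S v)) _ _))

  ♯-↭ : ∀ S {a b} → a ↭ b → ♯ S a ≡ ♯ S b
  ♯-↭ S _↭_.refl = refl
  ♯-↭ S (prep x p) = cong (bit (S x) +_) (♯-↭ S p)
  ♯-↭ S (swap x y p) = trans (cong (λ z → bit (S x) + (bit (S y) + z)) (♯-↭ S p))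
    (solve 3 (λ a b c → a :+ (b :+ c) := b :+ (a :+ c)) refl (bit (S x)) (bit (S y)) _)
    where open +-*-Solver
  ♯-↭ S (_↭_.trans p q) = trans (♯-↭ S p) (♯-↭ S q)

  heads : List Dart → List V
  heads = map tgt

  -- Telescoping: an inner vertex of the walk is once a head and once a tail.
  ♯-walk : ∀ S {u p v} → IsWalk u p v → ♯ S (tails p) + bit (S v) ≡ ♯ S (heads p) + bit (S u)
  ♯-walk S (nil refl) = refl
  ♯-walk S {p = d ∷ p} {v} (cons refl w) =
    trans (ℕₚ.+-assoc (bit (S (src d))) _ _) (trans (cong (bit (S (src d)) +_) (♯-walk S w))
      (solve 3 (λ a b c → a :+ (b :+ c) := c :+ b :+ a) refl (bit (S (src d))) (♯ S (heads p)) (bit (S (tgt d)))))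
    where open +-*-Solver
  module _ (P : E → Set) (P? : ∀ e → Dec (P e)) (u v : V) where

    -- A flow is a list of darts on distinct edges; that its value is j is expressed on all cuts at once.
    Value : List Dart → ℕ → Set
    Value F j = ∀ S → S u ≡ true → S v ≡ false → ♯ S (tails F) ≡ ♯ S (heads F) + j

    record Flow (j : ℕ) : Set where
      constructor flow
      field
        {darts} : List Dart
        distinct : Unique (es darts)
        within : All (P ∘ edge) darts
        value : Value darts j

    record Cut (j : ℕ) : Set where
      constructor cut
      field
        {cutset} : List E
        within : All P cutset
        size : len cutset ≡ j
        separates : ¬ Conn (λ d → P (edge d) × edge d ∉ cutset) u v

    Residual : List Dart → Dart → Set
    Residual F d = (edge d ∉ es F × P (edge d)) ⊎ flip d ∈ F

    residual? : ∀ F d → Dec (Residual F d)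
    residual? F d = (¬? (edge d ∈ᵉ? es F) ×-dec P? (edge d)) ⊎-dec (flip d ∈ᵈ? F)

    -- The invariant describes a flow whose last unit has come only as far as `x`. Each dart of the
    -- residual path is added, or its reversal cancelled, until `x` is `v`; distinct edges on the
    -- path keep the later darts residual.
    augment : ∀ {j x p F} → IsWalk x p v → All (Residual F) p → Unique (es p) → Unique (es F) → All (P ∘ edge) F →
              (∀ S → S u ≡ true → S v ≡ false → ♯ S (tails F) + bit (S x) ≡ ♯ S (heads F) + suc j) → Flow (suc j)
    augment {F = F} (nil refl) _ _ uF pF inv = flow uF pF (λ S su sv →
      trans (sym (trans (cong (λ z → ♯ S (tails F) + bit z) sv) (ℕₚ.+-identityʳ _))) (inv S su sv))
    augment {j} {p = d ∷ p} {F} (cons refl w) (r ∷ rs) up uF pF inv with flip d ∈ᵈ? F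
    ... | yes h with Mₚ.∈-∃++ h
    ... | a , b , refl = augment w (All.tabulate res) (uniq-tail up)
          (uniq-tail (uniq-↭ (Pₚ.map⁺ edge (Pₚ.shift (flip d) a b)) uF))
          (all-⊆ sub pF)
          λ S su sv → ℕₚ.+-cancelˡ-≡ (bit (S (src d))) _ _ (begin
            bit (S (src d)) + (♯ S (tails (a ++ b)) + bit (S (tgt d)))
              ≡⟨ solve 3 (λ x y z → x :+ (y :+ z) := (z :+ y) :+ x) refl (bit (S (src d))) (♯ S (tails (a ++ b))) (bit (S (tgt d))) ⟩
            ♯ S (tails (flip d ∷ a ++ b)) + bit (S (src d))
              ≡⟨ cong (_+ bit (S (src d))) (sym (♯-↭ S (Pₚ.map⁺ src (Pₚ.shift (flip d) a b)))) ⟩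
            ♯ S (tails (a ++ flip d ∷ b)) + bit (S (src d)) ≡⟨ inv S su sv ⟩
            ♯ S (heads (a ++ flip d ∷ b)) + suc j
              ≡⟨ cong (_+ suc j) (♯-↭ S (Pₚ.map⁺ tgt (Pₚ.shift (flip d) a b))) ⟩
            bit (S (tgt (flip d))) + ♯ S (heads (a ++ b)) + suc j
              ≡⟨ cong (λ z → bit (S z) + ♯ S (heads (a ++ b)) + suc j) (tgt-flip d) ⟩
            bit (S (src d)) + ♯ S (heads (a ++ b)) + suc j
              ≡⟨ ℕₚ.+-assoc (bit (S (src d))) _ _ ⟩
            bit (S (src d)) + (♯ S (heads (a ++ b)) + suc j) ∎)
      where
      open +-*-Solver
      open ≡-Reasoning
      sub : a ++ b ⊆ a ++ flip d ∷ b
      sub q = Pₚ.∈-resp-↭ (↭-sym (Pₚ.shift (flip d) a b)) (there q)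
      res : ∀ {d′} → d′ ∈ p → Residual (a ++ b) d′
      res h′ with All.lookup rs h′
      ... | inj₁ (q , pe) = inj₁ ((q ∘ es-⊆ sub) , pe)
      ... | inj₂ q with Pₚ.∈-resp-↭ (Pₚ.shift (flip d) a b) q
      ... | there q′ = inj₂ q′
      ... | here e = ⊥-elim (uniq-∉ up (subst (_∈ es p) (cong proj₁ e) (Mₚ.∈-map⁺ edge h′)))
    augment {j} {p = d ∷ p} {F} (cons refl w) (inj₂ r ∷ rs) up uF pF inv | no h = ⊥-elim (h r)
    augment {j} {p = d ∷ p} {F} (cons refl w) (inj₁ (r , pe) ∷ rs) up uF pF inv | no h =
      augment w (All.tabulate res) (uniq-tail up) (∉-uniq r uF) (pe ∷ pF)
        λ S su sv → begin
          bit (S (src d)) + ♯ S (tails F) + bit (S (tgt d))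
            ≡⟨ solve 3 (λ x y z → x :+ y :+ z := z :+ (y :+ x)) refl (bit (S (src d))) (♯ S (tails F)) (bit (S (tgt d))) ⟩
          bit (S (tgt d)) + (♯ S (tails F) + bit (S (src d)))
            ≡⟨ cong (bit (S (tgt d)) +_) (inv S su sv) ⟩
          bit (S (tgt d)) + (♯ S (heads F) + suc j)
            ≡⟨ sym (ℕₚ.+-assoc (bit (S (tgt d))) _ _) ⟩
          bit (S (tgt d)) + ♯ S (heads F) + suc j ∎
      where
      open +-*-Solver
      open ≡-Reasoning
      res : ∀ {d′} → d′ ∈ p → Residual (d ∷ F) d′
      res h′ with All.lookup rs h′
      ... | inj₂ q = inj₂ (there q)
      ... | inj₁ (q , pe′) = inj₁ ((λ { (here e) → uniq-∉ up (subst (_∈ es p) e (Mₚ.∈-map⁺ edge h′)) ; (there z) → q z }) , pe′)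

    Leaves : (V → Bool) → Dart → Set
    Leaves S d = S (src d) ≡ true × S (tgt d) ≡ false

    leaves? : ∀ S d → Dec (Leaves S d)
    leaves? S d = (S (src d) Boolₚ.≟ true) ×-dec (S (tgt d) Boolₚ.≟ false)

    -- Without darts entering `S`, the value is carried by the leaving darts alone; this makes the
    -- size of the cut exact.
    count-leaving : ∀ S F → All (λ d → S (tgt d) ≡ true → S (src d) ≡ true) F →
                    ♯ S (tails F) ≡ ♯ S (heads F) + len (filter (leaves? S) F)
    count-leaving S [] [] = refl
    count-leaving S (d ∷ F) (h ∷ hs) with S (src d) | S (tgt d) | count-leaving S F hs
    ... | true | true | ih = cong suc ih
    ... | true | false | ih = trans (cong suc ih) (sym (ℕₚ.+-suc _ _))
    ... | false | false | ih = ih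
    ... | false | true | ih with h refl
    ... | ()

    reach : ∀ {R : Dart → Set} → (∀ d → Dec (R d)) → V → Bool
    reach R? x = does (conn? R? u x)

    reach-true : ∀ {R : Dart → Set} (R? : ∀ d → Dec (R d)) {x} → Conn R u x → reach R? x ≡ true
    reach-true R? {x} c = dec-true (conn? R? u x) c

    reach-false : ∀ {R : Dart → Set} (R? : ∀ d → Dec (R d)) {x} → ¬ Conn R u x → reach R? x ≡ false
    reach-false R? {x} c = dec-false (conn? R? u x) c

    true-reach : ∀ {R : Dart → Set} (R? : ∀ d → Dec (R d)) {x} → reach R? x ≡ true → Conn R u x
    true-reach R? {x} e = does-true (conn? R? u x) e

    improve : ∀ {j} → Flow j → Flow (suc j) ⊎ Cut j
    improve {j} (flow {F} uF pF val) with conn? (residual? F) u v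
    ... | yes (conn w r) with erase w
    ... | p , wp , sp , sub , _ = inj₁ (augment wp (all-⊆ sub r) (simple-es wp sp) uF pF
            (λ S su sv → trans (cong₂ (λ a b → a + bit b) (val S su sv) su)
              (trans (ℕₚ.+-assoc _ j 1) (cong (♯ S (heads F) +_) (ℕₚ.+-comm j 1)))))
    improve {j} (flow {F} uF pF val) | no q = inj₂ (cut (all-es (all-⊆ leaving⊆ pF)) size sep)
      where
      R? = residual? F
      S : V → Bool
      S = reach R?
      leaving⊆ : filter (leaves? S) F ⊆ F
      leaving⊆ h = proj₁ (Mₚ.∈-filter⁻ (leaves? S) {xs = F} h)
      ent : All (λ d → S (tgt d) ≡ true → S (src d) ≡ true) F
      ent = All.tabulate (λ {d} h e → reach-true R? (conn-trans (true-reach R? e)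
        (subst (Conn _ (tgt d)) (tgt-flip d) (conn-dart (flip d) (inj₂ (subst (_∈ F) (sym (flip-flip d)) h))))))
      size : len (es (filter (leaves? S) F)) ≡ j
      size = trans (Lₚ.length-map edge (filter (leaves? S) F)) (ℕₚ.+-cancelˡ-≡ (♯ S (heads F)) _ _
        (trans (sym (count-leaving S F ent)) (val S (reach-true R? conn-refl) (reach-false R? q))))
      sep : ¬ Conn (λ d → P (edge d) × edge d ∉ es (filter (leaves? S) F)) u v
      sep (conn w a) with crossing (λ x → S x Boolₚ.≟ true) w (reach-true R? conn-refl)
                            (λ e → q (true-reach R? e))
      ... | d , h , s , t with All.lookup a h
      ... | pe , ne with edge d ∈ᵉ? es F
      ... | no z = t (reach-true R? (conn-trans (true-reach R? s) (conn-dart d (inj₁ (z , pe)))))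
      ... | yes z with Mₚ.∈-map⁻ edge z
      ... | d′ , h′ , eq with edge-inv d d′ eq
      ... | inj₁ refl = ne (Mₚ.∈-map⁺ edge (Mₚ.∈-filter⁺ (leaves? S) h′ (s , Boolₚ.¬-not t)))
      ... | inj₂ refl = t (reach-true R? (conn-trans (true-reach R? s) (conn-dart d (inj₂ h′))))

    max-flow : ∀ k → Flow k ⊎ ∃ λ j → j < k × Cut j
    max-flow zero = inj₁ (flow {darts = []} [] [] (λ _ _ _ → refl))
    max-flow (suc k) with max-flow k
    ... | inj₂ (j , lt , c) = inj₂ (j , ℕₚ.m≤n⇒m≤1+n lt , c)
    ... | inj₁ f with improve f
    ... | inj₁ f′ = inj₁ f′
    ... | inj₂ c = inj₂ (k , ℕₚ.≤-refl , c)

    no-leaving : ∀ S F → All (λ d → S (src d) ≡ true → S (tgt d) ≡ true) F → ♯ S (tails F) ≤ ♯ S (heads F)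
    no-leaving S [] [] = z≤n
    no-leaving S (d ∷ F) (h ∷ hs) with S (src d) | S (tgt d) | no-leaving S F hs
    ... | true | true | ih = s≤s ih
    ... | false | b | ih = ℕₚ.≤-trans ih (ℕₚ.m≤n+m _ (bit b))
    ... | true | false | ih with h refl
    ... | ()

    -- If the darts of `F` did not lead from `u` to `v`, none would leave the set reached, against
    -- the positive value. Removing the path lowers the value by one on every cut, by telescoping.
    decompose : ∀ j {F} → Unique (es F) → Value F j → ∃ λ ws → len ws ≡ j ×
                All (λ w → IsWalk u w v × w ⊆ F) ws × AllPairs DisjointEdges ws
    decompose zero _ _ = [] , refl , [] , []
    decompose (suc j) {F} uF val with conn? (_∈ᵈ? F) u v
    ... | no q = ⊥-elim (ℕₚ.<⇒≱ (ℕₚ.m<m+n (♯ S (heads F)) (s≤s z≤n))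
                   (ℕₚ.≤-trans (ℕₚ.≤-reflexive (sym (val S (reach-true R? conn-refl) (reach-false R? q))))
                     (no-leaving S F (All.tabulate (λ {d} h e → reach-true R? (conn-trans (true-reach R? e) (conn-dart d h)))))))
      where R? = _∈ᵈ? F
            S = reach R?
    ... | yes (conn w a) with erase w
    ... | p , wp , sp , sub , _ with extract (Uniqueₘ (simple-es wp sp)) (λ h → All.lookup a (sub h))
      where Uniqueₘ : ∀ {p} → Unique (es p) → Unique p
            Uniqueₘ {[]} _ = []
            Uniqueₘ {d ∷ p} u = ∉-uniq (λ h → uniq-∉ u (Mₚ.∈-map⁺ edge h)) (Uniqueₘ (uniq-tail u))
    ... | F′ , pm with uniq-++⁻ (es p) {es F′} (subst Unique (Lₚ.map-++ edge p F′) (uniq-↭ (Pₚ.map⁺ edge pm) uF))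
    ... | _ , uF′ , dj with decompose j {F′} uF′ val′
      where
      val′ : Value F′ j
      val′ S su sv = ℕₚ.+-cancelˡ-≡ (♯ S (tails p)) _ _ (begin
        ♯ S (tails p) + ♯ S (tails F′)        ≡⟨ sym (trans (cong (♯ S) (Lₚ.map-++ src p F′)) (♯-++ S (tails p))) ⟩
        ♯ S (tails (p ++ F′))                  ≡⟨ sym (♯-↭ S (Pₚ.map⁺ src pm)) ⟩
        ♯ S (tails F)                          ≡⟨ val S su sv ⟩
        ♯ S (heads F) + suc j                  ≡⟨ cong (_+ suc j) (♯-↭ S (Pₚ.map⁺ tgt pm)) ⟩
        ♯ S (heads (p ++ F′)) + suc j          ≡⟨ cong (_+ suc j) (trans (cong (♯ S) (Lₚ.map-++ tgt p F′)) (♯-++ S (heads p))) ⟩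
        ♯ S (heads p) + ♯ S (heads F′) + suc j ≡⟨ solve 3 (λ a b c → a :+ b :+ (con 1 :+ c) := a :+ con 1 :+ (b :+ c)) refl (♯ S (heads p)) (♯ S (heads F′)) j ⟩
        ♯ S (heads p) + 1 + (♯ S (heads F′) + j) ≡⟨ cong (_+ (♯ S (heads F′) + j)) tel ⟩
        ♯ S (tails p) + (♯ S (heads F′) + j) ∎)
        where
        open +-*-Solver
        open ≡-Reasoning
        tel : ♯ S (heads p) + 1 ≡ ♯ S (tails p)
        tel = trans (cong (λ z → ♯ S (heads p) + bit z) (sym su))
                (trans (sym (♯-walk S wp)) (trans (cong (λ z → ♯ S (tails p) + bit z) sv) (ℕₚ.+-identityʳ _)))
    ... | ws , lws , aws , dws = p ∷ ws , cong suc lws ,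
          ((wp , λ h → Pₚ.∈-resp-↭ (↭-sym pm) (Mₚ.∈-++⁺ˡ h)) ∷
            All.tabulate (λ h → let (w , s) = All.lookup aws h in w , λ q → Pₚ.∈-resp-↭ (↭-sym pm) (Mₚ.∈-++⁺ʳ p (s q)))) ,
          (All.tabulate (λ h (q , q′) → dj (q , es-⊆ (proj₂ (All.lookup aws h)) q′)) ∷ dws)

    Paths : ℕ → Set
    Paths k = ∃ λ ws → len ws ≡ k × All (λ w → IsWalk u w v × All (P ∘ edge) w) ws × AllPairs DisjointEdges ws

    menger : ∀ k → Paths k ⊎ ∃ λ j → j < k × Cut j
    menger k with max-flow k
    ... | inj₂ c = inj₂ c
    ... | inj₁ (flow {F} uF pF val) with decompose k uF val
    ... | ws , l , a , d = inj₁ (ws , l , All.tabulate (λ h → let (w , s) = All.lookup a h in w , all-⊆ s pF) , d)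

-- One step: packing or small separation along a long cycle.

span : ∀ {A : Set} {Q : A → Set} → (∀ x → Dec (Q x)) → ∀ xs →
       ∃₂ λ a b → xs ≡ a ++ b × All Q a × (b ≡ [] ⊎ ∃₂ λ y b′ → b ≡ y ∷ b′ × ¬ Q y)
span Q? [] = [] , [] , refl , [] , inj₁ refl
span Q? (x ∷ xs) with Q? x
... | no q = [] , x ∷ xs , refl , [] , inj₂ (x , xs , refl , q)
... | yes q with span Q? xs
... | a , b , refl , al , r = x ∷ a , b , refl , q ∷ al , r

module Steps (G : Graph) where
  open Gaps G public
  open Menger G public

  module Bonds (P Q : E → Set) (P? : ∀ e → Dec (P e)) (X : List E)
               (P⊆ : ∀ {e} → P e → e ∉ X) (Q⊆ : ∀ {e} → Q e → e ∉ X) (P∩Q : ∀ {e} → P e → Q e → ⊥)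
               (u v : V) (uPv : Conn (P ∘ edge) u v) (uQv : Conn (Q ∘ edge) u v)
               {j : ℕ} (c : Cut P P? u v j) where

    open Cut c renaming (cutset to K)

    -- The edges of the cut that leave the component of v behind the component of u: both ends of each of
    -- them stay joined to v or u, so that deleting them does not disconnect anything as long as Q joins u and v.
    R₁ R₂ : Dart → Set
    S₁ S₂ : V → Set
    R₁ d = P (edge d) × edge d ∉ K
    S₁ = Conn R₁ u
    R₂ d = P (edge d) × ¬ S₁ (src d) × ¬ S₁ (tgt d)
    S₂ = Conn R₂ v

    S₁? : ∀ x → Dec (S₁ x)
    S₁? = conn? (λ d → P? (edge d) ×-dec ¬? (edge d ∈ᵉ? K)) u
    S₂? : ∀ x → Dec (S₂ x)
    S₂? = conn? (λ d → P? (edge d) ×-dec (¬? (S₁? (src d)) ×-dec ¬? (S₁? (tgt d)))) v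

    Crosses : Dart → Set
    Crosses d = S₂ (src d) × ¬ S₂ (tgt d)

    Crosses? : ∀ d → Dec (Crosses d)
    Crosses? d = S₂? (src d) ×-dec ¬? (S₂? (tgt d))

    crosses? : ∀ e → Dec (Crosses (e , true) ⊎ Crosses (e , false))
    crosses? e = Crosses? (e , true) ⊎-dec Crosses? (e , false)

    bond : List E
    bond = filter crosses? K

    S₂⇒¬S₁ : ∀ {x} → S₂ x → ¬ S₁ x
    S₂⇒¬S₁ (conn w a) s with crossing (λ y → ¬? (S₁? y)) w separates (λ q → q s)
    ... | d , h , _ , q = q (proj₂ (proj₂ (All.lookup a h)))

    crosses-S₁ : ∀ d → P (edge d) → Crosses d → S₁ (tgt d)
    crosses-S₁ d p (s , t) with S₁? (tgt d)
    ... | yes q = q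
    ... | no q = ⊥-elim (t (conn-trans s (conn-dart d (p , S₂⇒¬S₁ s , q))))

    -- Such a dart ends in `S₁`; were its edge outside `K`, its source would belong to `S₁` too.
    crosses-∈ : ∀ d → P (edge d) → Crosses d → edge d ∈ bond
    crosses-∈ d p c with edge d ∈ᵉ? K
    ... | no q = ⊥-elim (S₂⇒¬S₁ (proj₁ c) (conn-trans (crosses-S₁ d p c)
                   (subst (Conn _ (tgt d)) (tgt-flip d) (conn-dart (flip d) (p , q)))))
    ... | yes q = Mₚ.∈-filter⁺ crosses? q (either d c)
      where either : ∀ d → Crosses d → Crosses (edge d , true) ⊎ Crosses (edge d , false)
            either (e , true) c = inj₁ c
            either (e , false) c = inj₂ c

    bond-dart : ∀ {e} → e ∈ bond → ∃ λ d → edge d ≡ e × Crosses d × P e × e ∈ K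
    bond-dart {e} h with Mₚ.∈-filter⁻ crosses? {xs = K} h
    ... | h′ , inj₁ c = (e , true) , refl , c , All.lookup within h′ , h′
    ... | h′ , inj₂ c = (e , false) , refl , c , All.lookup within h′ , h′

    bond-size : len bond ≤ j
    bond-size = subst (len bond ≤_) size (Lₚ.length-filter crosses? K)

    bond-dart₀ : ∃ λ d → Crosses d × edge d ∈ bond
    bond-dart₀ with conn-sym uPv
    ... | conn w a with crossing S₂? w conn-refl (λ s → S₂⇒¬S₁ s conn-refl)
    ... | d , h , c = d , c , crosses-∈ d (All.lookup a h) c

    Kept : E → Set
    Kept e = e ∉ bond ++ X

    keep : ∀ {e} → e ∉ bond → e ∉ X → Kept e
    keep q q′ h with Mₚ.∈-++⁻ bond h
    ... | inj₁ z = q z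
    ... | inj₂ z = q′ z

    -- The detour runs back to `v` inside `S₂`, over `Q` to `u`, and on inside `S₁`. Bond edges have
    -- an end in `S₁`, belong to `P` and lie in `K`, which keeps them off the three stretches in
    -- turn.
    rejoin : ∀ d → P (edge d) → Crosses d → Conn (Kept ∘ edge) (src d) (tgt d)
    rejoin d p c = conn-trans (conn-sym (conn-map (λ g r → conn-dart g (in₂ g r)) (proj₁ c)))
        (conn-trans (conn-sym (conn-map (λ g q → conn-dart g (keep (λ h → P∩Q (proj₁ (proj₂ (proj₂ (proj₂ (bond-dart h))))) q) (Q⊆ q))) uQv))
          (conn-map (λ g r → conn-dart g (keep (λ h → proj₂ r (proj₂ (proj₂ (proj₂ (proj₂ (bond-dart h)))))) (P⊆ (proj₁ r)))) (crosses-S₁ d p c)))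
      where
      in₂ : ∀ g → R₂ g → Kept (edge g)
      in₂ g (p , s , t) = keep no-bond (P⊆ p)
        where
        no-bond : edge g ∉ bond
        no-bond h with bond-dart h
        ... | d′ , refl , c′ , p′ , _ with edge-inv d′ g refl
        ... | inj₁ refl = t (crosses-S₁ d′ p′ c′)
        ... | inj₂ refl = s (crosses-S₁ d′ p′ c′)

    reconnect : ∀ d → edge d ∉ X → Conn (Kept ∘ edge) (src d) (tgt d)
    reconnect d h with edge d ∈ᵉ? bond
    ... | no q = conn-dart d (keep q h)
    ... | yes q with bond-dart q
    ... | d′ , eq , c′ , p , _ with edge-inv d′ d eq
    ... | inj₁ refl = rejoin d′ p c′
    ... | inj₂ refl = conn-sym (subst (λ z → Conn (Kept ∘ edge) z (tgt d′)) (sym (tgt-flip d′)) (rejoin d′ p c′))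

    -- Having left `S₂` through `e`, the cycle must return by another edge crossing `S₂`, and that
    -- edge is in the bond.
    bond-acyclic : ∀ {c e} → e ∈ bond → IsCyc c → All (P ∘ edge) c →
                   All (λ d → edge d ∉ bond ⊎ edge d ≡ e) c → e ∉ es c
    bond-acyclic {c} {e} h C pc oc he with bond-dart h
    ... | d , refl , cr , p , _ with through d C he
    ... | q , C′ , pm with crossing S₂? (walk-rev (cyc-∷ C′)) (proj₁ cr) (proj₂ cr)
    ... | g , hg , cg = clash (All.lookup (all-es oc) hc)
      where
      hq : edge g ∈ es q
      hq = Pₚ.∈-resp-↭ (es-rev q) (Mₚ.∈-map⁺ edge hg)
      hc : edge g ∈ es c
      hc = Pₚ.∈-resp-↭ pm (there hq)
      clash : edge g ∉ bond ⊎ edge g ≡ edge d → ⊥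
      clash (inj₁ z) = z (crosses-∈ g (All.lookup (all-es pc) hc) cg)
      clash (inj₂ z) = uniq-∉ (uedges C′) (subst (_∈ es q) z hq)

  module Search (ℓ : ℕ) (1≤ℓ : 1 ≤ ℓ) where

    LongIn : List E → List Dart → Set
    LongIn X c = IsCyc c × ℓ ≤ len c × All (λ d → edge d ∉ X) c

    Packing : List E → ℕ → Set
    Packing X k = ∃ λ cs → len cs ≡ k × All (LongIn X) cs × AllPairs DisjointEdges cs

    Gap : List E → Set
    Gap X = ∀ {c} → IsCyc c → All (λ d → edge d ∉ X) c → ℓ ≤ len c → ℓ + ℓ ≤ len c

    -- All of `removed` is deleted. Only `witness` may come back later, and `all-long` ensures that
    -- this creates no short cycle.
    record Separation (X : List E) (k : ℕ) : Set where
      constructor separation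
      field
        {removed} : List E
        {witness} : E
        removed-∉ : ∀ {e} → e ∈ removed → e ∉ X
        witness-∈ : witness ∈ removed
        small : len removed < k
        reconnects : ∀ d → edge d ∉ X → Conn (λ d → edge d ∉ removed ++ X) (src d) (tgt d)
        all-long : ∀ {c} → IsCyc c → All (λ d → edge d ∉ X) c →
                   All (λ d → edge d ∉ removed ⊎ edge d ≡ witness) c → witness ∈ es c → ℓ ≤ len c

    module _ (X : List E) (gap : Gap X) where
      open Near (_∉ X) (λ e → ¬? (e ∈ᵉ? X)) ℓ gap

      -- Closing up the first path after its first dart puts on the cycle both an edge near e and, as last
      -- edge, one that is not.
      mixed-cycle : ∀ {e u v w₁ w₂} → u ≢ v → IsWalk u w₁ v → All (Near e ∘ edge) w₁ →
              IsWalk v w₂ u → All (λ d → edge d ∉ X × ¬ Near e (edge d)) w₂ →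
              ∃ λ c → LongIn X c × es c ⊆ es w₁ ++ es w₂
      mixed-cycle {e} {u} {v} {w₁} {w₂} u≢v W₁ N₁ W₂ N₂ with erase W₁
      ... | [] , nil eq , _ = ⊥-elim (u≢v eq)
      ... | x ∷ p , cons refl wp , sp , sub , _
          with closeUp x (walk-++ wp W₂) fresh
        where
        fresh : edge x ∉ es (p ++ w₂)
        fresh h with Mₚ.∈-++⁻ (es p) (subst (edge x ∈_) (Lₚ.map-++ edge p w₂) h)
        ... | inj₁ q = uniq-∉ (simple-es {p = x ∷ p} (cons refl wp) sp) q
        ... | inj₂ q = proj₂ (All.lookup (all-es N₂) q) (All.lookup N₁ (sub (here refl)))
      -- The last dart is recovered as the one that enters `src x`.
      ... | c , sub′ , C , wc with crossing (λ z → ¬? (z Finₚ.≟ src x)) wc tx≢ (λ q → q refl)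
        where
        tx≢ : tgt x ≢ src x
        tx≢ eq with start-in wp
        ... | here q = uniq-∉ sp (here (trans (sym q) eq))
        ... | there q = uniq-∉ (uniq-tail sp) (subst (_∈ tails p) eq q)
      ... | y , hy , _ , ty = x ∷ c , (C , ℕₚ.≮⇒≥ not-short , aX) , c⊆
        where
        pick : ∀ {d} → d ∈ x ∷ c → d ∈ w₁ ⊎ d ∈ w₂
        pick (here refl) = inj₁ (sub (here refl))
        pick (there h) with Mₚ.∈-++⁻ p (sub′ h)
        ... | inj₁ q = inj₁ (sub (there q))
        ... | inj₂ q = inj₂ q
        aX : All (λ d → edge d ∉ X) (x ∷ c)
        aX = All.tabulate λ h → case pick h of λ
          { (inj₁ q) → proj₁ (All.lookup N₁ q) ; (inj₂ q) → proj₁ (All.lookup N₂ q) }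
        c⊆ : es (x ∷ c) ⊆ es w₁ ++ es w₂
        c⊆ h with Mₚ.∈-map⁻ edge h
        ... | d , q , refl with pick q
        ... | inj₁ z = Mₚ.∈-++⁺ˡ (Mₚ.∈-map⁺ edge z)
        ... | inj₂ z = Mₚ.∈-++⁺ʳ (es w₁) (Mₚ.∈-map⁺ edge z)
        ty′ : tgt y ≡ src x
        ty′ with tgt y Finₚ.≟ src x
        ... | yes q = q
        ... | no q = ⊥-elim (ty q)
        y∉near : ¬ Near e (edge y)
        y∉near with Mₚ.∈-++⁻ p (sub′ hy)
        ... | inj₂ q = proj₂ (All.lookup N₂ q)
        ... | inj₁ q with tgt-in wp q
        ... | here z = ⊥-elim (u≢v (trans (sym ty′) z))
        ... | there z = ⊥-elim (uniq-∉ (uniq-tail sp) (subst (_∈ tails p) ty′ z))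
        not-short : ¬ len (x ∷ c) < ℓ
        not-short l = y∉near (near-closed C aX l (here refl) (Mₚ.∈-map⁺ edge {xs = x ∷ c} (there hy)) (All.lookup N₁ (sub {x} (here refl))))

      -- Paths of the two sides are paired off. The sides share no edge, so the resulting cycles are
      -- disjoint; the inclusions are carried along to show this.
      mix : ∀ {e u v} → u ≢ v → ∀ k ws₁ ws₂ → len ws₁ ≡ k → len ws₂ ≡ k →
            All (λ w → IsWalk u w v × All (Near e ∘ edge) w) ws₁ →
            All (λ w → IsWalk v w u × All (λ d → edge d ∉ X × ¬ Near e (edge d)) w) ws₂ →
            AllPairs DisjointEdges ws₁ → AllPairs DisjointEdges ws₂ →
            ∃ λ cs → len cs ≡ k × All (λ c → LongIn X c × ∃₂ λ w₁ w₂ → w₁ ∈ ws₁ × w₂ ∈ ws₂ × es c ⊆ es w₁ ++ es w₂) cs ×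
                     AllPairs DisjointEdges cs
      mix _ zero [] [] _ _ _ _ _ _ = [] , refl , [] , []
      mix u≢v (suc k) (w₁ ∷ ws₁) (w₂ ∷ ws₂) l₁ l₂ ((W₁ , N₁) ∷ a₁) ((W₂ , N₂) ∷ a₂) (d₁ ∷ p₁) (d₂ ∷ p₂)
        with mixed-cycle u≢v W₁ N₁ W₂ N₂ | mix u≢v k ws₁ ws₂ (ℕₚ.suc-injective l₁) (ℕₚ.suc-injective l₂) a₁ a₂ p₁ p₂
      ... | c , L , s | cs , l , a , p = c ∷ cs , cong suc l ,
          (L , w₁ , w₂ , here refl , here refl , s) ∷ All.tabulate (λ h → case All.lookup a h of λ
            { (L′ , x₁ , x₂ , h₁ , h₂ , s′) → L′ , x₁ , x₂ , there h₁ , there h₂ , λ {z} → s′ {z} }) ,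
          All.tabulate dis ∷ p
        where
        dis : ∀ {c′} → c′ ∈ cs → DisjointEdges c c′
        dis h (q , q′) with All.lookup a h
        ... | _ , x₁ , x₂ , h₁ , h₂ , s′ with Mₚ.∈-++⁻ (es w₁) (s q) | Mₚ.∈-++⁻ (es x₁) (s′ q′)
        ... | inj₁ z | inj₁ z′ = All.lookup d₁ h₁ (z , z′)
        ... | inj₂ z | inj₂ z′ = All.lookup d₂ h₂ (z , z′)
        ... | inj₁ z | inj₂ z′ = proj₂ (All.lookup (all-es (proj₂ (All.lookup a₂ h₂))) z′) (All.lookup (all-es N₁) z)
        ... | inj₂ z | inj₁ z′ = proj₂ (All.lookup (all-es N₂) z) (All.lookup (all-es (proj₂ (All.lookup a₁ h₁))) z′)

      Rest : E → E → Set
      Rest e f = f ∉ X × ¬ Near e f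

      rest? : ∀ e f → Dec (Rest e f)
      rest? e f = ¬? (f ∈ᵉ? X) ×-dec ¬? (near? e f)

      record Arcs : Set where
        constructor arcs
        field
          {e} : E
          {u v} : V
          u≢v : u ≢ v
          near : Conn (Near e ∘ edge) u v
          rest : Conn (Rest e ∘ edge) v u

      -- By `no-long` some edge is not near `e`. The stretch from the first such edge to the next
      -- near edge, or to the end, is the path outside. The way back: that near edge and `e` share a
      -- short cycle, all of it near `e`, and from the start of `e` the initial near stretch leads
      -- to `v`.
      find-arcs : ∀ {c} → LongIn X c → Arcs
      find-arcs {[]} (C , _) = ⊥-elim (nonempty C refl)
      find-arcs {d ∷ c} (C , ll , aX) = go (span (near? e ∘ edge) (d ∷ c))
        where
        e = edge d
        near-e : Near e e
        near-e = All.lookup aX (here refl) , inj₁ refl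
        W : IsWalk (src d) (d ∷ c) (src d)
        W = cons refl (cyc-∷ C)
        join : ∀ g → Near e (edge g) → edge g ≢ e → Conn (Near e ∘ edge) (src g) (src d)
        join g (_ , inj₁ q) ne = ⊥-elim (ne q)
        join g ng@(_ , inj₂ (k , K , ka , kl , h , h′)) _ with src g Finₚ.≟ src d
        ... | yes q = conn (nil q) []
        ... | no q with split₂ K (ends-in g K h′) (ends-in d K h) q
        ... | k₁ , k₂ , w , _ , _ , pm = conn w (all-⊆ (λ z → Pₚ.∈-resp-↭ pm (Mₚ.∈-++⁺ˡ z)) (near-cycle ng K ka kl h′))
        go : (∃₂ λ a b → d ∷ c ≡ a ++ b × All (Near e ∘ edge) a × (b ≡ [] ⊎ ∃₂ λ y b′ → b ≡ y ∷ b′ × ¬ Near e (edge y))) → Arcs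
        go (a , b , eq , na , inj₁ refl) = ⊥-elim (no-long (len (d ∷ c)) ℕₚ.≤-refl C
             (subst (All (Near e ∘ edge)) (trans (sym (Lₚ.++-identityʳ a)) (sym eq)) na) 1≤ℓ ll)
        go ([] , _ , refl , _ , inj₂ (_ , _ , refl , ny)) = ⊥-elim (ny near-e)
        go (a@(_ ∷ a′) , b , refl , na , inj₂ (y , b′ , refl , ny)) with walk-split a W | span (λ z → ¬? (near? e (edge z))) (y ∷ b′)
        ... | v , wa , wb@(cons refl _) | [] , _ , refl , _ , inj₂ (_ , _ , refl , q) = ⊥-elim (q ny)
        ... | v , wa , wb@(cons refl _) | p@(_ ∷ p′) , r , refl , np , rest with walk-split p wb
        ... | u , wp , wr = arcs u≢v (conn-near new rest wr) (conn wp (All.tabulate (λ h →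
                All.lookup aX (Mₚ.∈-++⁺ʳ a (Mₚ.∈-++⁺ˡ h)) , All.lookup np h)))
          where
          u≢v : u ≢ src y
          u≢v with walk-++ wr wa | uniq-∉ (subst Unique (Lₚ.map-++ src p (r ++ a)) (subst (λ z → Unique (tails z)) (Lₚ.++-assoc p r a) (utails (rotate a C))))
          ... | wra | nin = λ eq → nin (Mₚ.∈-++⁺ʳ (tails p′) (first (subst (λ z → IsWalk z (r ++ a) (src y)) eq wra) ne))
            where
            ne : r ++ a ≢ []
            ne eq with Lₚ.++-conicalʳ r a eq
            ... | ()
            first : ∀ {x ds z} → IsWalk x ds z → ds ≢ [] → x ∈ tails ds
            first (nil _) ne = ⊥-elim (ne refl)
            first (cons refl _) _ = here refl
          new : ∀ {g} → g ∈ r → edge g ≢ e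
          new h eq = uniq-∉ (uedges C) (subst (_∈ _) eq (Mₚ.∈-map⁺ edge (Mₚ.∈-++⁺ʳ a′ (Mₚ.∈-++⁺ʳ p h))))
          conn-near : ∀ {r} → (∀ {g} → g ∈ r → edge g ≢ e) → r ≡ [] ⊎ (∃₂ λ g r′ → r ≡ g ∷ r′ × ¬ ¬ Near e (edge g)) → IsWalk u r (src d) → Conn (Near e ∘ edge) u (src y)
          conn-near _ (inj₁ refl) (nil refl) = conn wa na
          conn-near new (inj₂ (g , _ , refl , nng)) (cons refl _) with near? e (edge g)
          ... | no q = ⊥-elim (nng q)
          ... | yes q = conn-trans (join g q (new (here refl))) (conn wa na)

      -- In the case of a small cut, a short cycle through the witness lies wholly on the side of
      -- the cut by `near-closed`, and there `bond-acyclic` excludes it.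
      separate : ∀ {k c} → LongIn X c → Packing X k ⊎ Separation X k
      separate {k} L with find-arcs L
      ... | arcs {e} {u} {v} u≢v near rest
          with menger (Near e) (near? e) u v k | menger (Rest e) (rest? e) v u k
      ... | inj₁ (ws₁ , l₁ , a₁ , d₁) | inj₁ (ws₂ , l₂ , a₂ , d₂) with mix u≢v k ws₁ ws₂ l₁ l₂ a₁ a₂ d₁ d₂
      ... | cs , l , a , d = inj₁ (cs , l , All.tabulate (λ h → proj₁ (All.lookup a h)) , d)
      separate {k} L | arcs {e} {u} {v} u≢v near rest | inj₂ (j , j<k , c) | _ =
        inj₂ (separation (λ h → proj₁ (proj₁ (proj₂ (proj₂ (proj₂ (B.bond-dart h)))))) w∈ (ℕₚ.≤-<-trans B.bond-size j<k) B.reconnect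
          (λ C aX oc he → ℕₚ.≮⇒≥ (λ l → B.bond-acyclic w∈ C (near-cycle (w-near) C aX l he) oc he)))
        where
        module B = Bonds (Near e) (Rest e) (near? e) X proj₁ proj₁ (λ p q → proj₂ q p) u v near (conn-sym rest) c
        w∈ = proj₂ (proj₂ B.bond-dart₀)
        w-near = proj₁ (proj₂ (proj₂ (proj₂ (B.bond-dart w∈))))
      separate {k} L | arcs {e} {u} {v} u≢v near rest | inj₁ _ | inj₂ (j , j<k , c) =
        inj₂ (separation (λ h → proj₁ (proj₁ (proj₂ (proj₂ (proj₂ (B.bond-dart h)))))) w∈ (ℕₚ.≤-<-trans B.bond-size j<k) B.reconnect
          (λ C aX oc he → ℕₚ.≮⇒≥ (λ l → B.bond-acyclic w∈ C (All.tabulate (λ h → All.lookup aX h ,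
             (λ q → proj₂ w-rest (near-closed C aX l (Mₚ.∈-map⁺ edge h) he q)))) oc he)))
        where
        module B = Bonds (Rest e) (Near e) (rest? e) X proj₁ proj₁ (λ p q → proj₂ p q) v u rest (conn-sym near) c
        w∈ = proj₂ (proj₂ B.bond-dart₀)
        w-rest = proj₁ (proj₂ (proj₂ (proj₂ (B.bond-dart w∈))))

-- Graphs whose edges stand for walks, and pulling cycles back.

allPairs-lookup : ∀ {A : Set} {R : A → A → Set} → (∀ {x y} → R x y → R y x) → ∀ {xs} → AllPairs R xs →
                  ∀ i j → i ≢ j → R (lookup xs i) (lookup xs j)
allPairs-lookup s (_ ∷ _) zero zero ne = ⊥-elim (ne refl)
allPairs-lookup s (p ∷ _) zero (suc j) _ = All.lookup p (Mₚ.∈-lookup j)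
allPairs-lookup s (p ∷ _) (suc i) zero _ = s (All.lookup p (Mₚ.∈-lookup i))
allPairs-lookup s (_ ∷ ps) (suc i) (suc j) ne = allPairs-lookup s ps i j (ne ∘ cong suc)

module Cycles (G : Graph) where
  open Walks G public
  open Menger G using (DisjointEdges) public

  CyclePacking : ℕ → Set
  CyclePacking k = ∃ λ cs → len cs ≡ k × All IsCyc cs × AllPairs DisjointEdges cs

module Models (G : Graph) where
  open Cycles G

  Item : Set
  Item = (V × V) × List Dart

  Valid : Item → Set
  Valid ((a , b) , w) = IsWalk a w b × w ≢ [] × Unique (es w)

  Apart : Item → Item → Set
  Apart x y = DisjointEdges (proj₂ x) (proj₂ y)

  -- The graph on the vertices of G that has one edge for each of the given walks.
  build : List Item → Graph
  build Ms = record { n = n G ; m = len Ms ; ends = λ i → proj₁ (lookup Ms i) }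

  Covered : List Item → E → Set
  Covered Ms e = Any (λ x → e ∈ es (proj₂ x)) Ms

  module Lift (Ms : List Item) (ok : All Valid Ms) (apart : AllPairs Apart Ms) where
    module H = Cycles (build Ms)

    μ : H.Dart → List Dart
    μ (i , true) = proj₂ (lookup Ms i)
    μ (i , false) = rev (proj₂ (lookup Ms i))

    valid : ∀ i → Valid (lookup Ms i)
    valid i = All.lookup ok (Mₚ.∈-lookup i)

    μ-walk : ∀ d → IsWalk (H.src d) (μ d) (H.tgt d)
    μ-walk (i , true) = proj₁ (valid i)
    μ-walk (i , false) = walk-rev (proj₁ (valid i))

    μ-es : ∀ d → es (μ d) ↭ es (proj₂ (lookup Ms (H.edge d)))
    μ-es (i , true) = ↭-refl
    μ-es (i , false) = es-rev (proj₂ (lookup Ms i))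

    μ-ne : ∀ d → μ d ≢ []
    μ-ne (i , true) = proj₁ (proj₂ (valid i))
    μ-ne (i , false) eq = proj₁ (proj₂ (valid i)) (trans (sym (rev-rev _)) (cong rev eq))

    μ-disjoint : ∀ d d′ → H.edge d ≢ H.edge d′ → DisjointEdges (μ d) (μ d′)
    μ-disjoint d d′ ne (h , h′) = allPairs-lookup {R = Apart} (λ s (p , q) → s (q , p)) apart (H.edge d) (H.edge d′) ne
      (Pₚ.∈-resp-↭ (μ-es d) h , Pₚ.∈-resp-↭ (μ-es d′) h′)

    μ* : List H.Dart → List Dart
    μ* [] = []
    μ* (d ∷ ds) = μ d ++ μ* ds

    μ*-walk : ∀ {u v ds} → H.IsWalk u ds v → IsWalk u (μ* ds) v
    μ*-walk (H.nil e) = nil e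
    μ*-walk (H.cons {d = d} refl w) = walk-++ (μ-walk d) (μ*-walk w)

    μ*-∈ : ∀ {x} ds → x ∈ es (μ* ds) → ∃ λ d → d ∈ ds × x ∈ es (μ d)
    μ*-∈ (d ∷ ds) h with Mₚ.∈-++⁻ (es (μ d)) (subst (_ ∈_) (Lₚ.map-++ edge (μ d) (μ* ds)) h)
    ... | inj₁ q = d , here refl , q
    ... | inj₂ q with μ*-∈ ds q
    ... | d′ , h′ , r = d′ , there h′ , r

    -- Substituting walks for edges gives a closed walk that may repeat vertices, but its first edge
    -- occurs only once, so a cycle through that edge can be extracted.
    lift : ∀ {c} → H.IsCyc c → ∃ λ c′ → IsCyc c′ × es c′ ⊆ es (μ* c)
    lift {[]} C = ⊥-elim (H.nonempty C refl)
    lift {d ∷ p} C = go (μ d) refl (μ-walk d)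
      where
      go : ∀ w → μ d ≡ w → IsWalk (H.src d) w (H.tgt d) → ∃ λ c′ → IsCyc c′ × es c′ ⊆ es (μ* (d ∷ p))
      go [] eq _ = ⊥-elim (μ-ne d eq)
      go (x ∷ xs) eq (cons e w) with closeUp x (subst (IsWalk _ (xs ++ μ* p)) (sym e) (walk-++ w (μ*-walk (H.cyc-∷ C)))) fresh
        where
        fresh : edge x ∉ es (xs ++ μ* p)
        fresh h with Mₚ.∈-++⁻ (es xs) (subst (edge x ∈_) (Lₚ.map-++ edge xs (μ* p)) h)
        ... | inj₁ q = uniq-∉ (subst (Unique ∘ es) eq (uniq-↭ (↭-sym (μ-es d)) (proj₂ (proj₂ (valid (H.edge d)))))) q
        ... | inj₂ q with μ*-∈ p q
        ... | d′ , h′ , r = μ-disjoint d d′ (λ z → uniq-∉ (H.uedges C) (subst (_∈ H.es p) (sym z) (Mₚ.∈-map⁺ H.edge h′)))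
                             (subst (λ z → edge x ∈ es z) (sym eq) (here refl) , r)
      ... | c , sub , C′ , _ = x ∷ c , C′ ,
            λ {y} h → subst (λ z → y ∈ es (z ++ μ* p)) (sym eq) (es-⊆ {x ∷ c} {x ∷ xs ++ μ* p} sub′ h)
        where
        sub′ : x ∷ c ⊆ x ∷ xs ++ μ* p
        sub′ (here q) = here q
        sub′ (there h) = there (sub h)

    covered : ∀ {ds x} → x ∈ es (μ* ds) → Covered Ms x
    covered {ds} h with μ*-∈ ds h
    ... | d , _ , q = lose (Mₚ.∈-lookup (H.edge d)) (Pₚ.∈-resp-↭ (μ-es d) q)

    -- Disjoint cycles use disjoint walks. Recording that only covered edges occur keeps lifted
    -- cycles apart from one taken out before.
    lift-packing : ∀ {k} → H.CyclePacking k → ∃ λ cs → len cs ≡ k × All IsCyc cs × AllPairs DisjointEdges cs × All (All (Covered Ms ∘ edge)) cs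
    lift-packing (cs , l , a , p) with go cs a p
      where
      go : ∀ cs → All H.IsCyc cs → AllPairs H.DisjointEdges cs → ∃ λ cs′ → len cs′ ≡ len cs ×
           All (λ c → IsCyc c × ∃ λ c₀ → c₀ ∈ cs × es c ⊆ es (μ* c₀)) cs′ × AllPairs DisjointEdges cs′
      go [] [] [] = [] , refl , [] , []
      go (c ∷ cs) (C ∷ a) (d ∷ ds) with lift C | go cs a ds
      ... | c′ , C′ , s | cs′ , l′ , a′ , ds′ = c′ ∷ cs′ , cong suc l′ ,
            (C′ , c , here refl , s) ∷ All.tabulate (λ h → let (D , c₀ , h₀ , s₀) = All.lookup a′ h in D , c₀ , there h₀ , λ {z} → s₀ {z}) ,
            All.tabulate dis ∷ ds′
        where
        dis : ∀ {x} → x ∈ cs′ → DisjointEdges c′ x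
        dis h (q , q′) with All.lookup a′ h
        ... | _ , c₀ , h₀ , s₀ with μ*-∈ c (s q) | μ*-∈ c₀ (s₀ q′)
        ... | g , gh , gq | g′ , gh′ , gq′ = μ-disjoint g g′
              (λ eq → All.lookup d h₀ (Mₚ.∈-map⁺ H.edge gh , subst (_∈ H.es c₀) (sym eq) (Mₚ.∈-map⁺ H.edge gh′))) (gq , gq′)
    ... | cs′ , l′ , a′ , p′ = cs′ , trans l′ l , All.tabulate (λ h → proj₁ (All.lookup a′ h)) , p′ ,
          All.tabulate (λ {c} h → let (_ , c₀ , _ , s₀) = All.lookup a′ h in
            es-all {Covered Ms} {c} (All.tabulate {xs = es c} (λ {x} q → covered {c₀} {x} (s₀ {x} q))))

  single : E → Item
  single e = ends G e , [ (e , true) ]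

  singles-valid : ∀ L → All Valid (map single L)
  singles-valid L = Allₚ.map⁺ (All.tabulate (λ _ → cons refl (nil refl) , (λ ()) , [] ∷ []))

  singles-apart : ∀ {L} → Unique L → AllPairs Apart (map single L)
  singles-apart u = AllPairsₚ.map⁺ (AllPairs.map (λ { ne (here refl , here q) → ne q }) u)

  singles-covered : ∀ {L x} → Covered (map single L) x → x ∈ L
  singles-covered {e ∷ L} (here (here refl)) = here refl
  singles-covered {e ∷ L} (there h) = there (singles-covered h)

-- The Moore bound: logarithmic cycles from branching walks.

module Moore (G : Graph) where
  open Cycles G

  NonBacktracking : List Dart → Set
  NonBacktracking = Linked (λ d d′ → edge d ≢ edge d′)

  linked-join : ∀ as {a b bs} → NonBacktracking (as ++ [ a ]) → NonBacktracking (b ∷ bs) → edge a ≢ edge b →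
                NonBacktracking ((as ++ [ a ]) ++ b ∷ bs)
  linked-join [] _ l r = r ∷ l
  linked-join (x ∷ []) (q ∷ _) l r = q ∷ r ∷ l
  linked-join (x ∷ y ∷ as) (q ∷ l′) l r = q ∷ linked-join (y ∷ as) l′ l r

  linked-rev : ∀ {ds} → NonBacktracking ds → NonBacktracking (rev ds)
  linked-rev [] = []
  linked-rev [-] = [-]
  linked-rev {d ∷ d′ ∷ ds} (r ∷ l) = linked-join (rev ds) (linked-rev l) [-] (r ∘ sym)

  linked-prefix : ∀ as {bs} → NonBacktracking (as ++ bs) → NonBacktracking as
  linked-prefix [] _ = []
  linked-prefix (x ∷ []) _ = [-]
  linked-prefix (x ∷ y ∷ as) (r ∷ l) = r ∷ linked-prefix (y ∷ as) l

  linked-tail : ∀ {d ds} → NonBacktracking (d ∷ ds) → NonBacktracking ds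
  linked-tail [-] = []
  linked-tail (_ ∷ l) = l

  nb-close : ∀ {d a} → IsWalk (tgt d) a (src d) → Simple a (src d) → NonBacktracking (d ∷ a) → IsCyc (d ∷ a)
  nb-close {d} {a} w s l = isCyc-∷ w s fresh
    where
    no-flip : ∀ {a} → IsWalk (tgt d) a (src d) → Simple a (src d) → NonBacktracking (d ∷ a) → flip d ∉ a
    no-flip _ _ (r ∷ _) (here refl) = r refl
    no-flip (cons e _) s _ (there h) = uniq-∉ (uniq-tail s) (subst (_∈ _) (sym e) (Mₚ.∈-map⁺ src h))
    fresh : edge d ∉ es a
    fresh h with Mₚ.∈-map⁻ edge h
    ... | d′ , h′ , eq with edge-inv d d′ eq
    ... | inj₁ refl = uniq-∉ s (Mₚ.∈-map⁺ src h′)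
    ... | inj₂ refl = no-flip w s l h′

  -- In the shortest non-simple suffix the first vertex recurs; the stretch up to its recurrence is
  -- otherwise simple and does not backtrack, so it is a cycle.
  nb-cycle : ∀ {u v ds} → IsWalk u ds v → NonBacktracking ds → ¬ Simple ds v → ∃ λ c → IsCyc c × len c ≤ len ds
  nb-cycle (nil _) _ ns = ⊥-elim (ns ([] ∷ []))
  nb-cycle {u} {v} {d ∷ ds} (cons refl w) l ns with uniqueᵛ? (v ∷ tails ds)
  ... | no q with nb-cycle w (linked-tail l) q
  ... | c , C , le = c , C , ℕₚ.m≤n⇒m≤1+n le
  nb-cycle {u} {v} {d ∷ ds} (cons refl w) l ns | yes s with src d Finₚ.≟ v | src d ∈ᵛ? tails ds
  ... | yes refl | _ = d ∷ ds , nb-close w s l , ℕₚ.≤-refl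
  ... | no q | no q′ = ⊥-elim (ns (uniq-↭ (swap (src d) v ↭-refl) (∉-uniq (λ { (here z) → q z ; (there z) → q′ z }) s)))
  ... | no q | yes h with visit w h
  ... | a , d′ , b , refl , e , w₁ , _ = d ∷ a , nb-close w₁ (proj₁ (simple-split a d′ b e s)) (linked-prefix (d ∷ a) l) ,
        s≤s (subst (len a ≤_) (sym (Lₚ.length-++ a)) (ℕₚ.m≤m+n _ _))
    where open Ears G using (simple-split)

  record Branch (p : Dart) : Set where
    field
      left right : Dart
      left-src  : src left ≡ tgt p
      right-src : src right ≡ tgt p
      left-new  : edge p ≢ edge left
      right-new : edge p ≢ edge right
      different : edge left ≢ edge right

  module Tree (branch : ∀ p → Branch p) where
    next : Dart → Bool → Dart
    next p true = Branch.left (branch p)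
    next p false = Branch.right (branch p)

    next-src : ∀ p b → src (next p b) ≡ tgt p
    next-src p true = Branch.left-src (branch p)
    next-src p false = Branch.right-src (branch p)

    next-new : ∀ p b → edge p ≢ edge (next p b)
    next-new p true = Branch.left-new (branch p)
    next-new p false = Branch.right-new (branch p)

    walkAlong : Dart → List Bool → List Dart
    walkAlong p [] = []
    walkAlong p (b ∷ bs) = next p b ∷ walkAlong (next p b) bs

    tip : Dart → List Bool → V
    tip p [] = tgt p
    tip p (b ∷ bs) = tip (next p b) bs

    walkAlong-walk : ∀ p bs → IsWalk (tgt p) (walkAlong p bs) (tip p bs)
    walkAlong-walk p [] = nil refl
    walkAlong-walk p (b ∷ bs) = cons (next-src p b) (walkAlong-walk (next p b) bs)

    walkAlong-nb : ∀ p bs → NonBacktracking (p ∷ walkAlong p bs)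
    walkAlong-nb p [] = [-]
    walkAlong-nb p (b ∷ bs) = next-new p b ∷ walkAlong-nb (next p b) bs

    walkAlong-len : ∀ p bs → len (walkAlong p bs) ≡ len bs
    walkAlong-len p [] = refl
    walkAlong-len p (b ∷ bs) = cong suc (walkAlong-len (next p b) bs)

    Short : ℕ → Set
    Short k = ∃ λ c → IsCyc c × len c ≤ k + k

    -- One walk reversed and followed by the other is closed; it does not backtrack at the junction
    -- because the two first edges differ.
    split : ∀ p bs bs′ → len bs ≡ len bs′ → edge (next p true) ≢ edge (next p false) →
            tip p (true ∷ bs) ≡ tip p (false ∷ bs′) → Short (suc (len bs))
    split p bs bs′ l ne eq with nb-cycle (walk-++ (walk-rev (subst (IsWalk (tgt p) _) eq (walkAlong-walk p (true ∷ bs)))) (walkAlong-walk p (false ∷ bs′)))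
              (linked-join (rev P) (linked-rev (walkAlong-nb (next p true) bs)) (walkAlong-nb (next p false) bs′) ne)
              (λ u → uniq-∉ u (first {ds = P} (walk-rev (subst (IsWalk (tgt p) _) eq (walkAlong-walk p (true ∷ bs)))) ))
      where
      P = walkAlong (next p true) bs
      first : ∀ {x y ds} → IsWalk x (rev ds ++ [ flip (next p true) ]) y → x ∈ tails ((rev ds ++ [ flip (next p true) ]) ++ walkAlong p (false ∷ bs′))
      first {ds = ds} w with rev ds ++ [ flip (next p true) ] in e
      first (cons q _) | _ ∷ _ = here (sym q)
      first {ds = ds} w | [] with Lₚ.++-conicalʳ (rev ds) _ e
      ... | ()
    ... | c , C , le = c , C , ℕₚ.≤-trans le (ℕₚ.≤-reflexive (trans (Lₚ.length-++ (rev (walkAlong p (true ∷ bs))))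
            (cong₂ _+_ (trans (len-rev (walkAlong p (true ∷ bs))) (walkAlong-len p (true ∷ bs)))
              (trans (walkAlong-len p (false ∷ bs′)) (cong suc (sym l))))))

    diverge : ∀ p bs bs′ → len bs ≡ len bs′ → bs ≢ bs′ → tip p bs ≡ tip p bs′ → Short (len bs)
    diverge p [] [] _ ne _ = ⊥-elim (ne refl)
    diverge p (true ∷ bs) (false ∷ bs′) l _ eq = split p bs bs′ (ℕₚ.suc-injective l) (Branch.different (branch p)) eq
    diverge p (false ∷ bs) (true ∷ bs′) l _ eq =
      subst Short (sym l) (split p bs′ bs (sym (ℕₚ.suc-injective l)) (Branch.different (branch p)) (sym eq))
    diverge p (true ∷ bs) (true ∷ bs′) l ne eq with diverge (next p true) bs bs′ (ℕₚ.suc-injective l) (ne ∘ cong (true ∷_)) eq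
    ... | c , C , le = c , C , ℕₚ.≤-trans le (ℕₚ.+-mono-≤ (ℕₚ.n≤1+n _) (ℕₚ.n≤1+n _))
    diverge p (false ∷ bs) (false ∷ bs′) l ne eq with diverge (next p false) bs bs′ (ℕₚ.suc-injective l) (ne ∘ cong (false ∷_)) eq
    ... | c , C , le = c , C , ℕₚ.≤-trans le (ℕₚ.+-mono-≤ (ℕₚ.n≤1+n _) (ℕₚ.n≤1+n _))

    strings : ℕ → List (List Bool)
    strings zero = [ [] ]
    strings (suc k) = map (true ∷_) (strings k) ++ map (false ∷_) (strings k)

    strings-len : ∀ k → len (strings k) ≡ 2 ^ k
    strings-len zero = refl
    strings-len (suc k) = trans (Lₚ.length-++ (map (true ∷_) (strings k))) (cong₂ _+_
      (trans (Lₚ.length-map _ (strings k)) (strings-len k))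
      (trans (trans (Lₚ.length-map _ (strings k)) (strings-len k)) (sym (ℕₚ.+-identityʳ _))))

    strings-∈ : ∀ k {bs} → bs ∈ strings k → len bs ≡ k
    strings-∈ zero (here refl) = refl
    strings-∈ (suc k) h with Mₚ.∈-++⁻ (map (true ∷_) (strings k)) h
    ... | inj₁ q with Mₚ.∈-map⁻ (true ∷_) q
    ... | _ , r , refl = cong suc (strings-∈ k r)
    strings-∈ (suc k) h | inj₂ q with Mₚ.∈-map⁻ (false ∷_) q
    ... | _ , r , refl = cong suc (strings-∈ k r)

    strings-unique : ∀ k → Unique (strings k)
    strings-unique zero = [] ∷ []
    strings-unique (suc k) = Uniqueₚ.++⁺ (Uniqueₚ.map⁺ Lₚ.∷-injectiveʳ (strings-unique k)) (Uniqueₚ.map⁺ Lₚ.∷-injectiveʳ (strings-unique k))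
      λ (h , h′) → case Mₚ.∈-map⁻ (true ∷_) h , Mₚ.∈-map⁻ (false ∷_) h′ of λ { ((_ , _ , refl) , (_ , _ , ())) }

    collision : ∀ {A : Set} (f : A → V) {xs} → Unique xs → ¬ Unique (map f xs) →
                ∃₂ λ x y → x ∈ xs × y ∈ xs × x ≢ y × f x ≡ f y
    collision f {[]} _ nu = ⊥-elim (nu [])
    collision f {x ∷ xs} u nu with f x ∈ᵛ? map f xs
    ... | yes h with Mₚ.∈-map⁻ f h
    ... | y , h′ , eq = x , y , here refl , there h′ , (λ { refl → uniq-∉ u h′ }) , eq
    collision f {x ∷ xs} u nu | no q with collision f (uniq-tail u) (λ z → nu (∉-uniq q z))
    ... | a , b , ha , hb , r = a , b , there ha , there hb , r

    -- Bit strings of length `k` steer `2 ^ k` non-backtracking walks from `p₀`, more than there are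
    -- vertices. Two of them end together, and from where they part they close up to at most 2k
    -- darts.
    moore : ∀ (VS : List V) k → (∀ d → tgt d ∈ VS) → Dart → len VS < 2 ^ k → Short k
    moore VS k in-VS p₀ lt with collision (tip p₀) (strings-unique k) not-unique
      where
      tip-in : ∀ p bs → tip p bs ∈ VS
      tip-in p [] = in-VS p
      tip-in p (b ∷ bs) = tip-in (next p b) bs
      tips⊆ : map (tip p₀) (strings k) ⊆ VS
      tips⊆ h with Mₚ.∈-map⁻ (tip p₀) h
      ... | bs , _ , refl = tip-in p₀ bs
      not-unique : ¬ Unique (map (tip p₀) (strings k))
      not-unique u = ℕₚ.<⇒≱ lt (ℕₚ.≤-trans (ℕₚ.≤-reflexive (sym (trans (Lₚ.length-map _ (strings k)) (strings-len k)))) (uniq⇒len≤ u tips⊆))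
    ... | bs , bs′ , h , h′ , ne , eq = subst Short (strings-∈ k h)
          (diverge p₀ bs bs′ (trans (strings-∈ k h) (sym (strings-∈ k h′))) ne eq)

-- Many edge-disjoint cycles from a surplus of edges over vertices.

len-allFin : ∀ k → len (allFin k) ≡ k
len-allFin k = Lₚ.length-tabulate {n = k} id

filter-split : ∀ {A : Set} {P : A → Set} (P? : ∀ x → Dec (P x)) xs →
               len (filter P? xs) + len (filter (¬? ∘ P?) xs) ≡ len xs
filter-split P? [] = refl
filter-split P? (x ∷ xs) with P? x
... | yes _ = cong suc (filter-split P? xs)
... | no _ = trans (ℕₚ.+-suc _ _) (cong suc (filter-split P? xs))

total : ∀ {A B : Set} {R : A → B → Set} → (∀ a b → Dec (R a b)) → List A → List B → ℕ
total R? [] bs = 0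
total R? (a ∷ as) bs = len (filter (R? a) bs) + total R? as bs

total-∷ : ∀ {A B : Set} {R : A → B → Set} (R? : ∀ a b → Dec (R a b)) as b bs →
          total R? as (b ∷ bs) ≡ len (filter (λ a → R? a b) as) + total R? as bs
total-∷ R? [] b bs = refl
total-∷ R? (a ∷ as) b bs with R? a b | total-∷ R? as b bs
... | yes _ | ih = cong suc (trans (cong (len (filter (R? a) bs) +_) ih)
                     (solve 3 (λ x y z → x :+ (y :+ z) := y :+ (x :+ z)) refl (len (filter (R? a) bs)) (len (filter (λ a → R? a b) as)) (total R? as bs)))
  where open +-*-Solver
... | no _ | ih = trans (cong (len (filter (R? a) bs) +_) ih)
                     (solve 3 (λ x y z → x :+ (y :+ z) := y :+ (x :+ z)) refl (len (filter (R? a) bs)) (len (filter (λ a → R? a b) as)) (total R? as bs))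
  where open +-*-Solver

total-≥ : ∀ {A B : Set} {R : A → B → Set} (R? : ∀ a b → Dec (R a b)) k as bs →
          All (λ a → k ≤ len (filter (R? a) bs)) as → len as * k ≤ total R? as bs
total-≥ R? k [] bs [] = z≤n
total-≥ R? k (a ∷ as) bs (p ∷ ps) = ℕₚ.+-mono-≤ p (total-≥ R? k as bs ps)

total-≤ : ∀ {A B : Set} {R : A → B → Set} (R? : ∀ a b → Dec (R a b)) k as bs →
          (∀ b → len (filter (λ a → R? a b) as) ≤ k) → total R? as bs ≤ len bs * k
total-≤ R? k as [] h = ℕₚ.≤-reflexive (none as)
  where none : ∀ as → total R? as [] ≡ 0
        none [] = refl
        none (a ∷ as) = none as
total-≤ R? k as (b ∷ bs) h = subst (_≤ k + len bs * k) (sym (total-∷ R? as b bs)) (ℕₚ.+-mono-≤ (h b) (total-≤ R? k as bs h))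

module Dense (d : ℕ) (1≤d : 1 ≤ d) (K : ℕ) (bound : (d + d) * K + (d + d) * K < 2 ^ d) where
  D : ℕ
  D = d + d

  1≤D : 1 ≤ D
  1≤D = ℕₚ.≤-trans 1≤d (ℕₚ.m≤m+n d d)

  -- `VS` lists the vertices in use, since graphs made by `build` keep the whole vertex type; `t` is
  -- the induction measure. A surplus of `D` edges pays for each cycle taken out.
  Statement : ℕ → Set
  Statement t = ∀ G VS k → Unique VS → (∀ g → Cycles.tgt G g ∈ VS) → len VS + D * k ≤ m G → k ≤ K →
                m G + len VS ≤ t → Cycles.CyclePacking G k

  module Reduce (G : Graph) (VS : List (Cycles.V G)) (uVS : Unique VS) (in-VS : ∀ g → Cycles.tgt G g ∈ VS) where
    open Cycles G
    open Models G
    open Moore G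

    InVS : List V → Item → Set
    InVS VS ((a , b) , _) = a ∈ VS × b ∈ VS

    build-in : ∀ {VS Ms} → All (InVS VS) Ms → ∀ g → Cycles.tgt (build Ms) g ∈ VS
    build-in a (i , true) = proj₂ (All.lookup a (Mₚ.∈-lookup i))
    build-in a (i , false) = proj₁ (All.lookup a (Mₚ.∈-lookup i))

    edge-in : ∀ e → InVS VS (single e)
    edge-in e = in-VS (e , false) , in-VS (e , true)

    all-edges : List E
    all-edges = allFin (m G)

    forget : ∀ {k Ms} → All Valid Ms → AllPairs Apart Ms → Cycles.CyclePacking (build Ms) k → CyclePacking k
    forget ok ap pk with Lift.lift-packing _ ok ap pk
    ... | cs , l , a , p , _ = cs , l , a , p

    singles-in : ∀ L → All (InVS VS) (map single L)
    singles-in L = Allₚ.map⁺ (All.tabulate (λ {e} _ → edge-in e))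

    take-cycle : ∀ {t k c} → Statement t → IsCyc c → len c ≤ D → len VS + D * suc k ≤ m G → suc k ≤ K →
                 m G + len VS ≤ suc t → CyclePacking (suc k)
    take-cycle {t} {k} {c} IH C lc le kK lt =
      finish (Lift.lift-packing (map single L) (singles-valid L) (singles-apart uL)
             (IH (build (map single L)) VS k uVS (build-in (singles-in L)) le′ (ℕₚ.<⇒≤ kK) lt′))
      where
      L : List E
      L = filter (¬? ∘ (_∈ᵉ? es c)) all-edges
      uL : Unique L
      uL = Uniqueₚ.filter⁺ _ (Uniqueₚ.allFin⁺ (m G))
      lenL : len (map single L) ≡ len L
      lenL = Lₚ.length-map single L
      few : len (filter (_∈ᵉ? es c) all-edges) ≤ D
      few = ℕₚ.≤-trans (uniq⇒len≤ (Uniqueₚ.filter⁺ (_∈ᵉ? es c) (Uniqueₚ.allFin⁺ (m G))) (λ h → proj₂ (Mₚ.∈-filter⁻ (_∈ᵉ? es c) {xs = all-edges} h)))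
              (ℕₚ.≤-trans (ℕₚ.≤-reflexive (Lₚ.length-map edge c)) lc)
      m≤ : m G ≤ D + len L
      m≤ = subst (_≤ D + len L) (trans (filter-split (_∈ᵉ? es c) all-edges) (len-allFin (m G))) (ℕₚ.+-monoˡ-≤ (len L) few)
      le′ : len VS + D * k ≤ len (map single L)
      le′ = subst (len VS + D * k ≤_) (sym lenL) (ℕₚ.+-cancelˡ-≤ D _ _ (ℕₚ.≤-trans (ℕₚ.≤-reflexive
              (trans (solve 3 (λ x y z → x :+ (y :+ z) := y :+ (x :+ z)) refl D (len VS) (D * k))
                (cong (len VS +_) (sym (ℕₚ.*-suc D k))))) (ℕₚ.≤-trans le m≤)))
        where open +-*-Solver
      smaller : len L < m G
      smaller = subst (len L <_) (len-allFin (m G)) (Lₚ.filter-notAll (¬? ∘ (_∈ᵉ? es c)) all-edges (first C))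
        where first : ∀ {c} → IsCyc c → Any (λ e → ¬ e ∉ es c) all-edges
              first {[]} C = ⊥-elim (nonempty C refl)
              first {g ∷ c} C = lose (Mₚ.∈-allFin (edge g)) (λ q → q (here refl))
      lt′ : len (map single L) + len VS ≤ t
      lt′ = ℕₚ.≤-pred (ℕₚ.≤-trans (ℕₚ.+-monoˡ-≤ (len VS) (subst (_< m G) (sym lenL) smaller)) lt)
      finish : (∃ λ cs → len cs ≡ k × All IsCyc cs × AllPairs DisjointEdges cs × All (All (Covered (map single L) ∘ edge)) cs) →
               CyclePacking (suc k)
      finish (cs , l , a , p , cov) = c ∷ cs , cong suc l , C ∷ a , All.tabulate dis ∷ p
        where
        dis : ∀ {c′} → c′ ∈ cs → DisjointEdges c c′
        dis h (q , q′) = proj₂ (Mₚ.∈-filter⁻ (¬? ∘ (_∈ᵉ? es c)) {xs = all-edges}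
          (singles-covered {L} (All.lookup (all-es (All.lookup cov h)) q′))) q

    Incident : V → E → Set
    Incident v e = src (e , true) ≡ v ⊎ src (e , false) ≡ v

    incident? : ∀ v e → Dec (Incident v e)
    incident? v e = (src (e , true) Finₚ.≟ v) ⊎-dec (src (e , false) Finₚ.≟ v)

    incident : V → List E
    incident v = filter (incident? v) all-edges

    others : V → List E
    others v = filter (¬? ∘ incident? v) all-edges

    incident-unique : ∀ v → Unique (incident v)
    incident-unique v = Uniqueₚ.filter⁺ (incident? v) (Uniqueₚ.allFin⁺ (m G))

    incident-others : ∀ v → len (incident v) + len (others v) ≡ m G
    incident-others v = trans (filter-split (incident? v) all-edges) (len-allFin (m G))

    incident-∈ : ∀ {v e} → e ∈ incident v → Incident v e
    incident-∈ {v} h = proj₂ (Mₚ.∈-filter⁻ (incident? v) {xs = all-edges} h)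

    others-∈ : ∀ {v e} → e ∈ others v → ¬ Incident v e
    others-∈ {v} h = proj₂ (Mₚ.∈-filter⁻ (¬? ∘ incident? v) {xs = all-edges} h)

    dart-at : ∀ {v e} → Incident v e → ∃ λ g → src g ≡ v × edge g ≡ e
    dart-at {e = e} (inj₁ q) = (e , true) , q , refl
    dart-at {e = e} (inj₂ q) = (e , false) , q , refl

    without : V → List V
    without v = filter (λ x → ¬? (x Finₚ.≟ v)) VS

    without-< : ∀ {v} → v ∈ VS → len (without v) < len VS
    without-< h = Lₚ.filter-notAll (λ x → ¬? (x Finₚ.≟ _)) VS (lose h (λ q → q refl))

    in-without : ∀ {v x} → x ∈ VS → x ≢ v → x ∈ without v
    in-without h ne = Mₚ.∈-filter⁺ (λ x → ¬? (x Finₚ.≟ _)) h ne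

    others-in : ∀ v → All (InVS (without v)) (map single (others v))
    others-in v = Allₚ.map⁺ (All.tabulate (λ {e} h → in-without (proj₁ (edge-in e)) (others-∈ h ∘ inj₁) ,
                                                       in-without (proj₂ (edge-in e)) (others-∈ h ∘ inj₂)))

    prune : ∀ {t k v} → Statement t → v ∈ VS → len (incident v) ≤ 1 → len VS + D * k ≤ m G → k ≤ K →
            m G + len VS ≤ suc t → CyclePacking k
    prune {t} {k} {v} IH hv few le kK lt = forget (singles-valid (others v)) (singles-apart (Uniqueₚ.filter⁺ _ (Uniqueₚ.allFin⁺ (m G))))
        (IH (build (map single (others v))) (without v) k (Uniqueₚ.filter⁺ _ uVS) (build-in (others-in v))
          (subst (len (without v) + D * k ≤_) (sym lenL) (ℕₚ.≤-pred (ℕₚ.≤-trans (ℕₚ.≤-trans (ℕₚ.+-monoˡ-≤ (D * k) (without-< hv)) le)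
            (subst (_≤ suc (len (others v))) (incident-others v) (ℕₚ.+-monoˡ-≤ (len (others v)) few)))))
          kK
          (ℕₚ.≤-pred (ℕₚ.≤-trans (subst (λ z → z + len (without v) < m G + len VS) (sym lenL)
            (ℕₚ.+-mono-≤-< (subst (len (others v) ≤_) (incident-others v) (ℕₚ.m≤n+m _ (len (incident v)))) (without-< hv))) lt)))
      where
      lenL : len (map single (others v)) ≡ len (others v)
      lenL = Lₚ.length-map single (others v)

    -- The two edges at `v` become one between their other ends, possibly a loop: one edge and one
    -- vertex less. Without loops in the graph, those ends differ from `v`.
    suppress : ∀ {t k v e f} → Statement t → v ∈ VS → (∀ e → src (e , true) ≢ src (e , false)) → incident v ≡ e ∷ f ∷ [] →
               len VS + D * k ≤ m G → k ≤ K → m G + len VS ≤ suc t → CyclePacking k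
    suppress {t} {k} {v} {e} {f} IH hv nl ie le kK lt
      with dart-at (incident-∈ {v} {e} (subst (e ∈_) (sym ie) (here refl)))
         | dart-at (incident-∈ {v} {f} (subst (f ∈_) (sym ie) (there (here refl))))
    ... | x , refl , refl | y , sy , refl =
        forget {Ms = Ms} (ok ∷ singles-valid (others v)) (ap ∷ singles-apart (Uniqueₚ.filter⁺ _ (Uniqueₚ.allFin⁺ (m G))))
          (IH (build Ms) (without v) k (Uniqueₚ.filter⁺ _ uVS) (build-in (inv ∷ others-in v))
            (subst (len (without v) + D * k ≤_) (sym lenL) (ℕₚ.≤-pred (ℕₚ.≤-trans (ℕₚ.≤-trans (ℕₚ.+-monoˡ-≤ (D * k) (without-< hv)) le) (ℕₚ.≤-reflexive (sym me)))))
            kK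
            (ℕₚ.≤-pred (ℕₚ.≤-trans (subst (λ z → z + len (without v) < m G + len VS) (sym lenL)
              (ℕₚ.+-mono-≤-< (subst (suc (len (others v)) ≤_) me (ℕₚ.n≤1+n _)) (without-< hv))) lt)))
      where
      Ms : List Item
      Ms = ((tgt x , tgt y) , flip x ∷ y ∷ []) ∷ map single (others v)
      lenL : len Ms ≡ suc (len (others v))
      lenL = cong suc (Lₚ.length-map single (others v))
      me : suc (suc (len (others v))) ≡ m G
      me = trans (cong (λ z → len z + len (others v)) (sym ie)) (incident-others v)
      x≢y : edge x ≢ edge y
      x≢y eq = uniq-∉ (subst Unique ie (incident-unique v)) (here eq)
      no-loop : ∀ g → tgt g ≢ src g
      no-loop (e , true) eq = nl e (sym eq)
      no-loop (e , false) eq = nl e eq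
      ok : Valid ((tgt x , tgt y) , flip x ∷ y ∷ [])
      ok = cons refl (cons (trans sy (sym (tgt-flip x))) (nil refl)) , (λ ()) , ((x≢y ∷ []) ∷ [] ∷ [])
      inv : InVS (without v) ((tgt x , tgt y) , flip x ∷ y ∷ [])
      inv = in-without (in-VS x) (no-loop x) , in-without (in-VS y) (λ q → no-loop y (trans q (sym sy)))
      touches : ∀ g → src g ≡ v → edge g ∉ others v
      touches (e , true) q h = others-∈ h (inj₁ q)
      touches (e , false) q h = others-∈ h (inj₂ q)
      ap : All (Apart ((tgt x , tgt y) , flip x ∷ y ∷ [])) (map single (others v))
      ap = Allₚ.map⁺ (All.tabulate (λ { h (here refl , here refl) → touches x refl h ; h (there (here refl) , here refl) → touches y sy h }))

    -- Surplus edges are dropped until equality holds, because `short-cycle` bounds the number of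
    -- vertices through the exact number of edges.
    trim : ∀ {t k} → Statement t → len VS + D * k < m G → k ≤ K → m G + len VS ≤ suc t → CyclePacking k
    trim {t} {k} IH le kK lt = forget (singles-valid L) (singles-apart (Uniqueₚ.drop⁺ 1 (Uniqueₚ.allFin⁺ (m G))))
        (IH (build (map single L)) VS k uVS (build-in (singles-in L))
          (subst (len VS + D * k ≤_) (sym lenL) (ℕₚ.m+n≤o⇒m≤o∸n _ (subst (_≤ m G) (sym (ℕₚ.+-comm _ 1)) le)))
          kK
          (subst (λ z → z + len VS ≤ t) (sym lenL) (ℕₚ.≤-pred (ℕₚ.≤-trans
            (ℕₚ.+-monoˡ-≤ (len VS) (ℕₚ.≤-reflexive (ℕₚ.m+[n∸m]≡n (ℕₚ.≤-trans (s≤s z≤n) le)))) lt))))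
      where
      L : List E
      L = drop 1 all-edges
      lenL : len (map single L) ≡ m G ∸ 1
      lenL = trans (Lₚ.length-map single L) (trans (Lₚ.length-drop 1 all-edges) (cong (_∸ 1) (len-allFin (m G))))

    branching : (∀ v → v ∈ VS → 3 ≤ len (incident v)) → ∀ p → Branch p
    branching deg p = go (incident v) refl (deg v (in-VS p)) (incident-unique v)
      where
      v = tgt p
      pair : ∀ {e f} → e ∈ incident v → f ∈ incident v → edge p ≢ e → edge p ≢ f → e ≢ f → Branch p
      pair h h′ ne ne′ ef with dart-at (incident-∈ h) | dart-at (incident-∈ h′)
      ... | x , sx , refl | y , sy , refl = record
        { left = x ; right = y ; left-src = sx ; right-src = sy ; left-new = ne ; right-new = ne′ ; different = ef }
      go : ∀ L → incident v ≡ L → 3 ≤ len L → Unique L → Branch p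
      go [] _ () _
      go (_ ∷ []) _ (s≤s ()) _
      go (_ ∷ _ ∷ []) _ (s≤s (s≤s ())) _
      go (a ∷ b ∷ c ∷ L) eq _ ((ab ∷ ac ∷ _) ∷ (bc ∷ _) ∷ _) with edge p Finₚ.≟ a | edge p Finₚ.≟ b
      ... | yes refl | _ = pair (subst (b ∈_) (sym eq) (there (here refl))) (subst (c ∈_) (sym eq) (there (there (here refl)))) ab ac bc
      ... | no pa | yes refl = pair (subst (a ∈_) (sym eq) (here refl)) (subst (c ∈_) (sym eq) (there (there (here refl)))) pa bc ac
      ... | no pa | no pb = pair (subst (a ∈_) (sym eq) (here refl)) (subst (b ∈_) (sym eq) (there (here refl))) pa pb ab

    few-vertices : (∀ v → v ∈ VS → 3 ≤ len (incident v)) → len VS * 3 ≤ m G * 2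
    few-vertices deg = ℕₚ.≤-trans (total-≥ incident? 3 VS all-edges (All.tabulate (λ {v} h → deg v h)))
      (ℕₚ.≤-trans (total-≤ incident? 2 VS all-edges (λ e → uniq⇒len≤ {ys = src (e , true) ∷ src (e , false) ∷ []}
          (Uniqueₚ.filter⁺ (λ v → incident? v e) uVS) (ends⊆ e)))
        (ℕₚ.≤-reflexive (cong (_* 2) (len-allFin (m G)))))
      where
      ends⊆ : ∀ e → filter (λ v → incident? v e) VS ⊆ src (e , true) ∷ src (e , false) ∷ []
      ends⊆ e h with proj₂ (Mₚ.∈-filter⁻ (λ v → incident? v e) {xs = VS} h)
      ... | inj₁ q = here (sym q)
      ... | inj₂ q = there (here (sym q))

    -- For n vertices and m edges, 3n ≤ 2m = 2n + 2Dk gives n ≤ 2Dk < 2^d, so binary walks of depth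
    -- `d` collide.
    short-cycle : ∀ {k} → (∀ v → v ∈ VS → 3 ≤ len (incident v)) → m G ≡ len VS + D * k → k ≤ K → 1 ≤ k → ∃ λ c → IsCyc c × len c ≤ D
    short-cycle {k} deg me kK 1≤k = Tree.moore (branching deg) VS d in-VS (fromℕ< m>0 , true) small
      where
      open +-*-Solver
      m>0 : 0 < m G
      m>0 = ℕₚ.≤-trans (ℕₚ.*-mono-≤ 1≤D 1≤k) (ℕₚ.≤-trans (ℕₚ.m≤n+m _ (len VS)) (ℕₚ.≤-reflexive (sym me)))
      small : len VS < 2 ^ d
      small = ℕₚ.≤-<-trans (ℕₚ.+-cancelˡ-≤ (len VS + len VS) _ _ (ℕₚ.≤-trans (ℕₚ.≤-reflexive
          (solve 1 (λ x → x :+ x :+ x := x :* con 3) refl (len VS)))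
          (ℕₚ.≤-trans (few-vertices deg) (ℕₚ.≤-reflexive (trans (cong (_* 2) me)
            (solve 2 (λ x y → (x :+ y) :* con 2 := x :+ x :+ (y :+ y)) refl (len VS) (D * k)))))))
        (ℕₚ.≤-<-trans (ℕₚ.+-mono-≤ (ℕₚ.*-monoʳ-≤ D kK) (ℕₚ.*-monoʳ-≤ D kK)) bound)

  many-cycles : ∀ t → Statement t
  many-cycles t G VS zero _ _ _ _ _ = [] , refl , [] , []
  many-cycles zero G VS (suc k) _ _ le _ lt = ⊥-elim (ℕₚ.<⇒≱ (ℕₚ.≤-trans (ℕₚ.*-mono-≤ 1≤D (s≤s (z≤n {k})))
      (ℕₚ.m≤n+m _ (len VS))) (ℕₚ.≤-trans le (ℕₚ.≤-trans (ℕₚ.m≤m+n _ (len VS)) lt)))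
  many-cycles (suc t) G VS (suc k) uVS in-VS le kK lt = loops (Finₚ.any? (λ e → src (e , true) Finₚ.≟ src (e , false)))
    where
    open Cycles G
    open Reduce G VS uVS in-VS
    IH : Statement t
    IH = many-cycles t
    low : (∀ e → src (e , true) ≢ src (e , false)) → ∀ {v} → v ∈ VS → ∀ L → incident v ≡ L → len L ≤ 2 → CyclePacking (suc k)
    low nl hv [] eq _ = prune IH hv (subst (λ z → len z ≤ 1) (sym eq) z≤n) le kK lt
    low nl hv (_ ∷ []) eq _ = prune IH hv (subst (λ z → len z ≤ 1) (sym eq) ℕₚ.≤-refl) le kK lt
    low nl hv (_ ∷ _ ∷ []) eq _ = suppress IH hv nl eq le kK lt
    low nl hv (_ ∷ _ ∷ _ ∷ _) eq (s≤s (s≤s ()))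
    loops : Dec (∃ λ e → src (e , true) ≡ src (e , false)) → CyclePacking (suc k)
    -- Loops go first: a loop is a cycle of length one, and `suppress` relies on their absence.
    loops (yes (e , q)) = take-cycle IH (isCyc-∷ {e , true} {[]} (nil (sym q)) ([] ∷ []) (λ ())) 1≤D le kK lt
    loops (no nl) with any? (λ v → len (incident v) ≤? 2) VS
    ... | yes h with find h
    ... | v , hv , few = low (λ e q → nl (e , q)) hv (incident v) refl few
    loops (no nl) | no high with len VS + D * suc k <? m G
    ... | yes q = trim IH q kK lt
    ... | no q with short-cycle (λ v hv → ℕₚ.≰⇒> (λ few → high (lose hv few))) (ℕₚ.≤-antisym (ℕₚ.≮⇒≥ q) le) kK (s≤s z≤n)
    ... | c , C , lc = take-cycle IH C lc le kK lt

-- Iterating the steps and harvesting cycles from tree and witnesses.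

module Assemble (G : Graph) (ℓ : ℕ) (1≤ℓ : 1 ≤ ℓ) where
  open Steps G public
  open Search ℓ 1≤ℓ public

  longIn? : ∀ X c → Dec (IsCyc c × ℓ ≤ len c × All (λ d → edge d ∉ X) c)
  longIn? X c = cyc? c ×-dec ((ℓ ≤? len c) ×-dec all? (λ d → ¬? (edge d ∈ᵉ? X)) c)

  Hit : ℕ → Set
  Hit b = ∃ λ X → len X ≤ b × (∀ c → ¬ LongIn X c)

  -- Each round deletes a long cycle of fewer than 2ℓ edges; this is the source of the term kℓ.
  peel : ∀ j X → Packing X j ⊎ ∃ λ X′ → len X′ ≤ len X + j * (ℓ + ℓ) × Gap X′
  peel zero X = inj₁ ([] , refl , [] , [])
  peel (suc j) X with anyCyc? (λ c → all? (λ d → ¬? (edge d ∈ᵉ? X)) c ×-dec ((ℓ ≤? len c) ×-dec (len c <? ℓ + ℓ)))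
  ... | no none = inj₂ (X , ℕₚ.m≤m+n _ _ , λ C a l → ℕₚ.≮⇒≥ (λ q → none (_ , C , a , l , q)))
  ... | yes (c , C , a , l , lt) with peel j (es c ++ X)
  ... | inj₂ (X′ , le , g) = inj₂ (X′ , ℕₚ.≤-trans le (begin
          len (es c ++ X) + j * (ℓ + ℓ)        ≡⟨ cong (_+ j * (ℓ + ℓ)) (trans (Lₚ.length-++ (es c)) (ℕₚ.+-comm (len (es c)) (len X))) ⟩
          len X + len (es c) + j * (ℓ + ℓ)     ≡⟨ ℕₚ.+-assoc (len X) _ _ ⟩
          len X + (len (es c) + j * (ℓ + ℓ))   ≤⟨ ℕₚ.+-monoʳ-≤ (len X) (ℕₚ.+-monoˡ-≤ _ (ℕₚ.≤-trans (ℕₚ.≤-reflexive (Lₚ.length-map edge c)) (ℕₚ.<⇒≤ lt))) ⟩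
          len X + suc j * (ℓ + ℓ) ∎) , g)
        where open ℕₚ.≤-Reasoning
  ... | inj₁ (cs , lcs , al , dj) = inj₁ (c ∷ cs , cong suc lcs ,
          (C , l , a) ∷ All.tabulate (λ h → let (C′ , l′ , a′) = All.lookup al h in
             C′ , l′ , All.tabulate (λ q z → All.lookup a′ q (Mₚ.∈-++⁺ʳ (es c) z))) ,
          All.tabulate (λ h (q , q′) → All.lookup (all-es (proj₂ (proj₂ (All.lookup al h)))) q′ (Mₚ.∈-++⁺ˡ q)) ∷ dj)

  Connected : List E → Set
  Connected X = ∀ u v → Conn (λ d → edge d ∉ X) u v

  record Spanning (X : List E) (i : ℕ) : Set where
    field
      root     : V
      reached  : List V
      tree     : List E
      root∈    : root ∈ reached
      uniqueᵛ  : Unique reached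
      uniqueᵉ  : Unique tree
      sizeᵛ    : len reached ≡ suc i
      sizeᵉ    : len tree ≡ i
      avoids   : All (_∉ X) tree
      inside   : ∀ {d} → edge d ∈ tree → src d ∈ reached
      acyclic  : ∀ {c} → IsCyc c → ¬ All (λ d → edge d ∈ tree) c

  -- A path from the root to an unreached vertex contains an edge leaving the reached set. Its far
  -- end is a leaf of the enlarged tree, so no cycle uses that edge.
  spanning : ∀ {X} → Connected X → V → ∀ i → i < n G → Spanning X i
  spanning _ ρ zero _ = record
    { root = ρ ; reached = [ ρ ] ; tree = [] ; root∈ = here refl ; uniqueᵛ = [] ∷ [] ; uniqueᵉ = []
    ; sizeᵛ = refl ; sizeᵉ = refl ; avoids = [] ; inside = λ ()
    ; acyclic = λ { {[]} C _ → nonempty C refl ; {_ ∷ _} C (() ∷ _) } }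
  spanning {X} cX ρ (suc i) lt with spanning cX ρ i (ℕₚ.<⇒≤ lt)
  ... | S with Finₚ.any? (λ v → ¬? (v ∈ᵛ? Spanning.reached S))
  ... | no none = ⊥-elim (ℕₚ.<⇒≱ lt (subst₂ _≤_ (len-allFin (n G)) (Spanning.sizeᵛ S)
                    (uniq⇒len≤ (Uniqueₚ.allFin⁺ (n G)) (λ {v} _ → every v))))
    where every : ∀ v → v ∈ Spanning.reached S
          every v with v ∈ᵛ? Spanning.reached S
          ... | yes h = h
          ... | no h = ⊥-elim (none (v , h))
  ... | yes (v , nv) with cX (Spanning.root S) v
  ... | conn w a with crossing (_∈ᵛ? Spanning.reached S) w (Spanning.root∈ S) nv
  ... | d , hd , s , t = record
    { root = root ; reached = tgt d ∷ reached ; tree = edge d ∷ tree ; root∈ = there root∈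
    ; uniqueᵛ = ∉-uniq t uniqueᵛ
    ; uniqueᵉ = ∉-uniq (λ h → t (inside {flip d} h)) uniqueᵉ
    ; sizeᵛ = cong suc sizeᵛ ; sizeᵉ = cong suc sizeᵉ ; avoids = All.lookup a hd ∷ avoids
    ; inside = λ {g} → inside′ {g} ; acyclic = acyclic′ }
    where
    open Spanning S
    inside′ : ∀ {g} → edge g ∈ edge d ∷ tree → src g ∈ tgt d ∷ reached
    inside′ {g} (there h) = there (inside {g} h)
    inside′ {g} (here eq) with edge-inv d g (sym eq)
    ... | inj₁ refl = there s
    ... | inj₂ refl = here refl
    acyclic′ : ∀ {c} → IsCyc c → ¬ All (λ g → edge g ∈ edge d ∷ tree) c
    acyclic′ {c} C al with edge d ∈ᵉ? es c
    ... | no q = acyclic C (All.tabulate (λ {g} h → case All.lookup al h of λ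
            { (here eq) → ⊥-elim (q (subst (_∈ es c) eq (Mₚ.∈-map⁺ edge h))) ; (there z) → z }))
    ... | yes q with through d C q
    ... | p , C′ , pm = leaf (cyc-∷ C′) (uedges C′) (λ h → All.lookup (all-es al) (Pₚ.∈-resp-↭ pm (there h)))
      where
      leaf : ∀ {p} → IsWalk (tgt d) p (src d) → Unique (es (d ∷ p)) → (∀ {e} → e ∈ es p → e ∈ edge d ∷ tree) → ⊥
      leaf (nil eq) _ _ = t (subst (_∈ reached) (sym eq) s)
      leaf {x ∷ p} (cons eq _) u on with on (here refl)
      ... | here z = uniq-∉ u (here (sym z))
      ... | there z = t (subst (_∈ reached) eq (inside {x} z))

  -- `X₀` is what was deleted before the first step. The cycles found must avoid it, because edges
  -- added to connect the graph are bridges only without `X₀`.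
  record State (X₀ X Y : List E) : Set where
    field
      gap       : Gap X
      connected : Connected X
      uniqueY   : Unique Y
      X₀⊆X      : X₀ ⊆ X
      Y⊆X       : Y ⊆ X
      Y∩X₀      : Disjoint Y X₀
      no-short  : ∀ {c} → IsCyc c → All (λ d → edge d ∉ X ⊎ edge d ∈ Y) c → len c < ℓ → ∀ {e} → e ∈ Y → e ∉ es c

  -- The new witness belonged to the old graph, so short cycles still avoid the old witnesses. A
  -- short cycle through the new one thus lies in the graph before the step and uses no other
  -- removed edge, against `all-long`.
  advance : ∀ {k X₀ X Y} → State X₀ X Y → (s : Separation X k) →
            State X₀ (Separation.removed s ++ X) (Separation.witness s ∷ Y)
  advance {X₀ = X₀} {X} {Y} S s = record
    { gap = λ C a l → gap C (All.tabulate (λ h → weaken (All.lookup a h))) l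
    ; connected = λ u v → conn-map (λ d h → reconnects d h) (connected u v)
    ; uniqueY = ∉-uniq (λ h → removed-∉ witness-∈ (Y⊆X h)) uniqueY
    ; X₀⊆X = λ h → Mₚ.∈-++⁺ʳ removed (X₀⊆X h)
    ; Y⊆X = λ { (here refl) → Mₚ.∈-++⁺ˡ witness-∈ ; (there h) → Mₚ.∈-++⁺ʳ removed (Y⊆X h) }
    ; Y∩X₀ = λ { (here refl , h) → removed-∉ witness-∈ (X₀⊆X h) ; (there h , h′) → Y∩X₀ (h , h′) }
    ; no-short = no-short′ }
    where
    open State S
    open Separation s
    weaken : ∀ {e} → e ∉ removed ++ X → e ∉ X
    weaken q h = q (Mₚ.∈-++⁺ʳ removed h)
    no-short′ : ∀ {c} → IsCyc c → All (λ d → edge d ∉ removed ++ X ⊎ edge d ∈ witness ∷ Y) c → len c < ℓ →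
                ∀ {e} → e ∈ witness ∷ Y → e ∉ es c
    no-short′ {c} C a l {e} he hc = at he
      where
      old : ∀ {d} → d ∈ c → edge d ∉ X ⊎ edge d ∈ Y
      old h with All.lookup a h
      ... | inj₁ q = inj₁ (weaken q)
      ... | inj₂ (here eq) = inj₁ (λ z → removed-∉ witness-∈ (subst (_∈ X) eq z))
      ... | inj₂ (there q) = inj₂ q
      noY : ∀ {e} → e ∈ Y → e ∉ es c
      noY = no-short C (All.tabulate old) l
      at : e ∈ witness ∷ Y → ⊥
      at (there h) = noY h hc
      at (here refl) = ℕₚ.<⇒≱ l (all-long C
          (All.tabulate (λ h → case old h of λ { (inj₁ q) → q ; (inj₂ q) → ⊥-elim (noY q (Mₚ.∈-map⁺ edge h)) }))
          (All.tabulate (λ h → case All.lookup a h of λ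
            { (inj₁ q) → inj₁ (λ z → q (Mₚ.∈-++⁺ˡ z)) ; (inj₂ (here eq)) → inj₂ eq
            ; (inj₂ (there q)) → ⊥-elim (noY q (Mₚ.∈-map⁺ edge h)) }))
          hc)

  weaken-packing : ∀ {X₀ X k} → X₀ ⊆ X → Packing X k → Packing X₀ k
  weaken-packing s (cs , l , a , p) = cs , l , All.tabulate (λ h → let (C , l′ , a′) = All.lookup a h in
    C , l′ , All.tabulate (λ q z → All.lookup a′ q (s z))) , p

  search : ∀ t k {X₀ X Y} → State X₀ X Y → Packing X₀ (suc k) ⊎ (Hit (len X + t * k) ⊎
           ∃₂ λ X′ Y′ → State X₀ X′ Y′ × len Y′ ≡ t + len Y)
  search zero k S = inj₂ (inj₂ (_ , _ , S , refl))
  search (suc t) k {X = X} {Y} S with anyCyc? (λ c → longIn? X c)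
  ... | no none = inj₂ (inj₁ (X , ℕₚ.m≤m+n _ _ , λ c L → none (c , proj₁ L , L)))
  ... | yes (c , _ , L) with separate X (State.gap S) {suc k} L
  ... | inj₁ pk = inj₁ (weaken-packing (State.X₀⊆X S) pk)
  ... | inj₂ s with search t k (advance S s)
  ... | inj₁ pk = inj₁ pk
  ... | inj₂ (inj₂ (X′ , Y′ , S′ , l)) = inj₂ (inj₂ (X′ , Y′ , S′ , trans l (ℕₚ.+-suc t (len Y))))
  ... | inj₂ (inj₁ (X′ , le , none)) = inj₂ (inj₁ (X′ , ℕₚ.≤-trans le (begin
          len (removed ++ X) + t * k     ≡⟨ cong (_+ t * k) (trans (Lₚ.length-++ removed) (ℕₚ.+-comm (len removed) (len X))) ⟩
          len X + len removed + t * k    ≡⟨ ℕₚ.+-assoc (len X) _ _ ⟩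
          len X + (len removed + t * k)  ≤⟨ ℕₚ.+-monoʳ-≤ (len X) (ℕₚ.+-monoˡ-≤ (t * k) (ℕₚ.≤-pred small)) ⟩
          len X + suc t * k ∎) , none))
        where open ℕₚ.≤-Reasoning
              open Separation s

  module _ (d : ℕ) (1≤d : 1 ≤ d) (k : ℕ) (bound : (d + d) * suc k + (d + d) * suc k < 2 ^ d) where
    open Dense d 1≤d (suc k) bound using (D; many-cycles)

    -- The extra one in the size of `Y` makes up for the tree having an edge less than vertices. A
    -- short cycle would contain no witness and so lie in the tree.
    harvest : ∀ {X₀ X Y} → V → State X₀ X Y → len Y ≡ suc (D * suc k) → Packing X₀ (suc k)
    harvest {X₀} {X} {Y} ρ S lY = finish (Lift.lift-packing (map single L) (singles-valid L) (singles-apart uL)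
        (many-cycles _ (build (map single L)) (allFin (n G)) (suc k) (Uniqueₚ.allFin⁺ (n G)) (λ g → Mₚ.∈-allFin _)
          size ℕₚ.≤-refl ℕₚ.≤-refl))
      where
      open State S
      open Models G
      open +-*-Solver using (solve; _:+_; _:=_; con)
      pos : ∀ {j} → Fin j → suc (j ∸ 1) ≡ j
      pos zero = refl
      pos (suc _) = refl
      Sp : Spanning X (n G ∸ 1)
      Sp = spanning connected ρ (n G ∸ 1) (ℕₚ.≤-reflexive (pos ρ))
      open Spanning Sp
      L : List E
      L = tree ++ Y
      uL : Unique L
      uL = Uniqueₚ.++⁺ uniqueᵉ uniqueY (λ (h , h′) → All.lookup avoids h (Y⊆X h′))
      size : len (allFin (n G)) + D * suc k ≤ len (map single L)
      size = ℕₚ.≤-reflexive (begin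
        len (allFin (n G)) + D * suc k        ≡⟨ cong (_+ D * suc k) (trans (len-allFin (n G)) (sym (pos ρ))) ⟩
        suc (n G ∸ 1) + D * suc k             ≡⟨ sym (ℕₚ.+-suc (n G ∸ 1) (D * suc k)) ⟩
        n G ∸ 1 + suc (D * suc k)             ≡⟨ cong₂ _+_ (sym sizeᵉ) (sym lY) ⟩
        len tree + len Y                      ≡⟨ sym (trans (Lₚ.length-map single L) (Lₚ.length-++ tree)) ⟩
        len (map single L) ∎)
        where open ≡-Reasoning
      long : ∀ {c} → IsCyc c → All (Covered (map single L) ∘ edge) c → LongIn X₀ c
      long {c} C cov = C , ℕₚ.≮⇒≥ not-short , All.tabulate (λ {g} h q → case kind h of λ
          { (inj₁ z) → All.lookup avoids z (X₀⊆X q) ; (inj₂ z) → Y∩X₀ (z , q) })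
        where
        kind : ∀ {g} → g ∈ c → edge g ∈ tree ⊎ edge g ∈ Y
        kind h = Mₚ.∈-++⁻ tree (singles-covered {L} (All.lookup cov h))
        not-short : ¬ len c < ℓ
        not-short lt = acyclic C (All.tabulate (λ h → case kind h of λ
            { (inj₁ z) → z
            ; (inj₂ z) → ⊥-elim (no-short C (All.tabulate (λ h → case kind h of λ
                { (inj₁ z) → inj₁ (All.lookup avoids z) ; (inj₂ z) → inj₂ z })) lt z (Mₚ.∈-map⁺ edge h)) }))
      finish : (∃ λ cs → len cs ≡ suc k × All IsCyc cs × AllPairs DisjointEdges cs × All (All (Covered (map single L) ∘ edge)) cs) →
               Packing X₀ (suc k)
      finish (cs , l , a , p , cov) = cs , l , All.tabulate (λ h → long (All.lookup a h) (All.lookup cov h)) , p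

    connected-case : ∀ {X} → V → Gap X → Connected X → Packing X (suc k) ⊎ Hit (len X + suc (D * suc k) * k)
    connected-case {X} ρ g c with search (suc (D * suc k)) k {X} {X} {[]} record
        { gap = g ; connected = c ; uniqueY = [] ; X₀⊆X = id ; Y⊆X = λ () ; Y∩X₀ = λ () ; no-short = λ _ _ _ () }
    ... | inj₁ pk = inj₁ pk
    ... | inj₂ (inj₁ h) = inj₂ h
    ... | inj₂ (inj₂ (X′ , Y′ , S , l)) = inj₁ (harvest ρ S (trans l (ℕₚ.+-identityʳ _)))

-- Disconnected graphs: joining components by bridges.

predecessors : ∀ {k} → List (Fin (suc k)) → List (Fin k)
predecessors [] = []
predecessors (zero ∷ xs) = predecessors xs
predecessors (suc x ∷ xs) = x ∷ predecessors xs

predecessors-len : ∀ {k} (xs : List (Fin (suc k))) → len (predecessors xs) ≤ len xs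
predecessors-len [] = z≤n
predecessors-len (zero ∷ xs) = ℕₚ.m≤n⇒m≤1+n (predecessors-len xs)
predecessors-len (suc x ∷ xs) = s≤s (predecessors-len xs)

predecessors-∈ : ∀ {k} {x : Fin k} {xs} → suc x ∈ xs → x ∈ predecessors xs
predecessors-∈ {xs = zero ∷ xs} (there h) = predecessors-∈ h
predecessors-∈ {xs = suc x ∷ xs} (here refl) = here refl
predecessors-∈ {xs = suc x ∷ xs} (there h) = there (predecessors-∈ h)

suc-∈⁻ : ∀ {k} {x : Fin k} {xs} → suc x ∈ map suc xs → x ∈ xs
suc-∈⁻ h with Mₚ.∈-map⁻ suc h
... | _ , q , refl = q

module Bridge (ℓ : ℕ) (1≤ℓ : 1 ≤ ℓ) (G : Graph) (ρ v : Fin (n G)) (X : List (Fin (m G)))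
              (cut-off : ¬ Walks.Conn G (λ d → proj₁ d ∉ X) ρ v) where

  G⁺ : Graph
  G⁺ = record { n = n G ; m = suc (m G) ; ends = λ { zero → ρ , v ; (suc e) → ends G e } }

  module A = Assemble G ℓ 1≤ℓ
  module A⁺ = Assemble G⁺ ℓ 1≤ℓ

  X⁺ : List (Fin (suc (m G)))
  X⁺ = map suc X

  up : A.Dart → A⁺.Dart
  up (e , b) = suc e , b

  src-up : ∀ d → A⁺.src (up d) ≡ A.src d
  src-up (e , true) = refl
  src-up (e , false) = refl

  tgt-up : ∀ d → A⁺.tgt (up d) ≡ A.tgt d
  tgt-up (e , true) = refl
  tgt-up (e , false) = refl

  tails-up : ∀ p → A⁺.tails (map up p) ≡ A.tails p
  tails-up [] = refl
  tails-up (d ∷ p) = cong₂ _∷_ (src-up d) (tails-up p)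

  es-up : ∀ p → A⁺.es (map up p) ≡ map suc (A.es p)
  es-up [] = refl
  es-up (d ∷ p) = cong (_ ∷_) (es-up p)

  walk-up : ∀ {x p y} → A.IsWalk x p y → A⁺.IsWalk x (map up p) y
  walk-up (A.nil e) = A⁺.nil e
  walk-up (A.cons {d = d} e w) = A⁺.cons (trans (src-up d) e)
    (subst (λ z → A⁺.IsWalk z _ _) (sym (tgt-up d)) (walk-up w))

  walk-down : ∀ {x y} p → A⁺.IsWalk x (map up p) y → A.IsWalk x p y
  walk-down [] (A⁺.nil e) = A.nil e
  walk-down (d ∷ p) (A⁺.cons e w) = A.cons (trans (sym (src-up d)) e)
    (walk-down p (subst (λ z → A⁺.IsWalk z _ _) (tgt-up d) w))

  cyc-up : ∀ {c} → A.IsCyc c → A⁺.IsCyc (map up c)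
  cyc-up {c} (A.cyc w ut ue ne) = A⁺.cyc (walk-up w) (subst Unique (sym (tails-up c)) ut)
    (subst Unique (sym (es-up c)) (Uniqueₚ.map⁺ Finₚ.suc-injective ue)) (λ eq → ne (empty c eq))
    where
    empty : ∀ c → map up c ≡ [] → c ≡ []
    empty [] _ = refl

  cyc-down : ∀ c → A⁺.IsCyc (map up c) → A.IsCyc c
  cyc-down c (A⁺.cyc w ut ue ne) = A.cyc (walk-down c w) (subst Unique (tails-up c) ut)
    (AllPairs.map (λ h e → h (cong suc e)) (AllPairsₚ.map⁻ (subst Unique (es-up c) ue))) (λ { refl → ne refl })

  drop-zero : ∀ c → All (λ d → A⁺.edge d ≢ zero) c → ∃ λ c₀ → c ≡ map up c₀
  drop-zero [] [] = [] , refl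
  drop-zero ((zero , _) ∷ c) (h ∷ _) = ⊥-elim (h refl)
  drop-zero ((suc e , b) ∷ c) (_ ∷ hs) with drop-zero c hs
  ... | c₀ , refl = (e , b) ∷ c₀ , refl

  all-down : ∀ {Y} c → All (λ d → A⁺.edge d ∉ map suc Y) (map up c) → All (λ d → A.edge d ∉ Y) c
  all-down [] _ = []
  all-down (d ∷ c) (h ∷ hs) = (λ q → h (Mₚ.∈-map⁺ suc q)) ∷ all-down c hs

  all-up : ∀ {Y} c → All (λ d → A.edge d ∉ Y) c → All (λ d → A⁺.edge d ∉ map suc Y) (map up c)
  all-up [] _ = []
  all-up (d ∷ c) (h ∷ hs) = (h ∘ suc-∈⁻) ∷ all-up c hs

  -- The rest of a cycle through the new edge would join `ρ` and `v` without `X`.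
  bridge-unused : ∀ {c} → A⁺.IsCyc c → All (λ d → A⁺.edge d ∉ X⁺) c → All (λ d → A⁺.edge d ≢ zero) c
  bridge-unused {c} C a = All.tabulate (λ h eq → bad (subst (_∈ A⁺.es c) eq (Mₚ.∈-map⁺ A⁺.edge h)))
    where
    bad : zero ∉ A⁺.es c
    bad h with A⁺.through (zero , true) C h
    ... | p , C′ , pm with drop-zero p (A⁺.es-all (All.tabulate (λ {e} q eq → A⁺-new (subst (_∈ A⁺.es p) eq q))))
      where
      A⁺-new : zero ∉ A⁺.es p
      A⁺-new = uniq-∉ (A⁺.uedges C′)
    ... | p₀ , refl = cut-off (A.conn-sym (A.conn (walk-down p₀ (A⁺.cyc-∷ C′))
            (all-down p₀ (A⁺.es-all (All.tabulate (λ q → All.lookup (A⁺.all-es a) (Pₚ.∈-resp-↭ pm (there q))))))))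

  long-down : ∀ {c} → A⁺.LongIn X⁺ c → ∃ λ c₀ → c ≡ map up c₀ × A.LongIn X c₀
  long-down {c} (C , l , a) with drop-zero c (bridge-unused C a)
  ... | c₀ , refl = c₀ , refl , cyc-down c₀ C , subst (ℓ ≤_) (Lₚ.length-map up c₀) l , all-down c₀ a

  gap-up : A.Gap X → A⁺.Gap X⁺
  gap-up g {c} C a l with drop-zero c (bridge-unused C a)
  ... | c₀ , refl = subst (ℓ + ℓ ≤_) (sym (Lₚ.length-map up c₀))
          (g (cyc-down c₀ C) (all-down c₀ a) (subst (ℓ ≤_) (Lₚ.length-map up c₀) l))

  disjoint-down : ∀ c c′ → A⁺.DisjointEdges (map up c) (map up c′) → A.DisjointEdges c c′
  disjoint-down c c′ dj (h , h′) = dj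
    (subst (_ ∈_) (sym (es-up c)) (Mₚ.∈-map⁺ suc h) , subst (_ ∈_) (sym (es-up c′)) (Mₚ.∈-map⁺ suc h′))

  packing-down : ∀ {k} → A⁺.Packing X⁺ k → A.Packing X k
  packing-down (cs , refl , a , p) with go cs a
    where
    go : ∀ cs → All (A⁺.LongIn X⁺) cs → ∃ λ cs₀ → cs ≡ map (map up) cs₀ × All (A.LongIn X) cs₀
    go [] [] = [] , refl , []
    go (c ∷ cs) (L ∷ a) with long-down L | go cs a
    ... | c₀ , refl , L₀ | cs₀ , refl , a₀ = c₀ ∷ cs₀ , refl , L₀ ∷ a₀
  ... | cs₀ , refl , a₀ = cs₀ , sym (Lₚ.length-map (map up) cs₀) , a₀ ,
        AllPairs.map {R = λ c c′ → A⁺.DisjointEdges (map up c) (map up c′)} (λ {c} {c′} dj {x} → disjoint-down c c′ dj {x})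
          (AllPairsₚ.map⁻ p)

  hit-down : ∀ {b} → A⁺.Hit b → A.Hit b
  hit-down (Y , le , none) = predecessors Y , ℕₚ.≤-trans (predecessors-len Y) le ,
    λ c (C , l , a) → none (map up c) (cyc-up C , subst (ℓ ≤_) (sym (Lₚ.length-map up c)) l , avoid c a)
    where
    avoid : ∀ c → All (λ d → A.edge d ∉ predecessors Y) c → All (λ d → A⁺.edge d ∉ Y) (map up c)
    avoid [] _ = []
    avoid (d ∷ c) (h ∷ hs) = (h ∘ predecessors-∈) ∷ avoid c hs

  reach-up : ∀ {x y} → A.Conn (λ d → A.edge d ∉ X) x y → A⁺.Conn (λ d → A⁺.edge d ∉ X⁺) x y
  reach-up (A.conn {p} w a) = A⁺.conn (walk-up w) (all-up p a)

  reach-bridge : A⁺.Conn (λ d → A⁺.edge d ∉ X⁺) ρ v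
  reach-bridge = A⁺.conn-dart (zero , true) (λ h → case Mₚ.∈-map⁻ suc h of λ { (_ , _ , ()) })

module _ (ℓ : ℕ) (1≤ℓ : 1 ≤ ℓ) (d : ℕ) (1≤d : 1 ≤ d) (k : ℕ) (bound : (d + d) * suc k + (d + d) * suc k < 2 ^ d) where

  Cost : ℕ
  Cost = suc ((d + d) * suc k) * k

  -- Induction on the vertices not yet known to be joined to `ρ`; a bridge is added where needed.
  -- Neither `Cost` nor the size of `X` changes, so the bound survives.
  gap-case : ∀ (G : Graph) (vs : List (Fin (n G))) (X : List (Fin (m G))) (ρ : Fin (n G)) →
             (∀ v → v ∈ vs ⊎ Walks.Conn G (λ d → proj₁ d ∉ X) ρ v) → Assemble.Gap G ℓ 1≤ℓ X →
             Assemble.Packing G ℓ 1≤ℓ X (suc k) ⊎ Assemble.Hit G ℓ 1≤ℓ (len X + Cost)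
  gap-case G [] X ρ near g = connected-case d 1≤d k bound ρ g
      (λ u v → conn-trans (conn-sym (from u)) (from v))
    where
    open Assemble G ℓ 1≤ℓ
    from : ∀ v → Conn (λ d → edge d ∉ X) ρ v
    from v with near v
    ... | inj₂ c = c
  gap-case G (v ∷ vs) X ρ near g with Walks.conn? G (λ d → ¬? (Walks._∈ᵉ?_ G (proj₁ d) X)) ρ v
  ... | yes c = gap-case G vs X ρ (λ w → case near w of λ
          { (inj₂ q) → inj₂ q ; (inj₁ (here refl)) → inj₂ c ; (inj₁ (there h)) → inj₁ h }) g
  ... | no c = transfer (gap-case G⁺ vs X⁺ ρ (λ w → case near w of λ
          { (inj₂ q) → inj₂ (reach-up q) ; (inj₁ (here refl)) → inj₂ reach-bridge ; (inj₁ (there h)) → inj₁ h }) (gap-up g))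
    where
    open Bridge ℓ 1≤ℓ G ρ v X c
    transfer : A⁺.Packing X⁺ (suc k) ⊎ A⁺.Hit (len X⁺ + Cost) → A.Packing X (suc k) ⊎ A.Hit (len X + Cost)
    transfer (inj₁ p) = inj₁ (packing-down p)
    transfer (inj₂ h) = inj₂ (hit-down (subst (λ z → A⁺.Hit (z + Cost)) (Lₚ.length-map suc X) h))

  pack-or-hit : ∀ G → Assemble.Packing G ℓ 1≤ℓ [] (suc k) ⊎ Assemble.Hit G ℓ 1≤ℓ (suc k * (ℓ + ℓ) + Cost)
  pack-or-hit G with Assemble.peel G ℓ 1≤ℓ (suc k) []
  ... | inj₁ p = inj₁ p
  ... | inj₂ (X , le , g) = at-root (root (n G))
    where
    root : ∀ j → Fin j ⊎ ¬ Fin j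
    root zero = inj₂ λ ()
    root (suc j) = inj₁ zero
    at-root : Fin (n G) ⊎ ¬ Fin (n G) → Assemble.Packing G ℓ 1≤ℓ [] (suc k) ⊎ Assemble.Hit G ℓ 1≤ℓ (suc k * (ℓ + ℓ) + Cost)
    at-root (inj₂ none) = inj₂ ([] , z≤n , λ { c (C , _ , _) → none (Walks.IsCyc.base C) })
    at-root (inj₁ ρ) with gap-case G (allFin (n G)) X ρ (λ v → inj₁ (Mₚ.∈-allFin v)) g
    ... | inj₁ p = inj₁ (Assemble.weaken-packing G ℓ 1≤ℓ (λ ()) p)
    ... | inj₂ (X′ , le′ , none) = inj₂ (X′ , ℕₚ.≤-trans le′ (ℕₚ.+-monoˡ-≤ Cost le) , none)

-- Translation between lists of darts and the given notions of cycle and edge set.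

∣p∪q∣≤ : ∀ {j} (p q : Subset j) → ∣ p ∪ q ∣ ≤ ∣ p ∣ + ∣ q ∣
∣p∪q∣≤ Vec.[] Vec.[] = z≤n
∣p∪q∣≤ (true Vec.∷ p) (true Vec.∷ q) = s≤s (ℕₚ.≤-trans (∣p∪q∣≤ p q) (ℕₚ.+-monoʳ-≤ ∣ p ∣ (ℕₚ.n≤1+n _)))
∣p∪q∣≤ (true Vec.∷ p) (false Vec.∷ q) = s≤s (∣p∪q∣≤ p q)
∣p∪q∣≤ (false Vec.∷ p) (true Vec.∷ q) = ℕₚ.≤-trans (s≤s (∣p∪q∣≤ p q)) (ℕₚ.≤-reflexive (sym (ℕₚ.+-suc _ _)))
∣p∪q∣≤ (false Vec.∷ p) (false Vec.∷ q) = ∣p∪q∣≤ p q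

toSubset : ∀ {j} → List (Fin j) → Subset j
toSubset [] = ∅
toSubset (x ∷ xs) = ⁅ x ⁆ ∪ toSubset xs

toSubset-size : ∀ {j} (xs : List (Fin j)) → ∣ toSubset xs ∣ ≤ len xs
toSubset-size {j} [] = ℕₚ.≤-reflexive (Subsetₚ.∣⊥∣≡0 j)
toSubset-size (x ∷ xs) = ℕₚ.≤-trans (∣p∪q∣≤ ⁅ x ⁆ (toSubset xs))
  (ℕₚ.+-mono-≤ (ℕₚ.≤-reflexive (Subsetₚ.∣⁅x⁆∣≡1 x)) (toSubset-size xs))

toSubset-∈ : ∀ {j} {x : Fin j} {xs} → x ∈ xs → x ∈ˢ toSubset xs
toSubset-∈ {xs = x ∷ xs} (here refl) = Subsetₚ.x∈p∪q⁺ (inj₁ (Subsetₚ.x∈⁅x⁆ x))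
toSubset-∈ {xs = x ∷ xs} (there h) = Subsetₚ.x∈p∪q⁺ (inj₂ (toSubset-∈ h))

lookup-injective : ∀ {A B : Set} (f : A → B) (xs : List A) → Unique (map f xs) → ∀ {i j} →
                   f (lookup xs i) ≡ f (lookup xs j) → i ≡ j
lookup-injective f xs u {i} {j} eq with i Finₚ.≟ j
... | yes q = q
... | no q = ⊥-elim (allPairs-lookup {R = λ x y → f x ≢ f y} (λ h → h ∘ sym) (AllPairsₚ.map⁻ u) i j q eq)

module Conversion (G : Graph) where
  open Walks G

  joins : ∀ d {y} → tgt d ≡ y → Joins G (edge d) (src d) y
  joins (e , true) refl = inj₁ refl
  joins (e , false) refl = inj₂ refl

  walk-step : ∀ {u v} d p → IsWalk u (d ∷ p) v → ∀ i → tgt (lookup (d ∷ p) (inject₁ i)) ≡ src (lookup (d ∷ p) (suc i))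
  walk-step d (x ∷ p) (cons _ (cons e _)) zero = sym e
  walk-step d (x ∷ p) (cons _ w) (suc i) = walk-step x p w i

  walk-end : ∀ {u v} d p → IsWalk u (d ∷ p) v → tgt (lookup (d ∷ p) (fromℕ (len p))) ≡ v
  walk-end d [] (cons _ (nil e)) = e
  walk-end d (x ∷ p) (cons _ w) = walk-end x p w

  toCycle : ∀ c → IsCyc c → Σ (Cycle G) λ C → length C ≡ len c × (∀ a → edges C a ∈ es c)
  toCycle [] C = ⊥-elim (nonempty C refl)
  toCycle (d ∷ p) C = record
    { r = len p
    ; verts = src ∘ lookup (d ∷ p)
    ; edges = edge ∘ lookup (d ∷ p)
    ; verts-inj = lookup-injective src (d ∷ p) (utails C)
    ; edges-inj = lookup-injective edge (d ∷ p) (uedges C)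
    ; step = λ i → joins (lookup (d ∷ p) (inject₁ i)) (walk-step d p W i)
    ; close = joins (lookup (d ∷ p) (fromℕ (len p))) (walk-end d p W)
    } , refl , λ a → Mₚ.∈-map⁺ edge (Mₚ.∈-lookup a)
    where
    W : IsWalk (src d) (d ∷ p) (src d)
    W = cons refl (cyc-∷ C)

  dart-of : ∀ {e u v} → Joins G e u v → ∃ λ d → edge d ≡ e × src d ≡ u × tgt d ≡ v
  dart-of {e} (inj₁ q) = (e , true) , refl , cong proj₁ q , cong proj₂ q
  dart-of {e} (inj₂ q) = (e , false) , refl , cong proj₂ q , cong proj₁ q

  collect : ∀ r (vs : Fin (suc r) → V) (fs : Fin (suc r) → E) →
            (∀ i → Joins G (fs (inject₁ i)) (vs (inject₁ i)) (vs (suc i))) →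
            ∀ {end} → Joins G (fs (fromℕ r)) (vs (fromℕ r)) end →
            ∃ λ ds → IsWalk (vs zero) ds end × tails ds ≡ tabulate vs × es ds ≡ tabulate fs
  collect zero vs fs _ j with dart-of j
  ... | d , p , q , t = [ d ] , cons q (nil t) , cong [_] q , cong [_] p
  collect (suc r) vs fs st j with dart-of (st zero) | collect r (vs ∘ suc) (fs ∘ suc) (st ∘ suc) j
  ... | d , p , q , t | ds , w , ht , he =
        d ∷ ds , cons q (subst (λ z → IsWalk z ds _) (sym t) w) , cong₂ _∷_ q ht , cong₂ _∷_ p he

  fromCycle : (C : Cycle G) → ∃ λ c → IsCyc c × len c ≡ length C × (∀ {e} → e ∈ es c → ∃ λ a → e ≡ edges C a)
  fromCycle C with collect (r C) (verts C) (edges C) (step C) (close C)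
  ... | c , w , ht , he = c ,
        cyc w (subst Unique (sym ht) (Uniqueₚ.tabulate⁺ (verts-inj C)))
              (subst Unique (sym he) (Uniqueₚ.tabulate⁺ (edges-inj C)))
              (λ { refl → case ht of λ () }) ,
        trans (sym (Lₚ.length-map src c)) (trans (cong len ht) (Lₚ.length-tabulate (verts C))) ,
        λ h → Mₚ.∈-tabulate⁻ (subst (_ ∈_) he h)

  module _ (ℓ : ℕ) (1≤ℓ : 1 ≤ ℓ) where
    open Assemble G ℓ 1≤ℓ using (Packing; Hit; LongIn)

    packing⇒cycles : ∀ {k} → Packing [] k → HasEdgeDisjointLongCycles G ℓ k
    packing⇒cycles (cs , refl , a , p) =
      (λ i → proj₁ (C i)) ,
      (λ i → subst (ℓ ≤_) (sym (proj₁ (proj₂ (C i)))) (proj₁ (proj₂ (long i)))) ,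
      λ i j ne x y eq → allPairs-lookup {R = Menger.DisjointEdges G} (λ h (q , q′) → h (q′ , q)) p i j ne
        (proj₂ (proj₂ (C i)) x , subst (_∈ es (lookup cs j)) (sym eq) (proj₂ (proj₂ (C j)) y))
      where
      long : ∀ i → LongIn [] (lookup cs i)
      long i = All.lookup a (Mₚ.∈-lookup i)
      C : ∀ i → Σ (Cycle G) λ C → length C ≡ len (lookup cs i) × (∀ x → edges C x ∈ es (lookup cs i))
      C i = toCycle (lookup cs i) (proj₁ (long i))

    hit⇒subset : ∀ {b} → Hit b → Σ (Subset (m G)) λ X → ∣ X ∣ ≤ b × ¬ HasLongCycleMinus G ℓ X
    hit⇒subset (X , le , none) = toSubset X , ℕₚ.≤-trans (toSubset-size X) le , no-cycle
      where
      no-cycle : ¬ HasLongCycleMinus G ℓ (toSubset X)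
      no-cycle (C , l , av) with fromCycle C
      ... | c , C′ , lc , on = none c (C′ , subst (ℓ ≤_) (sym lc) l ,
            es-all (All.tabulate (λ h q → let (a , eq) = on h in av a (subst (_∈ˢ toSubset X) eq (toSubset-∈ q)))))

-- The choice of the depth and the final constant.

open +-*-Solver

<2^log+1 : ∀ k → k < 2 ^ suc ⌊log₂ k ⌋
<2^log+1 k = ℕₚ.≰⇒> (λ h → ℕₚ.<-irrefl refl (ℕₚ.≤-trans (ℕₚ.≤-reflexive (sym (⌊log₂[2^n]⌋≡n (suc ⌊log₂ k ⌋)))) (⌊log₂⌋-mono-≤ h)))

n≤2^n : ∀ a → a ≤ 2 ^ a
n≤2^n zero = z≤n
n≤2^n (suc a) = ℕₚ.≤-trans (ℕₚ.+-mono-≤ (ℕₚ.m^n>0 2 a) (n≤2^n a)) (ℕₚ.≤-reflexive (cong (2 ^ a +_) (sym (ℕₚ.+-identityʳ _))))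

-- With L = ⌊log₂ k⌋ and P = 2^L we have k < 2P, so 4dk = (32 + 8L)k < 80P^2, which is below 2^(8 +
-- 2L) = 256P^2.
depth : ℕ → ℕ
depth k = 8 + (⌊log₂ k ⌋ + ⌊log₂ k ⌋)

depth-bound : ∀ k → (depth k + depth k) * k + (depth k + depth k) * k < 2 ^ depth k
depth-bound k = begin-strict
  (depth k + depth k) * k + (depth k + depth k) * k
    ≡⟨ solve 2 (λ L k → let d = con 8 :+ (L :+ L) in (d :+ d) :* k :+ (d :+ d) :* k := (con 32 :+ con 8 :* L) :* k) refl L k ⟩
  (32 + 8 * L) * k          <⟨ ℕₚ.*-monoʳ-< (32 + 8 * L) (<2^log+1 k) ⟩
  (32 + 8 * L) * (2 * P)    ≤⟨ ℕₚ.*-monoˡ-≤ (2 * P) (ℕₚ.+-mono-≤ (ℕₚ.*-monoʳ-≤ 32 (ℕₚ.m^n>0 2 L)) (ℕₚ.*-monoʳ-≤ 8 (n≤2^n L))) ⟩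
  (32 * P + 8 * P) * (2 * P) ≤⟨ ℕₚ.m≤m+n _ (176 * (P * P)) ⟩
  (32 * P + 8 * P) * (2 * P) + 176 * (P * P)
    ≡⟨ solve 1 (λ P → (con 32 :* P :+ con 8 :* P) :* (con 2 :* P) :+ con 176 :* (P :* P) := con 256 :* (P :* P)) refl P ⟩
  256 * (P * P)             ≡⟨ cong (256 *_) (sym (ℕₚ.^-distribˡ-+-* 2 L L)) ⟩
  256 * 2 ^ (L + L)         ≡⟨ sym (ℕₚ.^-distribˡ-+-* 2 8 (L + L)) ⟩
  2 ^ depth k ∎
  where
  open ℕₚ.≤-Reasoning
  L P : ℕ
  L = ⌊log₂ k ⌋
  P = 2 ^ L

-- For K ≥ 2 cycles and L = ⌊log₂ K⌋ ≥ 1, the steps cost at most (1 + 16 + 4L)K^2 ≤ 21LK^2; this is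
-- where 21 comes from. The greedy phase needs only the factor 2.
total-cost : ∀ ℓ k → suc k * (ℓ + ℓ) + suc ((depth (suc k) + depth (suc k)) * suc k) * k ≤
             21 * (suc k * suc k * ⌊log₂ suc k ⌋ + suc k * ℓ)
-- For a single cycle the logarithm vanishes, but then no edge is charged to the steps either.
total-cost ℓ zero = begin
  1 * (ℓ + ℓ) + suc ((depth 1 + depth 1) * 1) * 0 ≡⟨ cong (1 * (ℓ + ℓ) +_) (ℕₚ.*-zeroʳ (suc ((depth 1 + depth 1) * 1))) ⟩
  1 * (ℓ + ℓ) + 0      ≤⟨ ℕₚ.m≤m+n _ (19 * ℓ) ⟩
  1 * (ℓ + ℓ) + 0 + 19 * ℓ
    ≡⟨ solve 1 (λ ℓ → con 1 :* (ℓ :+ ℓ) :+ con 0 :+ con 19 :* ℓ := con 21 :* (con 1 :* ℓ)) refl ℓ ⟩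
  21 * (1 * ℓ)         ≤⟨ ℕₚ.*-monoʳ-≤ 21 (ℕₚ.m≤n+m (1 * ℓ) (1 * 1 * ⌊log₂ 1 ⌋)) ⟩
  21 * (1 * 1 * ⌊log₂ 1 ⌋ + 1 * ℓ) ∎
  where open ℕₚ.≤-Reasoning
total-cost ℓ (suc k) = bound ⌊log₂ K ⌋ (⌊log₂⌋-mono-≤ {2} {K} (s≤s (s≤s z≤n)))
  where
  open ℕₚ.≤-Reasoning
  K : ℕ
  K = suc (suc k)
  bound : ∀ L → 1 ≤ L → K * (ℓ + ℓ) + suc ((8 + (L + L) + (8 + (L + L))) * K) * suc k ≤ 21 * (K * K * L + K * ℓ)
  bound (suc L) _ = begin
    K * (ℓ + ℓ) + suc ((8 + (suc L + suc L) + (8 + (suc L + suc L))) * K) * suc k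
      ≤⟨ ℕₚ.+-monoʳ-≤ (K * (ℓ + ℓ)) (ℕₚ.*-mono-≤ {x = suc ((8 + (suc L + suc L) + (8 + (suc L + suc L))) * K)} {y = K + (8 + (suc L + suc L) + (8 + (suc L + suc L))) * K} (s≤s (ℕₚ.m≤n+m _ (suc k))) (ℕₚ.n≤1+n (suc k))) ⟩
    K * (ℓ + ℓ) + (K + (8 + (suc L + suc L) + (8 + (suc L + suc L))) * K) * K
      ≤⟨ ℕₚ.m≤m+n _ (K * ℓ * 19 + 17 * (L * (K * K))) ⟩
    K * (ℓ + ℓ) + (K + (8 + (suc L + suc L) + (8 + (suc L + suc L))) * K) * K + (K * ℓ * 19 + 17 * (L * (K * K)))
      ≡⟨ solve 3 (λ K L ℓ → K :* (ℓ :+ ℓ) :+ (K :+ (con 8 :+ (con 1 :+ L :+ (con 1 :+ L)) :+ (con 8 :+ (con 1 :+ L :+ (con 1 :+ L)))) :* K) :* K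
             :+ (K :* ℓ :* con 19 :+ con 17 :* (L :* (K :* K)))
           := con 21 :* (K :* K :* (con 1 :+ L) :+ K :* ℓ)) refl K L ℓ ⟩
    21 * (K * K * suc L + K * ℓ) ∎

theorem1 : ∃[ c ] (1 ≤ c × ((ℓ k : ℕ) → 1 ≤ ℓ → 1 ≤ k → (G : Graph) →
    HasEdgeDisjointLongCycles G ℓ k
    ⊎ Σ (Subset (m G)) (λ X → (∣ X ∣ ≤ c * (k * k * ⌊log₂ k ⌋ + k * ℓ)) × ¬ HasLongCycleMinus G ℓ X)))
theorem1 = 21 , s≤s z≤n , alternative
  where
  alternative : (ℓ k : ℕ) → 1 ≤ ℓ → 1 ≤ k → (G : Graph) →
    HasEdgeDisjointLongCycles G ℓ k
    ⊎ Σ (Subset (m G)) (λ X → (∣ X ∣ ≤ 21 * (k * k * ⌊log₂ k ⌋ + k * ℓ)) × ¬ HasLongCycleMinus G ℓ X)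
  alternative ℓ (suc k) 1≤ℓ _ G = Sum.map (packing⇒cycles ℓ 1≤ℓ) cheap
      (pack-or-hit ℓ 1≤ℓ (depth (suc k)) (s≤s z≤n) k (depth-bound (suc k)) G)
    where
    open Conversion G
    cheap : Assemble.Hit G ℓ 1≤ℓ (suc k * (ℓ + ℓ) + suc ((depth (suc k) + depth (suc k)) * suc k) * k) →
            Σ (Subset (m G)) (λ X → (∣ X ∣ ≤ 21 * (suc k * suc k * ⌊log₂ suc k ⌋ + suc k * ℓ)) × ¬ HasLongCycleMinus G ℓ X)
    cheap h = let (X , le , none) = hit⇒subset ℓ 1≤ℓ h in X , ℕₚ.≤-trans le (total-cost ℓ k) , none
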